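{- Let $p$ be a prime number, let $(G,\theta)$ be a $p$-oriented profinite group satisfying formal Hilbert 90, and let $\chi_1,\chi_2,\chi_3\in H^1(G,\mathbb Z/p\mathbb Z)$. The following are equivalent: (1) $\chi_1\cup\chi_2=\chi_2\cup\chi_3=0$ in $H^2(G,\mathbb Z/p\mathbb Z)$; (2) the mod $p$ Massey product $\langle\chi_1,\chi_2,\chi_3\rangle$ is defined; (3) the mod $p$ Massey product $\langle\chi_1,\chi_2,\chi_3\rangle$ vanishes.
   Context: A $p$-oriented profinite group is a pair $(G,\theta)$ with $G$ a profinite group and $\theta\colon G\to\mathbb Z_p^\times$ a continuous homomorphism. For $n\geq 1$, $\mathbb Z/p^n\mathbb Z(1)$ denotes the discrete $G$-module $\mathbb Z/p^n\mathbb Z$ with $g\cdot v=\theta(g)v$. $(G,\theta)$ satisfies formal Hilbert 90 if for every open subgroup $H\subset G$ and every $n\geq1$ the reduction map $H^1(H,\mathbb Z/p^n\mathbb Z(1))\to H^1(H,\mathbb Z/p\mathbb Z(1))$ is surjective. Here $\mathbb Z/p\mathbb Z$ (without twist) has trivial $G$-action. Massey products: For a differential graded ring $(A,\partial)$ and $a_1,\dots,a_n\in H^1(A)$ ($n\ge2$), a defining system for $\langle a_1,\dots,a_n\rangle$ is a collection of elements $a_{ij}\in A^1$, $1\le i<j\le n+1$, $(i,j)\ne(1,n+1)$, with $\partial a_{i,i+1}=0$, $a_{i,i+1}$ representing $a_i$, and $\partial(a_{ij})=-\sum_{l=i+1}^{j-1}a_{il}a_{lj}$ for $i<j-1$; its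 value is the class of the 2-cocycle $-\sum_{l=2}^n a_{1l}a_{l,n+1}$ in $H^2(A)$. The Massey product $\langle a_1,\dots,a_n\rangle\subset H^2(A)$ is the set of all values of defining systems; it is defined if nonempty and vanishes if it contains $0$. Mod $p$ Massey products for $G$ are taken in the differential graded ring of continuous inhomogeneous cochains $C^*(G,\mathbb Z/p\mathbb Z)$ with cup product. -}

module Defs where

open import Algebra.Bundles using (Group; AbelianGroup; Ring)
open import Algebra.Morphism.Structures using (module GroupMorphisms)
import Algebra.Properties.AbelianGroup as AbelianGroupProperties
import Algebra.Properties.CommutativeSemigroup as CommutativeSemigroupProperties
import Algebra.Properties.Ring as RingProperties
open import Data.Fin.Base as Fin using (Fin; toℕ)
open import Data.Integer.Base as ℤ using (ℤ; +_; 0ℤ; 1ℤ)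
import Data.Integer.Properties as ℤ
open import Data.Integer.Divisibility.Signed using (_∣_; divides; ∣-trans; ∣m⇒∣-m; ∣m∣n⇒∣m+n; ∣n⇒∣m*n; ∣m⇒∣m*n; ∣ᵤ⇒∣)
open import Data.Integer.Tactic.RingSolver using (solve-∀)
open import Data.List.Relation.Unary.Any using (Any)
open import Data.Nat.Base as ℕ using (ℕ; zero; suc; _≤_; _<_)
import Data.Nat.Divisibility as ℕ
import Data.Nat.Properties as ℕ
open import Data.Product.Base using (Σ; Σ-syntax; ∃; ∃-syntax; _×_; _,_; proj₁; proj₂; uncurry)
open import Data.Product.Relation.Binary.Pointwise.NonDependent using (×-setoid)
open import Data.Unit.Base using (⊤; tt)
open import Data.Vec.Base using (Vec; lookup)
open import Function.Base using (_∘_; id; const)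
open import Function.Definitions using (Surjective)
open import Level using (Lift; lift; lower; 0ℓ; _⊔_) renaming (suc to lsuc)
open import Relation.Binary.Bundles using (Setoid)
open import Relation.Binary.Definitions using (_Respects_)
open import Relation.Binary.PropositionalEquality.Core as ≡ using (_≡_; subst)
import Relation.Binary.Reasoning.Setoid as SetoidReasoning
open import Relation.Nullary.Negation.Core using (¬_)
open import Relation.Unary using (Pred; _∩_; _≐_; _⊆_; ⋃; U)

-- Subsets are predicates.  As sets are setoids, an open subset has to be
-- closed under the setoid equality.
record Topology (X : Setoid 0ℓ 0ℓ) : Set₂ where
  open Setoid X using (Carrier; _≈_)
  field
    Open     : Pred (Pred Carrier 0ℓ) (lsuc 0ℓ)
    resp-≈   : ∀ {V} → Open V → V Respects _≈_
    resp-≐   : ∀ {V W} → V ≐ W → Open V → Open W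
    open-U   : Open U
    open-∩   : ∀ {V W} → Open V → Open W → Open (V ∩ W)
    open-⋃   : ∀ (I : Set) (V : I → Pred Carrier 0ℓ) → (∀ i → Open (V i)) → Open (⋃ I V)

record Space : Set₂ where
  field
    setoid   : Setoid 0ℓ 0ℓ
    topology : Topology setoid
  open Setoid setoid public
  open Topology topology public

IsContinuous : (X Y : Space) → (Space.Carrier X → Space.Carrier Y) → Set₁
IsContinuous X Y f = ∀ V → Space.Open Y V → Space.Open X (V ∘ f)

record ContinuousMap (X Y : Space) : Set₁ where
  no-eta-equality
  private
    module X = Space X
    module Y = Space Y
  field
    to         : X.Carrier → Y.Carrier
    cong       : ∀ {x y} → x X.≈ y → to x Y.≈ to y
    continuous : IsContinuous X Y to

open ContinuousMap using (to)

_∘ᶜ_ : ∀ {X Y Z} → ContinuousMap Y Z → ContinuousMap X Y → ContinuousMap X Z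
g ∘ᶜ f = record
  { to         = to g ∘ to f
  ; cong       = ContinuousMap.cong g ∘ ContinuousMap.cong f
  ; continuous = λ V o → ContinuousMap.continuous f _ (ContinuousMap.continuous g V o)
  }

discrete : Setoid 0ℓ 0ℓ → Space
discrete X = record
  { setoid   = X
  ; topology = record
    { Open   = λ V → Lift (lsuc 0ℓ) (V Respects _≈_)
    ; resp-≈ = lower
    ; resp-≐ = λ (V⊆W , W⊆V) (lift r) → lift (λ eq w → V⊆W (r eq (W⊆V w)))
    ; open-U = lift _
    ; open-∩ = λ (lift r) (lift s) → lift (λ eq (v , w) → r eq v , s eq w)
    ; open-⋃ = λ I V o → lift (λ eq (i , v) → i , lower (o i) eq v)
    }
  }
  where open Setoid X

point : Space
point = discrete (record { Carrier = ⊤ ; _≈_ = λ _ _ → ⊤ })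

infixr 2 _×ₜ_

_×ₜ_ : Space → Space → Space
X ×ₜ Y = record
  { setoid   = ×-setoid X.setoid Y.setoid
  ; topology = record
    { Open   = λ W → ∀ x y → W (x , y) → Box W x y
    ; resp-≈ = λ o {xy} {xy′} eq w →
        let A , B , oA , oB , a , b , sub = o (proj₁ xy) (proj₂ xy) w
        in sub (X.resp-≈ oA (proj₁ eq) a) (Y.resp-≈ oB (proj₂ eq) b)
    ; resp-≐ = λ (V⊆W , W⊆V) o x y w →
        let A , B , oA , oB , a , b , sub = o x y (W⊆V w)
        in A , B , oA , oB , a , b , λ p q → V⊆W (sub p q)
    ; open-U = λ x y _ → U , U , X.open-U , Y.open-U , tt , tt , λ _ _ → tt
    ; open-∩ = λ o o′ x y (v , w) →
        let A , B , oA , oB , a , b , sub = o x y v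
            A′ , B′ , oA′ , oB′ , a′ , b′ , sub′ = o′ x y w
        in A ∩ A′ , B ∩ B′ , X.open-∩ oA oA′ , Y.open-∩ oB oB′ , (a , a′) , (b , b′) ,
           λ (p , p′) (q , q′) → sub p q , sub′ p′ q′
    ; open-⋃ = λ I V o x y (i , v) →
        let A , B , oA , oB , a , b , sub = o i x y v
        in A , B , oA , oB , a , b , λ p q → i , sub p q
    }
  }
  where
  module X = Space X
  module Y = Space Y
  Box : Pred (X.Carrier × Y.Carrier) 0ℓ → X.Carrier → Y.Carrier → Set₁
  Box W x y = Σ[ A ∈ Pred X.Carrier 0ℓ ] Σ[ B ∈ Pred Y.Carrier 0ℓ ]
    X.Open A × Y.Open B × A x × B y × (∀ {x′ y′} → A x′ → B y′ → W (x′ , y′))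

module _ (X Y : Space) where
  private
    module X = Space X
    module Y = Space Y

  proj₁ᶜ : ContinuousMap (X ×ₜ Y) X
  proj₁ᶜ = record
    { to = proj₁ ; cong = proj₁
    ; continuous = λ V o x y v → V , U , o , Y.open-U , v , tt , λ p _ → p }

  proj₂ᶜ : ContinuousMap (X ×ₜ Y) Y
  proj₂ᶜ = record
    { to = proj₂ ; cong = proj₂
    ; continuous = λ V o x y v → U , V , X.open-U , o , tt , v , λ _ q → q }

  module _ (Z : Space) where
    private module Z = Space Z

    ⟨_,_⟩ᶜ : ContinuousMap Z X → ContinuousMap Z Y → ContinuousMap Z (X ×ₜ Y)
    ⟨ f , g ⟩ᶜ = record
      { to   = λ z → to f z , to g z
      ; cong = λ eq → ContinuousMap.cong f eq , ContinuousMap.cong g eq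
      ; continuous = λ W o →
          let box = λ ((z , w) : Σ Z.Carrier (λ z → W (to f z , to g z))) → o (to f z) (to g z) w
              A   = λ i → proj₁ (box i)
              B   = λ i → proj₁ (proj₂ (box i))
              oA  = λ i → proj₁ (proj₂ (proj₂ (box i)))
              oB  = λ i → proj₁ (proj₂ (proj₂ (proj₂ (box i))))
              a   = λ i → proj₁ (proj₂ (proj₂ (proj₂ (proj₂ (box i)))))
              b   = λ i → proj₁ (proj₂ (proj₂ (proj₂ (proj₂ (proj₂ (box i))))))
              sub = λ i {x} {y} → proj₂ (proj₂ (proj₂ (proj₂ (proj₂ (proj₂ (box i)))))) {x} {y}
          in Z.resp-≐ ((λ (i , p , q) → sub i p q) , (λ {z} w → (z , w) , a (z , w) , b (z , w)))
               (Z.open-⋃ _ (λ i → (A i ∘ to f) ∩ (B i ∘ to g)) λ i →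
                 Z.open-∩ (ContinuousMap.continuous f _ (oA i)) (ContinuousMap.continuous g _ (oB i)))
      }

discrete₂ᶜ : (A B C : Setoid 0ℓ 0ℓ) (op : Setoid.Carrier A → Setoid.Carrier B → Setoid.Carrier C) →
             (∀ {x x′ y y′} → Setoid._≈_ A x x′ → Setoid._≈_ B y y′ → Setoid._≈_ C (op x y) (op x′ y′)) →
             ContinuousMap (discrete A ×ₜ discrete B) (discrete C)
discrete₂ᶜ A B C op op-cong = record
  { to   = uncurry op
  ; cong = λ (eq , eq′) → op-cong eq eq′
  ; continuous = λ V (lift r) x y v →
      (λ x′ → x′ A.≈ x) , (λ y′ → y′ B.≈ y) ,
      lift (λ eq p → A.trans (A.sym eq) p) , lift (λ eq p → B.trans (B.sym eq) p) ,
      A.refl , B.refl , λ p q → r (op-cong (A.sym p) (B.sym q)) v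
  }
  where
  module A = Setoid A
  module B = Setoid B

record TopologicalGroup : Set₂ where
  field
    group    : Group 0ℓ 0ℓ
    topology : Topology (Group.setoid group)
  space : Space
  space = record { topology = topology }
  open Group group public
  open Topology topology public using (Open; resp-≈; resp-≐; open-U; open-∩; open-⋃)
  field
    ∙-continuous  : IsContinuous (space ×ₜ space) space (uncurry _∙_)
    ⁻¹-continuous : IsContinuous space space _⁻¹

record OpenSubgroup (G : TopologicalGroup) : Set₁ where
  open TopologicalGroup G
  field
    member    : Pred Carrier 0ℓ
    is-open   : Open member
    ε-member  : member ε
    ∙-member  : ∀ {g h} → member g → member h → member (g ∙ h)
    ⁻¹-member : ∀ {g} → member g → member (g ⁻¹)

subgroup : (G : TopologicalGroup) → OpenSubgroup G → TopologicalGroup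
subgroup G H = record
  { group = record
    { Carrier = Σ G.Carrier member
    ; _≈_     = λ g h → proj₁ g G.≈ proj₁ h
    ; _∙_     = λ (g , p) (h , q) → g G.∙ h , ∙-member p q
    ; ε       = G.ε , ε-member
    ; _⁻¹     = λ (g , p) → g G.⁻¹ , ⁻¹-member p
    ; isGroup = record
      { isMonoid = record
        { isSemigroup = record
          { isMagma = record
            { isEquivalence = record { refl = G.refl ; sym = G.sym ; trans = G.trans }
            ; ∙-cong = G.∙-cong
            }
          ; assoc = λ _ _ _ → G.assoc _ _ _
          }
        ; identity = (λ _ → G.identityˡ _) , (λ _ → G.identityʳ _)
        }
      ; inverse = (λ _ → G.inverseˡ _) , (λ _ → G.inverseʳ _)
      ; ⁻¹-cong = G.⁻¹-cong
      }
    }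
  ; topology = record
    { Open   = λ V → Σ[ W ∈ Pred G.Carrier 0ℓ ] G.Open W × V ≐ (W ∘ proj₁)
    ; resp-≈ = λ (W , oW , V⊆W , W⊆V) eq v → W⊆V (G.resp-≈ oW eq (V⊆W v))
    ; resp-≐ = λ (V⊆V′ , V′⊆V) (W , oW , V⊆W , W⊆V) →
        W , oW , (λ v → V⊆W (V′⊆V v)) , (λ w → V⊆V′ (W⊆V w))
    ; open-U = U , G.open-U , _ , _
    ; open-∩ = λ (W , oW , V⊆W , W⊆V) (W′ , oW′ , V′⊆W′ , W′⊆V′) →
        W ∩ W′ , G.open-∩ oW oW′ , (λ (v , v′) → V⊆W v , V′⊆W′ v′) , (λ (w , w′) → W⊆V w , W′⊆V′ w′)
    ; open-⋃ = λ I V o →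
        ⋃ I (λ i → proj₁ (o i)) , G.open-⋃ I _ (λ i → proj₁ (proj₂ (o i))) ,
        (λ (i , v) → i , proj₁ (proj₂ (proj₂ (o i))) v) ,
        (λ (i , w) → i , proj₂ (proj₂ (proj₂ (o i))) w)
    }
  ; ∙-continuous = λ V (W , oW , V⊆W , W⊆V) (g , p) (h , q) v →
      let A , B , oA , oB , a , b , sub = G.∙-continuous W oW g h (V⊆W v)
      in A ∘ proj₁ , B ∘ proj₁ , (A , oA , id , id) , (B , oB , id , id) , a , b ,
         λ x y → W⊆V (sub x y)
  ; ⁻¹-continuous = λ V (W , oW , V⊆W , W⊆V) →
      W ∘ G._⁻¹ , G.⁻¹-continuous W oW , (λ v → V⊆W v) , (λ w → W⊆V w)
  }
  where
  module G = TopologicalGroup G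
  open OpenSubgroup H

IsCompact : Space → Set₁
IsCompact X = ∀ (I : Set) (V : I → Pred Carrier 0ℓ) → (∀ i → Open (V i)) →
  (∀ x → ∃[ i ] V i x) → ∃[ is ] (∀ x → Any (λ i → V i x) is)
  where open Space X

IsHausdorff : Space → Set₁
IsHausdorff X = ∀ x y → ¬ x ≈ y →
  Σ[ V ∈ Pred Carrier 0ℓ ] Σ[ W ∈ Pred Carrier 0ℓ ]
  Open V × Open W × V x × W y × (∀ z → V z → ¬ W z)
  where open Space X

-- A compact Hausdorff topological group whose open subgroups form a base of
-- neighbourhoods of the identity.
record IsProfinite (G : TopologicalGroup) : Set₁ where
  open TopologicalGroup G
  field
    compact   : IsCompact space
    hausdorff : IsHausdorff space
    base      : ∀ V → Open V → V ε → Σ[ H ∈ OpenSubgroup G ] OpenSubgroup.member H ⊆ V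

record DiscreteModule (G : TopologicalGroup) : Set₁ where
  private module G = TopologicalGroup G
  field
    abelianGroup : AbelianGroup 0ℓ 0ℓ
  open AbelianGroup abelianGroup public
    renaming (_∙_ to infixl 6 _+_; ε to 0#; _⁻¹ to -_; ∙-cong to +-cong; ⁻¹-cong to -‿cong)
  infixr 8 _▷_
  field
    _▷_          : G.Carrier → Carrier → Carrier
    ▷-cong       : ∀ {g h x y} → g G.≈ h → x ≈ y → g ▷ x ≈ h ▷ y
    ▷-identity   : ∀ x → G.ε ▷ x ≈ x
    ▷-assoc      : ∀ g h x → (g G.∙ h) ▷ x ≈ g ▷ (h ▷ x)
    ▷-distrib    : ∀ g x y → g ▷ (x + y) ≈ g ▷ x + g ▷ y
    ▷-continuous : IsContinuous (G.space ×ₜ discrete setoid) (discrete setoid) (uncurry _▷_)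

trivialModule : (G : TopologicalGroup) → AbelianGroup 0ℓ 0ℓ → DiscreteModule G
trivialModule G M = record
  { abelianGroup = M
  ; _▷_          = λ _ x → x
  ; ▷-cong       = λ _ eq → eq
  ; ▷-identity   = λ _ → M.refl
  ; ▷-assoc      = λ _ _ _ → M.refl
  ; ▷-distrib    = λ _ _ _ → M.refl
  ; ▷-continuous = ContinuousMap.continuous (proj₂ᶜ (TopologicalGroup.space G) (discrete M.setoid))
  }
  where module M = AbelianGroup M

restrict : (G : TopologicalGroup) (H : OpenSubgroup G) → DiscreteModule G → DiscreteModule (subgroup G H)
restrict G H M = record
  { abelianGroup = abelianGroup
  ; _▷_          = λ (g , _) x → g ▷ x
  ; ▷-cong       = ▷-cong
  ; ▷-identity   = ▷-identity
  ; ▷-assoc      = λ _ _ → ▷-assoc _ _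
  ; ▷-distrib    = λ _ → ▷-distrib _
  ; ▷-continuous = λ V o (g , p) x v →
      let A , B , oA , oB , a , b , sub = ▷-continuous V o g x v
      in A ∘ proj₁ , B , (A , oA , id , id) , oB , a , b , sub
  }
  where open DiscreteModule M

record ModuleMorphism {G : TopologicalGroup} (M N : DiscreteModule G) : Set where
  private
    module M = DiscreteModule M
    module N = DiscreteModule N
  field
    fun      : M.Carrier → N.Carrier
    fun-cong : ∀ {x y} → x M.≈ y → fun x N.≈ fun y
    fun-+    : ∀ x y → fun (x M.+ y) N.≈ fun x N.+ fun y
    fun-▷    : ∀ g x → fun (g M.▷ x) N.≈ g N.▷ fun x

module _ {c ℓ} (A : AbelianGroup c ℓ) where
  open AbelianGroup A renaming (_∙_ to infixl 6 _+_; ε to 0#; _⁻¹ to -_; ∙-cong to +-cong; ⁻¹-cong to -‿cong)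
  open AbelianGroupProperties A
  open CommutativeSemigroupProperties commutativeSemigroup using (interchange)
  open SetoidReasoning setoid

  -- (-1)ⁿ x
  signed : ℕ → Carrier → Carrier
  signed zero    x = x
  signed (suc n) x = - signed n x

  -- t₀ - t₁ + t₂ - ⋯ ± tₙ₋₁
  alternatingSum : ∀ n → (Fin n → Carrier) → Carrier
  alternatingSum zero    t = 0#
  alternatingSum (suc n) t = t Fin.zero - alternatingSum n (t ∘ Fin.suc)

  sumBelow : ℕ → (ℕ → Carrier) → Carrier
  sumBelow zero    t = 0#
  sumBelow (suc n) t = sumBelow n t + t n

  signed-cong : ∀ n {x y} → x ≈ y → signed n x ≈ signed n y
  signed-cong zero    eq = eq
  signed-cong (suc n) eq = -‿cong (signed-cong n eq)

  signed-0# : ∀ n → signed n 0# ≈ 0#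
  signed-0# zero    = refl
  signed-0# (suc n) = trans (-‿cong (signed-0# n)) ε⁻¹≈ε

  -‿cong₂ : ∀ {x y z w} → x ≈ y → z ≈ w → x - z ≈ y - w
  -‿cong₂ p q = +-cong p (-‿cong q)

  -‿interchange : ∀ x y z w → (x + y) - (z + w) ≈ (x - z) + (y - w)
  -‿interchange x y z w = begin
    (x + y) - (z + w)         ≈⟨ +-cong refl (⁻¹-∙-comm z w) ⟨
    (x + y) + ((- z) + (- w)) ≈⟨ interchange x y (- z) (- w) ⟩
    (x - z) + (y - w)         ∎

  x-x≈0 : ∀ x → x - x ≈ 0#
  x-x≈0 = inverseʳ

  x-0≈x : ∀ x → x - 0# ≈ x
  x-0≈x x = trans (+-cong refl ε⁻¹≈ε) (identityʳ x)

  x-[x-y]≈y : ∀ x y → x - (x - y) ≈ y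
  x-[x-y]≈y x y = begin
    x - (x - y)   ≈⟨ +-cong refl (⁻¹-anti-homo‿- x y) ⟩
    x + (y - x)   ≈⟨ assoc x y (- x) ⟨
    (x + y) - x   ≈⟨ xyx⁻¹≈y x y ⟩
    y             ∎

  x-y≈[x-z]+[z-y] : ∀ x y z → (x - z) + (z - y) ≈ x - y
  x-y≈[x-z]+[z-y] x y z = begin
    (x - z) + (z - y)       ≈⟨ assoc (x - z) z (- y) ⟨
    ((x - z) + z) - y       ≈⟨ +-cong (//-rightDividesˡ z x) refl ⟩
    x - y                   ∎

  alternatingSum-cong : ∀ n {s t : Fin n → Carrier} → (∀ i → s i ≈ t i) →
                        alternatingSum n s ≈ alternatingSum n t
  alternatingSum-cong zero    eq = refl
  alternatingSum-cong (suc n) eq = -‿cong₂ (eq Fin.zero) (alternatingSum-cong n (eq ∘ Fin.suc))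

  alternatingSum-+ : ∀ n (s t : Fin n → Carrier) →
    alternatingSum n (λ i → s i + t i) ≈ alternatingSum n s + alternatingSum n t
  alternatingSum-+ zero    s t = sym (identityʳ 0#)
  alternatingSum-+ (suc n) s t =
    trans (-‿cong₂ refl (alternatingSum-+ n (s ∘ Fin.suc) (t ∘ Fin.suc))) (-‿interchange _ _ _ _)

record Additive {c ℓ c′ ℓ′} (A : AbelianGroup c ℓ) (B : AbelianGroup c′ ℓ′) : Set (c ⊔ ℓ ⊔ c′ ⊔ ℓ′) where
  private
    module A = AbelianGroup A
    module B = AbelianGroup B
  field
    map      : A.Carrier → B.Carrier
    map-cong : ∀ {x y} → x A.≈ y → map x B.≈ map y
    map-∙    : ∀ x y → map (x A.∙ y) B.≈ map x B.∙ map y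

  map-ε : map A.ε B.≈ B.ε
  map-ε = identityʳ-unique _ _ (B.trans (B.sym (map-∙ A.ε A.ε)) (map-cong (A.identityˡ A.ε)))
    where open AbelianGroupProperties B

  map-⁻¹ : ∀ x → map (x A.⁻¹) B.≈ map x B.⁻¹
  map-⁻¹ x = inverseˡ-unique _ _
    (B.trans (B.sym (map-∙ (x A.⁻¹) x)) (B.trans (map-cong (A.inverseˡ x)) map-ε))
    where open AbelianGroupProperties B

  map-- : ∀ x y → map (x A.- y) B.≈ map x B.- map y
  map-- x y = B.trans (map-∙ x (y A.⁻¹)) (B.∙-cong B.refl (map-⁻¹ y))

  map-alternatingSum : ∀ n (t : Fin n → A.Carrier) →
    map (alternatingSum A n t) B.≈ alternatingSum B n (map ∘ t)
  map-alternatingSum zero    t = map-ε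
  map-alternatingSum (suc n) t =
    B.trans (map-- _ _) (-‿cong₂ B B.refl (map-alternatingSum n (t ∘ Fin.suc)))

record CochainComplex : Set₂ where
  field
    degree : ℕ → AbelianGroup (lsuc 0ℓ) 0ℓ
  open module Degree {n} = AbelianGroup (degree n) public
    using (_≈_; _-_)
    renaming (_∙_ to infixl 6 _+_; ε to 0#; _⁻¹ to -_)
  Cochain : ℕ → Set₁
  Cochain n = AbelianGroup.Carrier (degree n)
  field
    ∂      : ∀ {n} → Cochain n → Cochain (suc n)
    ∂-cong : ∀ {n} {x y : Cochain n} → x ≈ y → ∂ x ≈ ∂ y
    ∂-+    : ∀ {n} (x y : Cochain n) → ∂ (x + y) ≈ ∂ x + ∂ y
    ∂∂≈0   : ∀ {n} (x : Cochain n) → ∂ (∂ x) ≈ 0#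

  ∂-additive : ∀ {n} → Additive (degree n) (degree (suc n))
  ∂-additive = record { map = ∂ ; map-cong = ∂-cong ; map-∙ = ∂-+ }

  IsCocycle : ∀ {n} → Cochain n → Set
  IsCocycle x = ∂ x ≈ 0#

  IsCoboundary : ∀ {n} → Cochain n → Set₁
  IsCoboundary {zero}  x = Lift (lsuc 0ℓ) (x ≈ 0#)
  IsCoboundary {suc n} x = Σ[ y ∈ Cochain n ] ∂ y ≈ x

  coboundary-resp-≈ : ∀ {n} {x y : Cochain n} → x ≈ y → IsCoboundary x → IsCoboundary y
  coboundary-resp-≈ {zero}  eq (lift b) = lift (AbelianGroup.trans (degree zero) (AbelianGroup.sym (degree zero) eq) b)
  coboundary-resp-≈ {suc n} eq (b , e)  = b , AbelianGroup.trans (degree (suc n)) e eq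

  coboundary-0# : ∀ {n} → IsCoboundary {n} 0#
  coboundary-0# {zero}  = lift (AbelianGroup.refl (degree zero))
  coboundary-0# {suc n} = 0# , Additive.map-ε ∂-additive

  coboundary-+ : ∀ {n} {x y : Cochain n} → IsCoboundary x → IsCoboundary y → IsCoboundary (x + y)
  coboundary-+ {zero}  (lift b) (lift c) = lift (trans (∙-cong b c) (identityʳ _))
    where open AbelianGroup (degree zero)
  coboundary-+ {suc n} (b , d) (c , e) = b + c , trans (∂-+ b c) (∙-cong d e)
    where open AbelianGroup (degree (suc n)) hiding (_≈_; _-_)

  coboundary-neg : ∀ {n} {x : Cochain n} → IsCoboundary x → IsCoboundary (- x)
  coboundary-neg {zero}  (lift b) = lift (trans (⁻¹-cong b) ε⁻¹≈ε)
    where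
    open AbelianGroup (degree zero)
    open AbelianGroupProperties (degree zero)
  coboundary-neg {suc n} (b , d) = - b , trans (Additive.map-⁻¹ ∂-additive b) (⁻¹-cong d)
    where open AbelianGroup (degree (suc n)) hiding (_≈_; _-_)

cohomology : CochainComplex → ℕ → AbelianGroup (lsuc 0ℓ) (lsuc 0ℓ)
cohomology C n = record
  { Carrier = Σ (Cochain n) IsCocycle
  ; _≈_     = λ (x , _) (y , _) → IsCoboundary (x - y)
  ; _∙_     = λ (x , p) (y , q) → x + y , D′.trans (∂-+ x y) (D′.trans (D′.∙-cong p q) (D′.identityʳ _))
  ; ε       = 0# , Additive.map-ε ∂-additive
  ; _⁻¹     = λ (x , p) → - x , D′.trans (Additive.map-⁻¹ ∂-additive x) (D′.trans (D′.⁻¹-cong p) P′.ε⁻¹≈ε)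
  ; isAbelianGroup = record
    { isGroup = record
      { isMonoid = record
        { isSemigroup = record
          { isMagma = record
            { isEquivalence = record
              { refl  = equal D.refl
              ; sym   = λ b → coboundary-resp-≈ (P.⁻¹-anti-homo‿- _ _) (coboundary-neg b)
              ; trans = λ b c → coboundary-resp-≈ (x-y≈[x-z]+[z-y] (degree n) _ _ _) (coboundary-+ b c)
              }
            ; ∙-cong = λ b c → coboundary-resp-≈ (D.sym (-‿interchange (degree n) _ _ _ _)) (coboundary-+ b c)
            }
          ; assoc = λ _ _ _ → equal (D.assoc _ _ _)
          }
        ; identity = (λ _ → equal (D.identityˡ _)) , (λ _ → equal (D.identityʳ _))
        }
      ; inverse = (λ _ → equal (D.inverseˡ _)) , (λ _ → equal (D.inverseʳ _))
      ; ⁻¹-cong = λ b → coboundary-resp-≈ (D.sym (P.⁻¹-∙-comm _ _)) (coboundary-neg b)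
      }
    ; comm = λ _ _ → equal (D.comm _ _)
    }
  }
  where
  open CochainComplex C
  module D  = AbelianGroup (degree n)
  module D′ = AbelianGroup (degree (suc n))
  module P  = AbelianGroupProperties (degree n)
  module P′ = AbelianGroupProperties (degree (suc n))
  equal : {x y : Cochain n} → x ≈ y → IsCoboundary (x - y)
  equal eq = coboundary-resp-≈ (D.sym (P.x≈y⇒x∙y⁻¹≈ε eq)) coboundary-0#

record DGRing : Set₂ where
  infixl 7 _·_
  field
    complex : CochainComplex
  open CochainComplex complex public
  field
    _·_         : ∀ {i j} → Cochain i → Cochain j → Cochain (i ℕ.+ j)
    1#          : Cochain 0
    ·-cong      : ∀ {i j} {x x′ : Cochain i} {y y′ : Cochain j} → x ≈ x′ → y ≈ y′ → x · y ≈ x′ · y′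
    ·-distribˡ  : ∀ {i j} (x : Cochain i) (y z : Cochain j) → x · (y + z) ≈ x · y + x · z
    ·-distribʳ  : ∀ {i j} (x : Cochain j) (y z : Cochain i) → (y + z) · x ≈ y · x + z · x
    ·-assoc     : ∀ {i j k} (x : Cochain i) (y : Cochain j) (z : Cochain k) →
                  subst Cochain (ℕ.+-assoc i j k) ((x · y) · z) ≈ x · (y · z)
    ·-identityˡ : ∀ {i} (x : Cochain i) → 1# · x ≈ x
    ·-identityʳ : ∀ {i} (x : Cochain i) → subst Cochain (ℕ.+-identityʳ i) (x · 1#) ≈ x
    leibniz     : ∀ {i j} (x : Cochain i) (y : Cochain j) →
                  ∂ (x · y) ≈ ∂ x · y + signed (degree _) i (subst Cochain (ℕ.+-suc i j) (x · ∂ y))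

module _ (A : DGRing) where
  open DGRing A

  private
    H¹ H² : AbelianGroup (lsuc 0ℓ) (lsuc 0ℓ)
    H¹ = cohomology complex 1
    H² = cohomology complex 2

  0·x≈0 : ∀ {i j} (y : Cochain j) → 0# {i} · y ≈ 0#
  0·x≈0 {i} {j} y = Additive.map-ε {A = degree i} {B = degree (i ℕ.+ j)} record
    { map = _· y ; map-cong = λ p → ·-cong p (AbelianGroup.refl (degree j)) ; map-∙ = ·-distribʳ y }

  x·0≈0 : ∀ {i j} (x : Cochain i) → x · 0# {j} ≈ 0#
  x·0≈0 {i} {j} x = Additive.map-ε {A = degree j} {B = degree (i ℕ.+ j)} record
    { map = x ·_ ; map-cong = ·-cong (AbelianGroup.refl (degree i)) ; map-∙ = ·-distribˡ x }

  subst-0# : ∀ {m n} (eq : m ≡ n) {x : Cochain m} → x ≈ 0# → subst Cochain eq x ≈ 0#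
  subst-0# ≡.refl p = p

  cup : ∀ {i j} → AbelianGroup.Carrier (cohomology complex i) → AbelianGroup.Carrier (cohomology complex j) →
        AbelianGroup.Carrier (cohomology complex (i ℕ.+ j))
  cup {i} {j} (x , p) (y , q) = x · y , (begin
    ∂ (x · y)
      ≈⟨ leibniz x y ⟩
    ∂ x · y + signed D i (subst Cochain (ℕ.+-suc i j) (x · ∂ y))
      ≈⟨ D.∙-cong
           (D.trans (·-cong p (AbelianGroup.refl (degree j))) (0·x≈0 y))
           (signed-cong D i (subst-0# (ℕ.+-suc i j)
             (AbelianGroup.trans (degree (i ℕ.+ suc j)) (·-cong (AbelianGroup.refl (degree i)) q) (x·0≈0 x)))) ⟩
    0# + signed D i 0#
      ≈⟨ D.trans (D.identityˡ _) (signed-0# D i) ⟩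
    0# ∎)
    where
    D : AbelianGroup (lsuc 0ℓ) 0ℓ
    D = degree (suc (i ℕ.+ j))
    module D = AbelianGroup D
    open SetoidReasoning D.setoid

  -- Defining systems for ⟨a₁,…,aₙ⟩, n = m + 2.  Indices are 1-based; the
  -- values entry i j outside 1 ≤ i < j ≤ n + 1, (i , j) ≠ (1 , n + 1) are
  -- unconstrained and used nowhere.
  module _ {m : ℕ} (a : Vec (AbelianGroup.Carrier H¹) (2 ℕ.+ m)) where
    private
      n : ℕ
      n = 2 ℕ.+ m

    -- Σ_{l = i+1}^{j-1} entry i l · entry l j
    innerSum : (ℕ → ℕ → Cochain 1) → ℕ → ℕ → Cochain 2
    innerSum entry i j = sumBelow (degree 2) (j ℕ.∸ suc i)
      (λ k → entry i (suc i ℕ.+ k) · entry (suc i ℕ.+ k) j)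

    record DefiningSystem : Set₁ where
      field
        entry      : ℕ → ℕ → Cochain 1
        cocycle    : ∀ (i : Fin n) → IsCocycle (entry (1 ℕ.+ toℕ i) (2 ℕ.+ toℕ i))
        represents : ∀ (i : Fin n) →
          AbelianGroup._≈_ H¹ (entry (1 ℕ.+ toℕ i) (2 ℕ.+ toℕ i) , cocycle i) (lookup a i)
        equation   : ∀ i j → 1 ≤ i → suc i < j → j ≤ 1 ℕ.+ n → ¬ (i ≡ 1 × j ≡ 1 ℕ.+ n) →
          ∂ (entry i j) ≈ - innerSum entry i j

      value : Cochain 2
      value = - innerSum entry 1 (1 ℕ.+ n)

    -- The Massey product as a subset of H², whose elements are cocycles c.
    MasseyProduct : Pred (AbelianGroup.Carrier H²) (lsuc 0ℓ)
    MasseyProduct (c , _) = Σ[ S ∈ DefiningSystem ] IsCoboundary (DefiningSystem.value S - c)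

    MasseyDefined : Set₁
    MasseyDefined = ∃ MasseyProduct

    MasseyVanishes : Set₁
    MasseyVanishes = MasseyProduct (AbelianGroup.ε H²)

constᶜ : (X Y : Space) → Space.Carrier Y → ContinuousMap X Y
constᶜ X Y y = record
  { to = const y
  ; cong = λ _ → Space.refl Y
  ; continuous = λ V _ → X.resp-≐ ((λ (v , _) → v) , (λ v → v , tt)) (X.open-⋃ (V y) (λ _ → U) (λ _ → X.open-U))
  }
  where module X = Space X

module _ (X : Space) (A : AbelianGroup 0ℓ 0ℓ) where
  open AbelianGroup A renaming (_∙_ to infixl 6 _+_; ε to 0#; _⁻¹ to -_; ∙-cong to +-cong; ⁻¹-cong to -‿cong)

  Map : Set₁
  Map = ContinuousMap X (discrete setoid)

  _+ᶜ_ : Map → Map → Map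
  f +ᶜ g = discrete₂ᶜ setoid setoid setoid _+_ +-cong ∘ᶜ ⟨_,_⟩ᶜ _ _ X f g

  0ᶜ : Map
  0ᶜ = constᶜ X _ 0#

  _-ᶜ_ : Map → Map → Map
  f -ᶜ g = discrete₂ᶜ setoid setoid setoid _-_ (-‿cong₂ A) ∘ᶜ ⟨_,_⟩ᶜ _ _ X f g

  -ᶜ_ : Map → Map
  -ᶜ f = discrete₂ᶜ setoid setoid setoid (λ x _ → - x) (λ p _ → -‿cong p) ∘ᶜ ⟨_,_⟩ᶜ _ _ X f f

  alternatingSum-continuous : ∀ n (t : Fin n → Map) →
    IsContinuous X (discrete setoid) (λ x → alternatingSum A n (λ i → to (t i) x))
  alternatingSum-continuous zero    t = ContinuousMap.continuous 0ᶜ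
  alternatingSum-continuous (suc n) t = ContinuousMap.continuous (t Fin.zero -ᶜ record
    { to         = λ x → alternatingSum A n (λ i → to (t (Fin.suc i)) x)
    ; cong       = λ eq → alternatingSum-cong A n (λ i → ContinuousMap.cong (t (Fin.suc i)) eq)
    ; continuous = alternatingSum-continuous n (t ∘ Fin.suc)
    })

  alternatingSumᶜ : ∀ n → (Fin n → Map) → Map
  alternatingSumᶜ n t = record
    { to         = λ x → alternatingSum A n (λ i → to (t i) x)
    ; cong       = λ eq → alternatingSum-cong A n (λ i → ContinuousMap.cong (t i) eq)
    ; continuous = alternatingSum-continuous n t
    }

  continuousMaps : AbelianGroup (lsuc 0ℓ) 0ℓ
  continuousMaps = record
    { Carrier = Map
    ; _≈_     = λ f g → ∀ x → to f x ≈ to g x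
    ; _∙_     = _+ᶜ_
    ; ε       = 0ᶜ
    ; _⁻¹     = -ᶜ_
    ; isAbelianGroup = record
      { isGroup = record
        { isMonoid = record
          { isSemigroup = record
            { isMagma = record
              { isEquivalence = record
                { refl = λ _ → refl ; sym = λ p x → sym (p x) ; trans = λ p q x → trans (p x) (q x) }
              ; ∙-cong = λ p q x → +-cong (p x) (q x)
              }
            ; assoc = λ _ _ _ _ → assoc _ _ _
            }
          ; identity = (λ _ _ → identityˡ _) , (λ _ _ → identityʳ _)
          }
        ; inverse = (λ _ _ → inverseˡ _) , (λ _ _ → inverseʳ _)
        ; ⁻¹-cong = λ p x → -‿cong (p x)
        }
      ; comm = λ _ _ _ → comm _ _
      }
    }

module _ (G : TopologicalGroup) where
  private module G = TopologicalGroup G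

  power : ℕ → Space
  power zero    = point
  power (suc n) = G.space ×ₜ power n

  Tuple : ℕ → Set
  Tuple n = Space.Carrier (power n)

  -- merge n i (g₀ , … , gₙ) is (g₀ , … , gᵢ gᵢ₊₁ , … , gₙ) for i < n,
  -- and (g₀ , … , gₙ₋₁) for i = n.
  merge : ∀ n → Fin (suc n) → Tuple (suc n) → Tuple n
  merge zero    Fin.zero    _           = tt
  merge (suc n) Fin.zero    (g , h , x) = g G.∙ h , x
  merge (suc n) (Fin.suc i) (g , x)     = g , merge n i x

  merge-cong : ∀ n i {x y} → Space._≈_ (power (suc n)) x y → Space._≈_ (power n) (merge n i x) (merge n i y)
  merge-cong zero    Fin.zero    _           = tt
  merge-cong (suc n) Fin.zero    (p , q , r) = G.∙-cong p q , r
  merge-cong (suc n) (Fin.suc i) (p , q)     = p , merge-cong n i q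

  merge-continuous : ∀ n i → IsContinuous (power (suc n)) (power n) (merge n i)
  merge-continuous zero    Fin.zero    = ContinuousMap.continuous (constᶜ (power 1) (power 0) tt)
  merge-continuous (suc n) Fin.zero    = ContinuousMap.continuous
    (⟨_,_⟩ᶜ G.space (power n) (power (2 ℕ.+ n))
      (record { to = uncurry G._∙_ ; cong = uncurry G.∙-cong ; continuous = G.∙-continuous }
        ∘ᶜ ⟨_,_⟩ᶜ G.space G.space (power (2 ℕ.+ n)) (proj₁ᶜ G.space (power (suc n))) (proj₁ᶜ G.space (power n) ∘ᶜ proj₂ᶜ G.space (power (suc n))))
      (proj₂ᶜ G.space (power n) ∘ᶜ proj₂ᶜ G.space (power (suc n))))
  merge-continuous (suc n) (Fin.suc i) = ContinuousMap.continuous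
    (⟨_,_⟩ᶜ G.space (power n) (power (2 ℕ.+ n)) (proj₁ᶜ G.space (power (suc n)))
      (record { to = merge n i ; cong = merge-cong n i ; continuous = merge-continuous n i }
        ∘ᶜ proj₂ᶜ G.space (power (suc n))))

  mergeᶜ : ∀ n → Fin (suc n) → ContinuousMap (power (suc n)) (power n)
  mergeᶜ n i = record { to = merge n i ; cong = merge-cong n i ; continuous = merge-continuous n i }

  module _ (M : DiscreteModule G) where
    open DiscreteModule M
    open SetoidReasoning setoid

    private
      D : AbelianGroup 0ℓ 0ℓ
      D = abelianGroup

    -- Σᵢ (-1)ⁱ f (merge n i x), which is every term of the inhomogeneous
    -- differential but the first, up to sign.
    mergeSum : ∀ n → (Tuple n → Carrier) → Tuple (suc n) → Carrier
    mergeSum n f x = alternatingSum D (suc n) (λ i → f (merge n i x))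

    -- (∂f)(g₀,…,gₙ) = g₀ f(g₁,…,gₙ) + Σ_{0≤i<n} (-1)ⁱ⁺¹ f(…,gᵢgᵢ₊₁,…) + (-1)ⁿ⁺¹ f(g₀,…,gₙ₋₁)
    differential : ∀ n → (Tuple n → Carrier) → Tuple (suc n) → Carrier
    differential n f (g , x) = g ▷ f x - mergeSum n f (g , x)

    differentialᶜ : ∀ n → Map (power n) D → Map (power (suc n)) D
    differentialᶜ n f = record
      { to         = differential n (to f)
      ; cong       = ContinuousMap.cong composite
      ; continuous = ContinuousMap.continuous composite
      }
      where
      composite : Map (power (suc n)) D
      composite = _-ᶜ_ (power (suc n)) D
        (record { to = uncurry _▷_ ; cong = uncurry ▷-cong ; continuous = ▷-continuous }
          ∘ᶜ ⟨_,_⟩ᶜ G.space (discrete setoid) (power (suc n)) (proj₁ᶜ G.space (power n)) (f ∘ᶜ proj₂ᶜ G.space (power n)))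
        (alternatingSumᶜ (power (suc n)) D (suc n) (λ i → f ∘ᶜ mergeᶜ n i))

    ▷-additive : G.Carrier → Additive D D
    ▷-additive g = record { map = g ▷_ ; map-cong = ▷-cong G.refl ; map-∙ = ▷-distrib g }

    mergeSum-- : ∀ n (f h : Tuple n → Carrier) x →
      mergeSum n (λ y → f y - h y) x ≈ mergeSum n f x - mergeSum n h x
    mergeSum-- n f h x = begin
      alternatingSum D (suc n) (λ i → f (merge n i x) - h (merge n i x))
        ≈⟨ alternatingSum-+ D (suc n) (λ i → f (merge n i x)) (λ i → - h (merge n i x)) ⟩
      mergeSum n f x + alternatingSum D (suc n) (λ i → - h (merge n i x))
        ≈⟨ +-cong refl (Additive.map-alternatingSum negation (suc n) (λ i → h (merge n i x))) ⟨
      mergeSum n f x - mergeSum n h x ∎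
      where
      negation : Additive D D
      negation = record
        { map = -_ ; map-cong = -‿cong
        ; map-∙ = λ a b → sym (AbelianGroupProperties.⁻¹-∙-comm D a b) }

    mergeSum-mergeSum : ∀ n (f : Tuple n → Carrier) →
      (∀ {x y} → Space._≈_ (power n) x y → f x ≈ f y) →
      ∀ x → mergeSum (suc n) (mergeSum n f) x ≈ 0#
    mergeSum-mergeSum zero f f-cong (g , h , _) =
      trans (-‿cong₂ D refl (x-0≈x D _)) (x-x≈0 D _)
    mergeSum-mergeSum (suc n) f f-cong (g , h , k , y) = begin
      mergeSum (suc n) f (g G.∙ h , k , y) - mergeSum (suc n) (λ z → f (merge (suc n) Fin.zero (g , z)) - mergeSum n (λ w → f (g , w)) z) (h , k , y)
        ≈⟨ -‿cong₂ D refl (mergeSum-- (suc n) (λ z → f (merge (suc n) Fin.zero (g , z))) (mergeSum n (λ w → f (g , w))) (h , k , y)) ⟩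
      mergeSum (suc n) f (g G.∙ h , k , y) - (mergeSum (suc n) (λ z → f (merge (suc n) Fin.zero (g , z))) (h , k , y) - mergeSum (suc n) (mergeSum n (λ w → f (g , w))) (h , k , y))
        ≈⟨ -‿cong₂ D refl (-‿cong₂ D refl (mergeSum-mergeSum n (λ w → f (g , w)) (λ eq → f-cong (G.refl , eq)) (h , k , y))) ⟩
      mergeSum (suc n) f (g G.∙ h , k , y) - (mergeSum (suc n) (λ z → f (merge (suc n) Fin.zero (g , z))) (h , k , y) - 0#)
        ≈⟨ -‿cong₂ D refl (x-0≈x D _) ⟩
      mergeSum (suc n) f (g G.∙ h , k , y) - mergeSum (suc n) (λ z → f (merge (suc n) Fin.zero (g , z))) (h , k , y)
        ≈⟨ -‿cong₂ D (-‿cong₂ D (f-cong (G.assoc g h k , Space.refl (power n))) refl) refl ⟩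
      mergeSum (suc n) (λ z → f (merge (suc n) Fin.zero (g , z))) (h , k , y) - mergeSum (suc n) (λ z → f (merge (suc n) Fin.zero (g , z))) (h , k , y)
        ≈⟨ x-x≈0 D _ ⟩
      0# ∎

    differential-differential : ∀ n (f : Tuple n → Carrier) →
      (∀ {x y} → Space._≈_ (power n) x y → f x ≈ f y) →
      ∀ x → differential (suc n) (differential n f) x ≈ 0#
    differential-differential n f f-cong (g , h , y) = begin
      g ▷ (h ▷ f y - s) - (((g G.∙ h) ▷ f y - t) - mergeSum n (λ z → g ▷ f z - mergeSum n f (g , z)) (h , y))
        ≈⟨ -‿cong₂ D (Additive.map-- (▷-additive g) _ _) (-‿cong₂ D refl (mergeSum-- n (λ z → g ▷ f z) (λ z → mergeSum n f (g , z)) (h , y))) ⟩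
      (g ▷ (h ▷ f y) - g ▷ s) - (((g G.∙ h) ▷ f y - t) - (mergeSum n (λ z → g ▷ f z) (h , y) - u))
        ≈⟨ -‿cong₂ D (-‿cong₂ D (▷-assoc g h (f y)) refl)
             (-‿cong₂ D refl (-‿cong₂ D (Additive.map-alternatingSum (▷-additive g) (suc n) (λ i → f (merge n i (h , y)))) refl)) ⟨
      ((g G.∙ h) ▷ f y - g ▷ s) - (((g G.∙ h) ▷ f y - t) - (g ▷ s - u))
        ≈⟨ -‿cong₂ D refl (-‿interchange′ _ _ _ _) ⟩
      ((g G.∙ h) ▷ f y - g ▷ s) - (((g G.∙ h) ▷ f y - g ▷ s) - (t - u))
        ≈⟨ x-[x-y]≈y D _ _ ⟩
      t - u
        ≈⟨ mergeSum-mergeSum n f f-cong (g , h , y) ⟩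
      0# ∎
      where
      s t u : Carrier
      s = mergeSum n f (h , y)
      t = mergeSum n f (g G.∙ h , y)
      u = mergeSum n (λ z → mergeSum n f (g , z)) (h , y)
      -‿interchange′ : ∀ a b c d → (a - b) - (c - d) ≈ (a - c) - (b - d)
      -‿interchange′ a b c d = trans (-‿interchange D a (- b) c (- d))
        (+-cong refl (AbelianGroupProperties.⁻¹-∙-comm D b (- d)))

    -- C*(G, M), the complex of continuous inhomogeneous cochains.
    cochains : CochainComplex
    cochains = record
      { degree = λ n → continuousMaps (power n) D
      ; ∂      = λ {n} → differentialᶜ n
      ; ∂-cong = λ {n} p (g , x) → -‿cong₂ D (▷-cong G.refl (p x)) (alternatingSum-cong D (suc n) (λ i → p (merge n i (g , x))))
      ; ∂-+    = λ {n} f h (g , x) → trans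
          (-‿cong₂ D (▷-distrib g _ _) (alternatingSum-+ D (suc n) (λ i → to f (merge n i (g , x))) (λ i → to h (merge n i (g , x)))))
          (-‿interchange D _ _ _ _)
      ; ∂∂≈0   = λ {n} f → differential-differential n (to f) (ContinuousMap.cong f)
      }

    H : ℕ → AbelianGroup (lsuc 0ℓ) (lsuc 0ℓ)
    H = cohomology cochains

  module _ {M N : DiscreteModule G} (φ : ModuleMorphism M N) where
    private
      module M = DiscreteModule M
      module N = DiscreteModule N
      module CM = CochainComplex (cochains M)
      module CN = CochainComplex (cochains N)
    open ModuleMorphism φ

    private
      additive : Additive M.abelianGroup N.abelianGroup
      additive = record { map = fun ; map-cong = fun-cong ; map-∙ = fun-+ }

      funᶜ : ContinuousMap (discrete M.setoid) (discrete N.setoid)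
      funᶜ = record
        { to         = fun
        ; cong       = fun-cong
        ; continuous = λ V o → lift (λ {x} {y} eq v → lower o (fun-cong eq) v)
        }

    mapCochain : ∀ {n} → CM.Cochain n → CN.Cochain n
    mapCochain f = funᶜ ∘ᶜ f

    mapCochain-∂ : ∀ n (f : CM.Cochain n) → CN._≈_ {suc n} (CN.∂ {n} (mapCochain {n} f)) (mapCochain {suc n} (CM.∂ {n} f))
    mapCochain-∂ n f (g , x) = N.sym (N.trans (Additive.map-- additive _ _)
      (-‿cong₂ N.abelianGroup (fun-▷ g (to f x)) (Additive.map-alternatingSum additive (suc n) (λ i → to f (merge n i (g , x))))))

    mapH : ∀ n → AbelianGroup.Carrier (H M n) → AbelianGroup.Carrier (H N n)
    mapH n (f , p) = mapCochain {n} f , λ x →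
      N.trans (mapCochain-∂ n f x) (N.trans (fun-cong (p x)) (Additive.map-ε additive))

  take : ∀ i j → Tuple (i ℕ.+ j) → Tuple i
  take zero    j _       = tt
  take (suc i) j (g , x) = g , take i j x

  drop : ∀ i j → Tuple (i ℕ.+ j) → Tuple j
  drop zero    j x       = x
  drop (suc i) j (_ , x) = drop i j x

  takeᶜ : ∀ i j → ContinuousMap (power (i ℕ.+ j)) (power i)
  takeᶜ i j = record { to = take i j ; cong = tcong i ; continuous = continuous i }
    where
    tcong : ∀ i {x y} → Space._≈_ (power (i ℕ.+ j)) x y → Space._≈_ (power i) (take i j x) (take i j y)
    tcong zero    _       = tt
    tcong (suc i) (p , q) = p , tcong i q
    continuous : ∀ i → IsContinuous (power (i ℕ.+ j)) (power i) (take i j)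
    continuous zero    = ContinuousMap.continuous (constᶜ (power j) point tt)
    continuous (suc i) = ContinuousMap.continuous
      (⟨_,_⟩ᶜ G.space (power i) (power (suc i ℕ.+ j)) (proj₁ᶜ G.space (power (i ℕ.+ j)))
        (record { to = take i j ; cong = tcong i ; continuous = continuous i } ∘ᶜ proj₂ᶜ G.space (power (i ℕ.+ j))))

  dropᶜ : ∀ i j → ContinuousMap (power (i ℕ.+ j)) (power j)
  dropᶜ i j = record { to = drop i j ; cong = dcong i ; continuous = continuous i }
    where
    dcong : ∀ i {x y} → Space._≈_ (power (i ℕ.+ j)) x y → Space._≈_ (power j) (drop i j x) (drop i j y)
    dcong zero    p       = p
    dcong (suc i) (p , q) = dcong i q
    continuous : ∀ i → IsContinuous (power (i ℕ.+ j)) (power j) (drop i j)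
    continuous zero    = λ V o → o
    continuous (suc i) = λ V o → ContinuousMap.continuous (proj₂ᶜ G.space (power (i ℕ.+ j))) _ (continuous i V o)

  module _ (R : Ring 0ℓ 0ℓ) where
    open Ring R hiding (1#)
    open RingProperties R using (x[y-z]≈xy-xz; [y-z]x≈yx-zx)
    open AbelianGroupProperties +-abelianGroup using (⁻¹-∙-comm; ⁻¹-anti-homo‿-)
    open SetoidReasoning setoid

    private
      D : AbelianGroup 0ℓ 0ℓ
      D = +-abelianGroup
      T : DiscreteModule G
      T = trivialModule G +-abelianGroup
      C : CochainComplex
      C = cochains T
      module C = CochainComplex C
      Fun : ℕ → Set
      Fun n = Tuple n → Carrier
      d : ∀ n → Fun n → Fun (suc n)
      d = differential T

    -- (a ∪ b)(g₁,…,gᵢ₊ⱼ) = a(g₁,…,gᵢ) b(gᵢ₊₁,…,gᵢ₊ⱼ)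
    cupFun : ∀ i j → Fun i → Fun j → Fun (i ℕ.+ j)
    cupFun i j a b x = a (take i j x) * b (drop i j x)

    cupCochain : ∀ i j → C.Cochain i → C.Cochain j → C.Cochain (i ℕ.+ j)
    cupCochain i j a b = discrete₂ᶜ setoid setoid setoid _*_ *-cong ∘ᶜ
      ⟨_,_⟩ᶜ (discrete setoid) (discrete setoid) (power (i ℕ.+ j)) (a ∘ᶜ takeᶜ i j) (b ∘ᶜ dropᶜ i j)

    private
      to-subst : ∀ {k l} (q : k ≡ l) (f : C.Cochain k) x → to (subst C.Cochain q f) x ≡ subst Fun q (to f) x
      to-subst ≡.refl f x = ≡.refl

      subst-suc : ∀ {k l} (q : k ≡ l) (f : Fun (suc k)) g x →
        subst Fun (≡.cong suc q) f (g , x) ≡ subst Fun q (λ y → f (g , y)) x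
      subst-suc ≡.refl f g x = ≡.refl

      to-signed : ∀ n i (f : C.Cochain n) x → to (signed (C.degree n) i f) x ≡ signed D i (to f x)
      to-signed n zero    f x = ≡.refl
      to-signed n (suc i) f x = ≡.cong -_ (to-signed n i f x)

      x-[y+z] : ∀ x y z → x - (y + z) ≈ (x - y) - z
      x-[y+z] x y z = trans (+-cong refl (sym (⁻¹-∙-comm y z))) (sym (+-assoc x (- y) (- z)))

      x-[y-z] : ∀ x y z → x - (y - z) ≈ (x - y) + z
      x-[y-z] x y z = begin
        x - (y - z)       ≈⟨ +-cong refl (⁻¹-anti-homo‿- y z) ⟩
        x + (z - y)       ≈⟨ +-cong refl (+-comm z (- y)) ⟩
        x + ((- y) + z)   ≈⟨ +-assoc x (- y) z ⟨
        (x - y) + z       ∎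

      *-alternatingSum : ∀ x n (t : Fin n → Carrier) →
        x * alternatingSum D n t ≈ alternatingSum D n (λ i → x * t i)
      *-alternatingSum x = Additive.map-alternatingSum {A = D} {B = D}
        record { map = x *_ ; map-cong = *-cong refl ; map-∙ = distribˡ x }

    cupFun-leibniz : ∀ i j (a : Fun i) (b : Fun j) x →
      d (i ℕ.+ j) (cupFun i j a b) x ≈
      cupFun (suc i) j (d i a) b x + signed D i (subst Fun (ℕ.+-suc i j) (cupFun i (suc j) a (d j b)) x)
    cupFun-leibniz zero j a b (g , x) = begin
      a tt * b x - alternatingSum D (suc j) (λ l → a tt * b (merge j l (g , x)))
        ≈⟨ -‿cong₂ D refl (*-alternatingSum (a tt) (suc j) (λ l → b (merge j l (g , x)))) ⟨
      a tt * b x - a tt * mergeSum T j b (g , x)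
        ≈⟨ x[y-z]≈xy-xz _ _ _ ⟨
      a tt * d j b (g , x)
        ≈⟨ +-identityˡ _ ⟨
      0# + a tt * d j b (g , x)
        ≈⟨ +-cong (zeroˡ _) refl ⟨
      0# * b x + a tt * d j b (g , x)
        ≈⟨ +-cong (*-cong (x-[x-y]≈y D (a tt) 0#) refl) refl ⟨
      (a tt - (a tt - 0#)) * b x + a tt * d j b (g , x) ∎
    cupFun-leibniz (suc i) j a b (g , h , y) = begin
      A - (B - τ)
        ≈⟨ -‿cong₂ D refl (-‿cong₂ D refl (x-[x-y]≈y D E τ)) ⟨
      A - (B - (E - (E - τ)))
        ≈⟨ -‿cong₂ D refl (-‿cong₂ D refl (-‿cong₂ D refl (cupFun-leibniz i j (λ z → a (g , z)) b (h , y)))) ⟩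
      A - (B - (E - (P + S)))
        ≈⟨ -‿cong₂ D refl (-‿cong₂ D refl (x-[y+z] E P S)) ⟩
      A - (B - ((E - P) - S))
        ≈⟨ -‿cong₂ D refl (x-[y-z] B (E - P) S) ⟩
      A - ((B - (E - P)) + S)
        ≈⟨ x-[y+z] A (B - (E - P)) S ⟩
      (A - (B - (E - P))) - S
        ≈⟨ -‿cong₂ D (-‿cong₂ D refl (-‿cong₂ D refl (-‿cong₂ D refl ([y-z]x≈yx-zx β (a (g , y₁)) τ₁)))) refl ⟩
      (A - (B - (E - (E - τ₁ * β)))) - S
        ≈⟨ -‿cong₂ D (-‿cong₂ D refl (-‿cong₂ D refl (x-[x-y]≈y D E (τ₁ * β)))) refl ⟩
      (A - (B - τ₁ * β)) - S
        ≈⟨ -‿cong₂ D (-‿cong₂ D refl ([y-z]x≈yx-zx β (a (g ∙ h , y₁)) τ₁)) refl ⟨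
      (A - (a (g ∙ h , y₁) - τ₁) * β) - S
        ≈⟨ -‿cong₂ D ([y-z]x≈yx-zx β (a (h , y₁)) _) refl ⟨
      (a (h , y₁) - (a (g ∙ h , y₁) - τ₁)) * β - S
        ≡⟨ ≡.cong (λ w → (a (h , y₁) - (a (g ∙ h , y₁) - τ₁)) * β - signed D i w)
             (subst-suc (ℕ.+-suc i j) (cupFun (suc i) (suc j) a (d j b)) g (h , y)) ⟨
      (a (h , y₁) - (a (g ∙ h , y₁) - τ₁)) * β - signed D i (subst Fun (≡.cong suc (ℕ.+-suc i j)) (cupFun (suc i) (suc j) a (d j b)) (g , h , y)) ∎
      where
      open TopologicalGroup G using (_∙_)
      y₁ : Tuple i
      y₁ = take i j y
      β A B E P S τ τ₁ : Carrier
      β  = b (drop i j y)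
      A  = a (h , y₁) * β
      B  = a (g ∙ h , y₁) * β
      E  = a (g , y₁) * β
      P  = d i (λ z → a (g , z)) (h , y₁) * β
      S  = signed D i (subst Fun (ℕ.+-suc i j) (cupFun i (suc j) (λ z → a (g , z)) (d j b)) (h , y))
      τ  = mergeSum T (i ℕ.+ j) (cupFun i j (λ z → a (g , z)) b) (h , y)
      τ₁ = mergeSum T i (λ z → a (g , z)) (h , y₁)

    cupFun-assoc : ∀ i j k (a : Fun i) (b : Fun j) (c : Fun k) x →
      subst Fun (ℕ.+-assoc i j k) (cupFun (i ℕ.+ j) k (cupFun i j a b) c) x ≈
      cupFun i (j ℕ.+ k) a (cupFun j k b c) x
    cupFun-assoc zero    j k a b c x       = *-assoc _ _ _
    cupFun-assoc (suc i) j k a b c (g , x) = trans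
      (reflexive (subst-suc (ℕ.+-assoc i j k) (cupFun (suc i ℕ.+ j) k (cupFun (suc i) j a b) c) g x))
      (cupFun-assoc i j k (λ y → a (g , y)) b c x)

    cupFun-identityʳ : ∀ i (a : Fun i) x → subst Fun (ℕ.+-identityʳ i) (cupFun i 0 a (const (Ring.1# R))) x ≈ a x
    cupFun-identityʳ zero    a x       = *-identityʳ _
    cupFun-identityʳ (suc i) a (g , x) = trans
      (reflexive (subst-suc (ℕ.+-identityʳ i) (cupFun (suc i) 0 a (const (Ring.1# R))) g x))
      (cupFun-identityʳ i (λ y → a (g , y)) x)

    -- C*(G, R) with the cup product, for a ring R with trivial action.
    cochainRing : DGRing
    cochainRing = record
      { complex     = C
      ; _·_         = λ {i} {j} → cupCochain i j
      ; 1#          = constᶜ (power 0) (discrete setoid) (Ring.1# R)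
      ; ·-cong      = λ {i} {j} {f} {f′} {g} {g′} p q x → *-cong (p (take i j x)) (q (drop i j x))
      ; ·-distribˡ  = λ {i} {j} f g h x → distribˡ (to f (take i j x)) (to g (drop i j x)) (to h (drop i j x))
      ; ·-distribʳ  = λ {i} {j} f g h x → distribʳ (to f (drop i j x)) (to g (take i j x)) (to h (take i j x))
      ; ·-assoc     = λ {i} {j} {k} f g h x → trans
          (reflexive (to-subst (ℕ.+-assoc i j k) (cupCochain (i ℕ.+ j) k (cupCochain i j f g) h) x))
          (cupFun-assoc i j k (to f) (to g) (to h) x)
      ; ·-identityˡ = λ f x → *-identityˡ (to f x)
      ; ·-identityʳ = λ {i} f x → trans
          (reflexive (to-subst (ℕ.+-identityʳ i) (cupCochain i 0 f (constᶜ (power 0) (discrete setoid) (Ring.1# R))) x))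
          (cupFun-identityʳ i (to f) x)
      ; leibniz     = λ {i} {j} f g x → trans
          (cupFun-leibniz i j (to f) (to g) x)
          (+-cong refl (reflexive (≡.sym (≡.trans
            (to-signed (suc (i ℕ.+ j)) i (subst C.Cochain (ℕ.+-suc i j) (cupCochain i (suc j) f (C.∂ {j} g))) x)
            (≡.cong (signed D i) (to-subst (ℕ.+-suc i j) (cupCochain i (suc j) f (C.∂ {j} g)) x))))))
      }

infix 4 _≡_[mod_]

record _≡_[mod_] (x y : ℤ) (m : ℕ) : Set where
  constructor congruent
  field
    difference : + m ∣ x ℤ.- y

module _ {m : ℕ} where
  ≡⇒mod : ∀ {x y} → x ≡ y → x ≡ y [mod m ]
  ≡⇒mod {x} ≡.refl = congruent (divides 0ℤ (ℤ.+-inverseʳ x))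

  mod-refl : ∀ {x} → x ≡ x [mod m ]
  mod-refl = ≡⇒mod ≡.refl

  mod-sym : ∀ {x y} → x ≡ y [mod m ] → y ≡ x [mod m ]
  mod-sym {x} {y} (congruent p) = congruent (subst (+ m ∣_) (lemma x y) (∣m⇒∣-m p))
    where
    lemma : ∀ x y → ℤ.- (x ℤ.- y) ≡ y ℤ.- x
    lemma = solve-∀

  mod-trans : ∀ {x y z} → x ≡ y [mod m ] → y ≡ z [mod m ] → x ≡ z [mod m ]
  mod-trans {x} {y} {z} (congruent p) (congruent q) = congruent (subst (+ m ∣_) (lemma x y z) (∣m∣n⇒∣m+n p q))
    where
    lemma : ∀ x y z → (x ℤ.- y) ℤ.+ (y ℤ.- z) ≡ x ℤ.- z
    lemma = solve-∀

  mod-+ : ∀ {x y z w} → x ≡ y [mod m ] → z ≡ w [mod m ] → x ℤ.+ z ≡ y ℤ.+ w [mod m ]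
  mod-+ {x} {y} {z} {w} (congruent p) (congruent q) = congruent (subst (+ m ∣_) (lemma x y z w) (∣m∣n⇒∣m+n p q))
    where
    lemma : ∀ x y z w → (x ℤ.- y) ℤ.+ (z ℤ.- w) ≡ (x ℤ.+ z) ℤ.- (y ℤ.+ w)
    lemma = solve-∀

  mod-neg : ∀ {x y} → x ≡ y [mod m ] → ℤ.- x ≡ ℤ.- y [mod m ]
  mod-neg {x} {y} (congruent p) = congruent (subst (+ m ∣_) (lemma x y) (∣m⇒∣-m p))
    where
    lemma : ∀ x y → ℤ.- (x ℤ.- y) ≡ (ℤ.- x) ℤ.- (ℤ.- y)
    lemma = solve-∀

  mod-* : ∀ {x y z w} → x ≡ y [mod m ] → z ≡ w [mod m ] → x ℤ.* z ≡ y ℤ.* w [mod m ]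
  mod-* {x} {y} {z} {w} (congruent p) (congruent q) = congruent
    (subst (+ m ∣_) (lemma x y z w) (∣m∣n⇒∣m+n (∣m⇒∣m*n z p) (∣n⇒∣m*n y q)))
    where
    lemma : ∀ x y z w → (x ℤ.- y) ℤ.* z ℤ.+ y ℤ.* (z ℤ.- w) ≡ x ℤ.* z ℤ.- y ℤ.* w
    lemma = solve-∀

mod-∣ : ∀ {k m x y} → k ℕ.∣ m → x ≡ y [mod m ] → x ≡ y [mod k ]
mod-∣ k∣m (congruent p) = congruent (∣-trans (∣ᵤ⇒∣ k∣m) p)

ℤ/_ : ℕ → Ring 0ℓ 0ℓ
ℤ/ m = record
  { Carrier = ℤ
  ; _≈_     = λ x y → x ≡ y [mod m ]
  ; _+_     = ℤ._+_
  ; _*_     = ℤ._*_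
  ; -_      = ℤ.-_
  ; 0#      = 0ℤ
  ; 1#      = 1ℤ
  ; isRing  = record
    { +-isAbelianGroup = record
      { isGroup = record
        { isMonoid = record
          { isSemigroup = record
            { isMagma = record
              { isEquivalence = record { refl = mod-refl ; sym = mod-sym ; trans = mod-trans }
              ; ∙-cong = mod-+
              }
            ; assoc = λ x y z → ≡⇒mod (ℤ.+-assoc x y z)
            }
          ; identity = (λ x → ≡⇒mod (ℤ.+-identityˡ x)) , (λ x → ≡⇒mod (ℤ.+-identityʳ x))
          }
        ; inverse = (λ x → ≡⇒mod (ℤ.+-inverseˡ x)) , (λ x → ≡⇒mod (ℤ.+-inverseʳ x))
        ; ⁻¹-cong = mod-neg
        }
      ; comm = λ x y → ≡⇒mod (ℤ.+-comm x y)
      }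
    ; *-cong     = mod-*
    ; *-assoc    = λ x y z → ≡⇒mod (ℤ.*-assoc x y z)
    ; *-identity = (λ x → ≡⇒mod (ℤ.*-identityˡ x)) , (λ x → ≡⇒mod (ℤ.*-identityʳ x))
    ; distrib    = (λ x y z → ≡⇒mod (ℤ.*-distribˡ-+ x y z)) , (λ x y z → ≡⇒mod (ℤ.*-distribʳ-+ x y z))
    }
  }

-- ℤₚ = lim ℤ/pⁿ
record PAdicInteger (p : ℕ) : Set where
  field
    residue    : ℕ → ℤ
    compatible : ∀ n → residue (suc n) ≡ residue n [mod p ℕ.^ n ]

open PAdicInteger using (residue)

_*ₚ_ : ∀ {p} → PAdicInteger p → PAdicInteger p → PAdicInteger p
x *ₚ y = record
  { residue    = λ n → residue x n ℤ.* residue y n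
  ; compatible = λ n → mod-* (PAdicInteger.compatible x n) (PAdicInteger.compatible y n)
  }

record PAdicUnit (p : ℕ) : Set where
  field
    value      : PAdicInteger p
    inverse    : PAdicInteger p
    isInverse  : ∀ n → residue value n ℤ.* residue inverse n ≡ 1ℤ [mod p ℕ.^ n ]

open PAdicUnit using (value)

residueᵤ : ∀ {p} → PAdicUnit p → ℕ → ℤ
residueᵤ u = residue (value u)

ℤ× : ℕ → Group 0ℓ 0ℓ
ℤ× p = record
  { Carrier = PAdicUnit p
  ; _≈_     = λ u v → ∀ n → residueᵤ u n ≡ residueᵤ v n [mod p ℕ.^ n ]
  ; _∙_     = λ u v → record
      { value     = value u *ₚ value v
      ; inverse   = PAdicUnit.inverse u *ₚ PAdicUnit.inverse v
      ; isInverse = λ n → mod-trans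
          (≡⇒mod (interchange (residueᵤ u n) (residueᵤ v n) (residue (PAdicUnit.inverse u) n) (residue (PAdicUnit.inverse v) n)))
          (mod-* (PAdicUnit.isInverse u n) (PAdicUnit.isInverse v n))
      }
  ; ε       = record
      { value = one ; inverse = one ; isInverse = λ _ → mod-refl }
  ; _⁻¹     = λ u → record
      { value     = PAdicUnit.inverse u
      ; inverse   = value u
      ; isInverse = λ n → mod-trans (≡⇒mod (ℤ.*-comm (residue (PAdicUnit.inverse u) n) (residueᵤ u n))) (PAdicUnit.isInverse u n)
      }
  ; isGroup = record
    { isMonoid = record
      { isSemigroup = record
        { isMagma = record
          { isEquivalence = record
            { refl = λ _ → mod-refl ; sym = λ p n → mod-sym (p n) ; trans = λ p q n → mod-trans (p n) (q n) }
          ; ∙-cong = λ p q n → mod-* (p n) (q n)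
          }
        ; assoc = λ u v w n → ≡⇒mod (ℤ.*-assoc (residueᵤ u n) (residueᵤ v n) (residueᵤ w n))
        }
      ; identity = (λ u n → ≡⇒mod (ℤ.*-identityˡ (residueᵤ u n))) , (λ u n → ≡⇒mod (ℤ.*-identityʳ (residueᵤ u n)))
      }
    ; inverse = (λ u n → mod-trans (≡⇒mod (ℤ.*-comm (residue (PAdicUnit.inverse u) n) (residueᵤ u n))) (PAdicUnit.isInverse u n))
              , (λ u → PAdicUnit.isInverse u)
    ; ⁻¹-cong = λ {u} {v} eq n → unique (PAdicUnit.isInverse u n) (PAdicUnit.isInverse v n) (eq n)
    }
  }
  where
  one : PAdicInteger p
  one = record { residue = λ _ → 1ℤ ; compatible = λ _ → mod-refl }
  interchange : ∀ a b c d → (a ℤ.* b) ℤ.* (c ℤ.* d) ≡ (a ℤ.* c) ℤ.* (b ℤ.* d)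
  interchange = solve-∀
  unique : ∀ {m x x′ y y′} → x ℤ.* x′ ≡ 1ℤ [mod m ] → y ℤ.* y′ ≡ 1ℤ [mod m ] → x ≡ y [mod m ] → x′ ≡ y′ [mod m ]
  unique {m} {x} {x′} {y} {y′} p q eq = begin
    x′                  ≡⟨ ℤ.*-identityʳ x′ ⟨
    x′ ℤ.* 1ℤ           ≈⟨ mod-* (mod-refl {x = x′}) q ⟨
    x′ ℤ.* (y ℤ.* y′)   ≈⟨ mod-* (mod-refl {x = x′}) (mod-* eq (mod-refl {x = y′})) ⟨
    x′ ℤ.* (x ℤ.* y′)   ≡⟨ lemma x x′ y′ ⟩
    (x ℤ.* x′) ℤ.* y′   ≈⟨ mod-* p (mod-refl {x = y′}) ⟩
    1ℤ ℤ.* y′           ≡⟨ ℤ.*-identityˡ y′ ⟩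
    y′                  ∎
    where
    open SetoidReasoning (Ring.setoid (ℤ/ m))
    lemma : ∀ a b c → b ℤ.* (a ℤ.* c) ≡ (a ℤ.* b) ℤ.* c
    lemma = solve-∀

^-∣ : ∀ p {m n} → m ≤ n → p ℕ.^ m ℕ.∣ p ℕ.^ n
^-∣ p {m} {n} m≤n = subst (p ℕ.^ m ℕ.∣_)
  (≡.trans (≡.sym (ℕ.^-distribˡ-+-* p m (n ℕ.∸ m))) (≡.cong (p ℕ.^_) (ℕ.m+[n∸m]≡n m≤n)))
  (ℕ.m∣m*n (p ℕ.^ (n ℕ.∸ m)))

residue-≤ : ∀ {p} (x : PAdicInteger p) {m n} → m ≤ n → residue x n ≡ residue x m [mod p ℕ.^ m ]
residue-≤ {p} x {m} {n} m≤n = subst (λ k → residue x k ≡ residue x m [mod p ℕ.^ m ]) (ℕ.m+[n∸m]≡n m≤n) (go (n ℕ.∸ m))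
  where
  go : ∀ k → residue x (m ℕ.+ k) ≡ residue x m [mod p ℕ.^ m ]
  go zero    = ≡⇒mod (≡.cong (residue x) (ℕ.+-identityʳ m))
  go (suc k) = mod-trans (≡⇒mod (≡.cong (residue x) (ℕ.+-suc m k)))
    (mod-trans (mod-∣ (^-∣ p (ℕ.m≤m+n m k)) (PAdicInteger.compatible x (m ℕ.+ k))) (go k))

Ball : ∀ {p} → PAdicUnit p → ℕ → Pred (PAdicUnit p) 0ℓ
Ball {p} u n v = residueᵤ v n ≡ residueᵤ u n [mod p ℕ.^ n ]

Ball-⊆ : ∀ {p} (u : PAdicUnit p) {m n} → m ≤ n → Ball u n ⊆ Ball u m
Ball-⊆ {p} u {m} {n} m≤n {v} b = mod-trans (mod-sym (residue-≤ (value v) m≤n))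
  (mod-trans (mod-∣ (^-∣ p m≤n) b) (residue-≤ (value u) m≤n))

-- ℤₚ× with the p-adic topology: the congruence classes modulo pⁿ form a base.
ℤ×-space : ℕ → Space
ℤ×-space p = record
  { setoid   = Group.setoid (ℤ× p)
  ; topology = record
    { Open   = λ V → Lift (lsuc 0ℓ) (∀ u → V u → ∃[ n ] Ball u n ⊆ V)
    ; resp-≈ = λ (lift o) {u} {v} eq x → let n , sub = o u x in sub (mod-sym (eq n))
    ; resp-≐ = λ (V⊆W , W⊆V) (lift o) → lift λ u w → let n , sub = o u (W⊆V w) in n , λ b → V⊆W (sub b)
    ; open-U = lift λ _ _ → 0 , _
    ; open-∩ = λ (lift o) (lift o′) → lift λ u (v , w) →
        let n  , sub  = o u v
            n′ , sub′ = o′ u w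
        in n ℕ.+ n′ , λ {v} b → sub (Ball-⊆ u (ℕ.m≤m+n n n′) {v} b) , sub′ (Ball-⊆ u (ℕ.m≤n+m n′ n) {v} b)
    ; open-⋃ = λ I V o → lift λ u (i , v) → let n , sub = lower (o i) u v in n , λ b → i , sub b
    }
  }

record OrientedProfiniteGroup (p : ℕ) : Set₂ where
  field
    G              : TopologicalGroup
    isProfinite    : IsProfinite G
  private module G = TopologicalGroup G
  field
    θ              : G.Carrier → PAdicUnit p
    isHomomorphism : GroupMorphisms.IsGroupHomomorphism (Group.rawGroup G.group) (Group.rawGroup (ℤ× p)) θ
    isContinuous   : IsContinuous G.space (ℤ×-space p) θ

module _ {p : ℕ} (𝒢 : OrientedProfiniteGroup p) where
  open OrientedProfiniteGroup 𝒢
  private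
    module G = TopologicalGroup G
    module θ = GroupMorphisms.IsGroupHomomorphism isHomomorphism

  -- ℤ/pⁿ(1)
  twisted : ℕ → DiscreteModule G
  twisted n = record
    { abelianGroup = Ring.+-abelianGroup (ℤ/ (p ℕ.^ n))
    ; _▷_          = λ g v → residueᵤ (θ g) n ℤ.* v
    ; ▷-cong       = λ eq eq′ → mod-* (θ.⟦⟧-cong eq n) eq′
    ; ▷-identity   = λ v → mod-trans (mod-* (θ.ε-homo n) (mod-refl {x = v})) (≡⇒mod (ℤ.*-identityˡ v))
    ; ▷-assoc      = λ g h v → mod-trans (mod-* (θ.homo g h n) (mod-refl {x = v}))
        (≡⇒mod (ℤ.*-assoc (residueᵤ (θ g) n) (residueᵤ (θ h) n) v))
    ; ▷-distrib    = λ g x y → ≡⇒mod (ℤ.*-distribˡ-+ (residueᵤ (θ g) n) x y)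
    ; ▷-continuous = λ V (lift r) g v x →
        Ball (θ g) n ∘ θ , (λ w → w ≡ v [mod p ℕ.^ n ]) ,
        isContinuous (Ball (θ g) n) (lift λ u b → n , λ b′ → mod-trans b′ b) ,
        lift (λ eq b → mod-trans (mod-sym eq) b) ,
        mod-refl , mod-refl , λ b c → r (mod-* (mod-sym b) (mod-sym c)) x
    }

  reduction : ∀ (K : OpenSubgroup G) {m n} → m ≤ n → ModuleMorphism (restrict G K (twisted n)) (restrict G K (twisted m))
  reduction K {m} {n} m≤n = record
    { fun      = id
    ; fun-cong = mod-∣ (^-∣ p m≤n)
    ; fun-+    = λ _ _ → mod-refl
    ; fun-▷    = λ (g , _) x → mod-* (residue-≤ (value (θ g)) m≤n) (mod-refl {x = x})
    }

  FormalHilbert90 : Set₁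
  FormalHilbert90 = ∀ (K : OpenSubgroup G) n (1≤n : 1 ≤ n) →
    Surjective
      (AbelianGroup._≈_ (H (subgroup G K) (restrict G K (twisted n)) 1))
      (AbelianGroup._≈_ (H (subgroup G K) (restrict G K (twisted 1)) 1))
      (mapH (subgroup G K) (reduction K 1≤n) 1)

  modpCochains : DGRing
  modpCochains = cochainRing G (ℤ/ p)

  modpH : ℕ → AbelianGroup (lsuc 0ℓ) (lsuc 0ℓ)
  modpH = cohomology (DGRing.complex modpCochains)

{-# OPTIONS --safe #-}

-- Write χ, b, χ′ for χ₁, χ₂, χ₃.  The Massey product vanishes iff (χ, b, χ′) is
-- the superdiagonal of a homomorphism from G to the unitriangular 4×4 matrices
-- over ℤ/p.
--
-- Dividing θ by its Teichmüller part gives a character t ≡ 1 mod p.  Formal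
-- Hilbert 90 for n = 2, applied to the kernel of (χ, θ mod p) and descended to G
-- by a transfer of prime-to-p index, says that every 1-cocycle in the mod p
-- permutation module on ℤ/p, with G translating through a character χ, lifts to
-- ℤ/p² coefficients twisted by t.
--
-- If χ ∪ b = 0, such lifts of b and of a cochain bounding χ ∪ b exhibit b as the
-- norm (the sum of the coefficients) of a cocycle α for χ; likewise b is the norm
-- of a cocycle γ for χ′, and lifts of α and γ can be chosen with equal norms
-- modulo p².  The partial sums S of γ − α along the diagonals of (ℤ/p)² then
-- solve δᵢ₊₁,ⱼ₊₁ − δᵢⱼ = γⱼ − αᵢ up to an obstruction on each diagonal.  The sum
-- of S over a diagonal bounds p times the obstruction; subtracting a cocycle that
-- lifts its reduction mod p and dividing by p kills the obstruction mod p.  The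
-- missing matrix entries are moments of the resulting cocycle δ.
module Submission where

open import Defs
open import Algebra.Bundles using (AbelianGroup; CommutativeMonoid; Ring)
open import Algebra.Morphism.Structures using (module GroupMorphisms)
import Algebra.Properties.CommutativeMonoid.Sum as CommutativeMonoidSum
open import Data.Fin.Base as Fin using (Fin; toℕ; fromℕ<)
open import Data.Fin.Permutation using (Permutation′; permutation)
import Data.Fin.Properties as Fin
open import Data.Integer.Base as ℤ using (ℤ; +_; -[1+_]; -_; _+_; _-_; _*_; _^_; 0ℤ; 1ℤ; -1ℤ)
open import Data.Integer.DivMod using (_%ℕ_; _/ℕ_; n%ℕd<d; a≡a%ℕn+[a/ℕn]*n)
open import Data.Integer.Divisibility.Signed using (_∣_; _∣?_; divides; ∣⇒∣ᵤ; ∣ᵤ⇒∣)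
import Data.Integer.Properties as ℤ
open import Data.Integer.Tactic.RingSolver using (solve)
open import Data.List.Base using (List; []; _∷_; upTo; map; cartesianProduct)
open import Data.List.Membership.Propositional using (lose)
open import Data.List.Membership.Propositional.Properties using (∈-upTo⁺; ∈-map⁺; ∈-cartesianProduct⁺)
open import Data.List.Relation.Unary.Any as Any using (Any; here; there)
open import Data.Nat.Base as ℕ using (ℕ; zero; suc; s≤s; z≤n)
import Data.Nat.Divisibility as ℕ
open import Data.Nat.Primality using (Prime; prime⇒nonZero; prime⇒nonTrivial; euclidsLemma)
import Data.Nat.Properties as ℕ
open import Data.Product.Base using (Σ-syntax; ∃-syntax; _×_; _,_; proj₁; proj₂)
open import Data.Sum.Base using (_⊎_; inj₁; inj₂; [_,_]′)
open import Data.Unit.Base using (tt)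
import Data.Vec.Base as Vec
open import Function.Base using (_∘_; id; const)
open import Function.Bundles using (_⇔_; mk⇔)
open import Level using (0ℓ; lift) renaming (suc to lsuc)
open import Relation.Binary.PropositionalEquality using (_≡_; subst; cong; cong₂; sym; trans; refl)
open import Relation.Nullary using (¬_; Dec; yes; no; contradiction)
open import Relation.Nullary.Decidable as Dec using (_×-dec_)
open import Relation.Unary using (Pred; _∩_; U)

-- Congruences and finite sums

-- Formal Hilbert 90 concerns ℤ/p(1), while Massey products have trivial coefficients; the two agree
-- only on ker (θ mod p). This forces the detour through `t`, which is 1 modulo p on all of G and
-- equals θ modulo p² on that kernel, whose index divides p - 1. By Shapiro's lemma, lifting in the
-- permutation module on ℤ/p amounts to lifting on a subgroup; explicit families indexed by ℕ and
-- periodic modulo p stand for the induced modules, so that χ = 0 or χ = χ′ need no separate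
-- treatment. The model is Galois theory: χ ∪ b = 0 means that b is a norm from the cyclic extension
-- cut out by χ, and Hilbert 90 turns the quotient γ/α of two elements of norm b into σδ/δ. Without
-- a multiplicative group, cocycles modulo p² take its place. Both the norm construction and the
-- removal of the obstruction divide by p and lose one power of it, which is why the lifts to ℤ/p²
-- are needed although every conclusion is modulo p.

≡-conv : ∀ {x y z w : ℤ} → x ≡ y → z - w ≡ x - y → z ≡ w
≡-conv {x} {z = z} {w} refl eq = ℤ.i-j≡0⇒i≡j z w (trans eq (ℤ.+-inverseʳ x))

module _ {m : ℕ} where
  -- The pattern of most congruences below: the hypotheses are combined with suitable coefficients,
  -- and the ring solver checks that the combination and the goal have the same difference of sides.
  mod-conv : ∀ {x y z w} → x ≡ y [mod m ] → z - w ≡ x - y → z ≡ w [mod m ]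
  mod-conv (congruent d) eq = congruent (subst (+ m ∣_) (sym eq) d)

  mod-scale : ∀ c {x y} → x ≡ y [mod m ] → c * x ≡ c * y [mod m ]
  mod-scale c = mod-* (mod-refl {x = c})

  mod-^ : ∀ n {x y} → x ≡ y [mod m ] → x ^ n ≡ y ^ n [mod m ]
  mod-^ zero    h = mod-refl
  mod-^ (suc n) h = mod-* h (mod-^ n h)

  inverse-unique : ∀ {x x′ y y′} → x * x′ ≡ 1ℤ [mod m ] → y * y′ ≡ 1ℤ [mod m ] →
                   x ≡ y [mod m ] → x′ ≡ y′ [mod m ]
  inverse-unique {x} {x′} {y} {y′} p q h = mod-conv
    (mod-+ (mod-scale y′ p) (mod-+ (mod-scale (- x′) q) (mod-scale (- (x′ * y′)) h)))
    (solve (x ∷ x′ ∷ y ∷ y′ ∷ []))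

  unit-cancel : ∀ a b u → a * b ≡ 1ℤ [mod m ] → a * u ≡ 0ℤ [mod m ] → u ≡ 0ℤ [mod m ]
  unit-cancel a b u ab h = mod-conv (mod-+ (mod-scale b h) (mod-scale (- u) ab)) (solve (a ∷ b ∷ u ∷ []))

  ∣⇒mod : ∀ {x} → + m ∣ x → x ≡ 0ℤ [mod m ]
  ∣⇒mod {x} d = congruent (subst (+ m ∣_) (sym (ℤ.+-identityʳ x)) d)

  mod⇒∣ : ∀ {x} → x ≡ 0ℤ [mod m ] → + m ∣ x
  mod⇒∣ {x} (congruent d) = subst (+ m ∣_) (ℤ.+-identityʳ x) d

  modulus≡0 : + m ≡ 0ℤ [mod m ]
  modulus≡0 = ∣⇒mod (divides 1ℤ (sym (ℤ.*-identityˡ (+ m))))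

mod? : ∀ m x y → Dec (x ≡ y [mod m ])
mod? m x y = Dec.map′ congruent _≡_[mod_].difference (+ m ∣? (x - y))

mod-% : ∀ x m .{{_ : ℕ.NonZero m}} → + (x %ℕ m) ≡ x [mod m ]
mod-% x m = mod-conv (mod-scale (- (x /ℕ m)) modulus≡0)
  (trans (cong (λ z → + (x %ℕ m) - z) (a≡a%ℕn+[a/ℕn]*n x m)) (lemma (+ (x %ℕ m)) (x /ℕ m) (+ m)))
  where
  lemma : ∀ r q n → r - (r + q * n) ≡ - q * n - (- q * 0ℤ)
  lemma r q n = solve (r ∷ q ∷ n ∷ [])

%-unique : ∀ {m i} x .{{_ : ℕ.NonZero m}} → i ℕ.< m → x ≡ + i [mod m ] → x %ℕ m ≡ i
%-unique {m} {i} x i<m h = <-unique (n%ℕd<d x m) i<m (mod-trans (mod-% x m) h)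
  where
  multiple<m : ∀ {a} → a ℕ.< m → m ℕ.∣ a → a ≡ 0
  multiple<m {zero}  _   _ = refl
  multiple<m {suc _} a<m d = contradiction d (ℕ.>⇒∤ a<m)
  ≤-unique : ∀ {a b} → a ℕ.< m → b ℕ.≤ a → + a ≡ + b [mod m ] → a ≡ b
  ≤-unique {a} {b} a<m b≤a (congruent d) = ℕ.≤-antisym
    (ℕ.m∸n≡0⇒m≤n (multiple<m (ℕ.≤-<-trans (ℕ.m∸n≤m a b) a<m)
      (subst (λ z → m ℕ.∣ ℤ.∣ z ∣) (trans (ℤ.m-n≡m⊖n a b) (ℤ.⊖-≥ b≤a)) (∣⇒∣ᵤ d)))) b≤a
  <-unique : ∀ {a b} → a ℕ.< m → b ℕ.< m → + a ≡ + b [mod m ] → a ≡ b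
  <-unique {a} {b} a<m b<m h with ℕ.≤-total a b
  ... | inj₁ a≤b = sym (≤-unique b<m a≤b (mod-sym h))
  ... | inj₂ b≤a = ≤-unique a<m b≤a h

∑ : ℕ → (ℕ → ℤ) → ℤ
∑ zero    f = 0ℤ
∑ (suc n) f = ∑ n f + f n

mod-∑ : ∀ {m} n {f g : ℕ → ℤ} → (∀ i → f i ≡ g i [mod m ]) → ∑ n f ≡ ∑ n g [mod m ]
mod-∑ zero    h = mod-refl
mod-∑ (suc n) h = mod-+ (mod-∑ n h) (h n)

∑-cong : ∀ n {f g : ℕ → ℤ} → (∀ i → i ℕ.< n → f i ≡ g i) → ∑ n f ≡ ∑ n g
∑-cong zero    h = refl
∑-cong (suc n) h = cong₂ _+_ (∑-cong n (λ i i<n → h i (ℕ.m<n⇒m<1+n i<n))) (h n (ℕ.n<1+n n))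

∑-+ : ∀ n f g → ∑ n (λ i → f i + g i) ≡ ∑ n f + ∑ n g
∑-+ zero    f g = refl
∑-+ (suc n) f g = trans (cong (_+ (f n + g n)) (∑-+ n f g)) (lemma (∑ n f) (f n) (∑ n g) (g n))
  where
  lemma : ∀ a x b y → a + b + (x + y) ≡ a + x + (b + y)
  lemma a x b y = solve (a ∷ x ∷ b ∷ y ∷ [])

∑-* : ∀ n c f → ∑ n (λ i → c * f i) ≡ c * ∑ n f
∑-* zero    c f = sym (ℤ.*-zeroʳ c)
∑-* (suc n) c f = trans (cong (_+ c * f n) (∑-* n c f)) (sym (ℤ.*-distribˡ-+ c (∑ n f) (f n)))

∑-const : ∀ n c → ∑ n (const c) ≡ + n * c
∑-const zero    c = refl
∑-const (suc n) c = trans (cong (_+ c) (∑-const n c)) (lemma (+ n))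
  where
  lemma : ∀ k → k * c + c ≡ (1ℤ + k) * c
  lemma k = solve (k ∷ c ∷ [])

∑-head : ∀ n f → ∑ (suc n) f ≡ f 0 + ∑ n (f ∘ suc)
∑-head zero    f = ℤ.+-comm 0ℤ (f 0)
∑-head (suc n) f = trans (cong (_+ f (suc n)) (∑-head n f)) (ℤ.+-assoc (f 0) _ _)

∑-++ : ∀ n k f → ∑ (n ℕ.+ k) f ≡ ∑ n f + ∑ k (λ i → f (n ℕ.+ i))
∑-++ n zero    f = trans (cong (λ j → ∑ j f) (ℕ.+-identityʳ n)) (sym (ℤ.+-identityʳ _))
∑-++ n (suc k) f = trans (cong (λ j → ∑ j f) (ℕ.+-suc n k))
  (trans (cong (_+ f (n ℕ.+ k)) (∑-++ n k f)) (ℤ.+-assoc (∑ n f) _ _))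

module _ (p : ℕ) where
  Periodic : ℕ → (ℕ → ℤ) → Set
  Periodic m f = ∀ i → f (p ℕ.+ i) ≡ f i [mod m ]

  module _ {m : ℕ} {f : ℕ → ℤ} (per : Periodic m f) where
    periodic-multiple : ∀ k i → f (k ℕ.* p ℕ.+ i) ≡ f i [mod m ]
    periodic-multiple zero    i = mod-refl
    periodic-multiple (suc k) i = mod-trans (≡⇒mod (cong f (ℕ.+-assoc p (k ℕ.* p) i)))
      (mod-trans (per (k ℕ.* p ℕ.+ i)) (periodic-multiple k i))

    periodic-mod : ∀ {i j} → + i ≡ + j [mod p ] → f i ≡ f j [mod m ]
    periodic-mod {i} {j} (congruent (divides (+ k) eq)) =
      mod-trans (≡⇒mod (cong f (ℤ.+-injective i≡))) (periodic-multiple k j)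
      where
      lemma : ∀ a b c → a - b ≡ c → a ≡ c + b
      lemma a b c h = ≡-conv h (solve (a ∷ b ∷ c ∷ []))
      i≡ : + i ≡ + (k ℕ.* p ℕ.+ j)
      i≡ = trans (lemma (+ i) (+ j) _ eq) (cong (_+ + j) (sym (ℤ.pos-* k p)))
    periodic-mod {i} {j} (congruent (divides -[1+ k ] eq)) =
      mod-sym (mod-trans (≡⇒mod (cong f (ℤ.+-injective j≡))) (periodic-multiple (suc k) i))
      where
      lemma : ∀ a b c d → a - b ≡ - c * d → b ≡ c * d + a
      lemma a b c d h = sym (≡-conv h (solve (a ∷ b ∷ c ∷ d ∷ [])))
      j≡ : + j ≡ + (suc k ℕ.* p ℕ.+ i)
      j≡ = trans (lemma (+ i) (+ j) (+ suc k) (+ p) eq) (cong (_+ + i) (sym (ℤ.pos-* (suc k) p)))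

    -- Moving the window by one step exchanges `f s` for the congruent `f (p + s)`.
    ∑-shift : ∀ s → ∑ p (λ i → f (i ℕ.+ s)) ≡ ∑ p f [mod m ]
    ∑-shift zero    = ≡⇒mod (∑-cong p (λ i _ → cong f (ℕ.+-identityʳ i)))
    ∑-shift (suc s) = mod-trans (mod-conv {x = f (p ℕ.+ s)} {y = f s} (per s) (trans
      (cong₂ _-_ (∑-cong p (λ i _ → cong f (ℕ.+-suc i s))) refl)
      (lemma (∑ p (λ i → f (suc (i ℕ.+ s)))) (∑ p (λ i → f (i ℕ.+ s))) (f s) (f (p ℕ.+ s)) (sym (∑-head p (λ i → f (i ℕ.+ s))))))) (∑-shift s)
      where
      lemma : ∀ a b c d → c + a ≡ b + d → a - b ≡ d - c
      lemma a b c d h = ≡-conv h (solve (a ∷ b ∷ c ∷ d ∷ []))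

module _ {p : ℕ} .{{_ : ℕ.NonZero p}} where
  private
    scaleFin : ℤ → Fin p → Fin p
    scaleFin a u = fromℕ< (n%ℕd<d (a * + toℕ u) p)

    toℕ-scaleFin : ∀ a u → + toℕ (scaleFin a u) ≡ a * + toℕ u [mod p ]
    toℕ-scaleFin a u = mod-trans (≡⇒mod (cong +_ (Fin.toℕ-fromℕ< _))) (mod-% (a * + toℕ u) p)

    scaleFin-inverse : ∀ a b → a * b ≡ 1ℤ [mod p ] → ∀ u → scaleFin a (scaleFin b u) ≡ u
    scaleFin-inverse a b ab u = Fin.toℕ-injective
      (trans (Fin.toℕ-fromℕ< _) (%-unique _ (Fin.toℕ<n u) (mod-trans (mod-scale a (toℕ-scaleFin b u)) (lemma (+ toℕ u)))))
      where
      lemma : ∀ v → a * (b * v) ≡ v [mod p ]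
      lemma v = mod-conv (mod-scale v ab) (solve (a ∷ b ∷ v ∷ []))

    scaling : ∀ a b → a * b ≡ 1ℤ [mod p ] → Permutation′ p
    scaling a b ab = permutation (scaleFin a) (scaleFin b)
      (scaleFin-inverse a b ab) (scaleFin-inverse b a (mod-trans (≡⇒mod (ℤ.*-comm b a)) ab))

  -- The monoid is arbitrary for the sake of two uses: a product of residues in Fermat's little
  -- theorem and a sum over ℤ/p in the averaging argument.
  module Reindex {c ℓ} (M : CommutativeMonoid c ℓ) where
    open CommutativeMonoid M using (_≈_; Carrier) renaming (trans to ≈-trans)
    open CommutativeMonoidSum M

    sum-scale : ∀ a b → a * b ≡ 1ℤ [mod p ] → (F : ℤ → Carrier) →
                (∀ {u v} → u ≡ v [mod p ] → F u ≈ F v) →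
                sum {p} (λ u → F (+ toℕ u)) ≈ sum {p} (λ u → F (a * + toℕ u))
    sum-scale a b ab F F-cong = ≈-trans (sum-permute (λ u → F (+ toℕ u)) (scaling a b ab))
      (sum-cong-≋ (λ u → F-cong (toℕ-scaleFin a u)))

  ∑-scale : ∀ {m} a b → a * b ≡ 1ℤ [mod p ] → (F : ℤ → ℤ) → (∀ {u v} → u ≡ v [mod p ] → F u ≡ F v [mod m ]) →
            ∑ p (λ u → F (+ u)) ≡ ∑ p (λ u → F (a * + u)) [mod m ]
  ∑-scale {m} a b ab F F-cong = mod-trans (≡⇒mod (sym (sum≡∑ p (λ u → F (+ u)))))
    (mod-trans (Reindex.sum-scale M a b ab F F-cong) (≡⇒mod (sum≡∑ p (λ u → F (a * + u)))))
    where
    M : CommutativeMonoid 0ℓ 0ℓ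
    M = AbelianGroup.commutativeMonoid (Ring.+-abelianGroup (ℤ/ m))
    open CommutativeMonoidSum M
    sum≡∑ : ∀ n (f : ℕ → ℤ) → sum {n} (f ∘ toℕ) ≡ ∑ n f
    sum≡∑ zero    f = refl
    sum≡∑ (suc n) f = trans (cong (λ z → f 0 + z) (sum≡∑ n (f ∘ suc))) (sym (∑-head n f))

module _ {p : ℕ} (p-prime : Prime p) where
  private instance
    p≢0 : ℕ.NonZero p
    p≢0 = prime⇒nonZero p-prime

  euclid : ∀ x y → x * y ≡ 0ℤ [mod p ] → x ≡ 0ℤ [mod p ] ⊎ y ≡ 0ℤ [mod p ]
  euclid x y h with euclidsLemma ℤ.∣ x ∣ ℤ.∣ y ∣ p-prime (subst (p ℕ.∣_) (ℤ.abs-* x y) (∣⇒∣ᵤ (mod⇒∣ h)))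
  ... | inj₁ d = inj₁ (∣⇒mod (∣ᵤ⇒∣ d))
  ... | inj₂ d = inj₂ (∣⇒mod (∣ᵤ⇒∣ d))

  <p⇒≢0 : ∀ {u} → suc u ℕ.< p → ¬ + suc u ≡ 0ℤ [mod p ]
  <p⇒≢0 u<p h = ℕ.>⇒∤ u<p (∣⇒∣ᵤ (mod⇒∣ h))

  1≢0 : ¬ 1ℤ ≡ 0ℤ [mod p ]
  1≢0 = <p⇒≢0 (ℕ.nonTrivial⇒n>1 p {{prime⇒nonTrivial p-prime}})

-- Fermat's little theorem

module _ {n : ℕ} (p-prime : Prime (suc n)) where
  private
    p : ℕ
    p = suc n

    *-monoid : CommutativeMonoid 0ℓ 0ℓ
    *-monoid = record
      { Carrier = ℤ ; _≈_ = λ x y → x ≡ y [mod p ] ; _∙_ = _*_ ; ε = 1ℤ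
      ; isCommutativeMonoid = record
        { isMonoid = Ring.*-isMonoid (ℤ/ p) ; comm = λ x y → ≡⇒mod (ℤ.*-comm x y) } }

    open CommutativeMonoidSum *-monoid using (sum; sum-cong-≋) renaming (∑-distrib-+ to ∏-*)

    -- Putting 1 in place of the residue 0 turns the product over the units into one over all of
    -- ℤ/p, to which a permutation of `Fin p` applies.
    orOne : ℤ → ℤ
    orOne u with mod? p u 0ℤ
    ... | yes _ = 1ℤ
    ... | no  _ = u

    orOne-cong : ∀ {u v} → u ≡ v [mod p ] → orOne u ≡ orOne v [mod p ]
    orOne-cong {u} {v} h with mod? p u 0ℤ | mod? p v 0ℤ
    ... | yes _ | yes _ = mod-refl
    ... | no  _ | no  _ = h
    ... | yes a | no  b = contradiction (mod-trans (mod-sym h) a) b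
    ... | no  a | yes b = contradiction (mod-trans h b) a

    orOne-0 : ∀ {u} → u ≡ 0ℤ [mod p ] → orOne u ≡ 1ℤ
    orOne-0 {u} h with mod? p u 0ℤ
    ... | yes _ = refl
    ... | no  b = contradiction h b

    orOne-≢0 : ∀ {u} → ¬ u ≡ 0ℤ [mod p ] → orOne u ≡ u
    orOne-≢0 {u} h with mod? p u 0ℤ
    ... | yes a = contradiction a h
    ... | no  _ = refl

    ∏-const : ∀ k a → sum {k} (const a) ≡ a ^ k
    ∏-const zero    a = refl
    ∏-const (suc k) a = cong (a *_) (∏-const k a)

    ∏-≢0 : ∀ k (f : Fin k → ℤ) → (∀ i → ¬ f i ≡ 0ℤ [mod p ]) → ¬ sum f ≡ 0ℤ [mod p ]
    ∏-≢0 zero    f h e = 1≢0 p-prime e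
    ∏-≢0 (suc k) f h e with euclid p-prime (f Fin.zero) (sum (f ∘ Fin.suc)) e
    ... | inj₁ d = h Fin.zero d
    ... | inj₂ d = ∏-≢0 k (f ∘ Fin.suc) (h ∘ Fin.suc) d

    unit : Fin n → ℤ
    unit i = + suc (toℕ i)

    unit≢0 : ∀ i → ¬ unit i ≡ 0ℤ [mod p ]
    unit≢0 i = <p⇒≢0 p-prime (ℕ.s≤s (Fin.toℕ<n i))

    -- Multiplication by a permutes the nonzero residues.
    aⁿP≡P : ∀ a b → a * b ≡ 1ℤ [mod p ] → a ^ n * sum unit ≡ sum unit [mod p ]
    aⁿP≡P a b ab = mod-trans (mod-sym right)
      (mod-trans (mod-sym (Reindex.sum-scale *-monoid a b ab orOne orOne-cong)) left)
      where
      left : sum {p} (λ u → orOne (+ toℕ u)) ≡ sum unit [mod p ]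
      left = mod-trans (mod-* (≡⇒mod (orOne-0 mod-refl)) (sum-cong-≋ (λ i → ≡⇒mod (orOne-≢0 (unit≢0 i)))))
        (≡⇒mod (ℤ.*-identityˡ (sum unit)))
      right : sum {p} (λ u → orOne (a * + toℕ u)) ≡ a ^ n * sum unit [mod p ]
      right = mod-trans
        (mod-* (≡⇒mod (orOne-0 (≡⇒mod (ℤ.*-zeroʳ a))))
               (sum-cong-≋ (λ i → ≡⇒mod (orOne-≢0 (λ h → unit≢0 i (unit-cancel a b (unit i) ab h))))))
        (mod-trans (≡⇒mod (ℤ.*-identityˡ _))
          (mod-trans (∏-* (const a) unit) (≡⇒mod (cong (_* sum unit) (∏-const n a)))))

  fermat-suc : ∀ a b → a * b ≡ 1ℤ [mod p ] → a ^ n ≡ 1ℤ [mod p ]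
  fermat-suc a b ab = lemma (a ^ n) (sum unit) (∏-≢0 n unit unit≢0) (aⁿP≡P a b ab)
    where
    lemma : ∀ c P → ¬ P ≡ 0ℤ [mod p ] → c * P ≡ P [mod p ] → c ≡ 1ℤ [mod p ]
    lemma c P P≢0 h = [ step , (λ d → contradiction d P≢0) ]′ (euclid p-prime (c - 1ℤ) P (mod-conv h (solve (c ∷ P ∷ []))))
      where
      step : c - 1ℤ ≡ 0ℤ [mod p ] → c ≡ 1ℤ [mod p ]
      step d = mod-conv d (solve (c ∷ []))

fermat : ∀ {p} → Prime p → ∀ a b → a * b ≡ 1ℤ [mod p ] → a ^ p ≡ a [mod p ]
fermat {suc n} p-prime a b ab = mod-trans (mod-scale a (fermat-suc p-prime a b ab)) (≡⇒mod (ℤ.*-identityʳ a))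

-- Passing between the moduli p and p²

module _ {p : ℕ} where
  mod-p²⇒p : ∀ {x y} → x ≡ y [mod p ℕ.^ 2 ] → x ≡ y [mod p ]
  mod-p²⇒p = mod-∣ (ℕ.m∣m*n (p ℕ.* 1))

  mod-p¹⇒p : ∀ {x y} → x ≡ y [mod p ℕ.^ 1 ] → x ≡ y [mod p ]
  mod-p¹⇒p {x} {y} = subst (λ k → x ≡ y [mod k ]) (ℕ.^-identityʳ p)

  mod-p⇒p¹ : ∀ {x y} → x ≡ y [mod p ] → x ≡ y [mod p ℕ.^ 1 ]
  mod-p⇒p¹ {x} {y} = subst (λ k → x ≡ y [mod k ]) (sym (ℕ.^-identityʳ p))

  private
    +p² : + (p ℕ.^ 2) ≡ + p * + p
    +p² = trans (cong (λ k → + (p ℕ.* k)) (ℕ.*-identityʳ p)) (ℤ.pos-* p p)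

  cancel-p : .{{_ : ℕ.NonZero p}} → ∀ x y → + p * x ≡ + p * y [mod p ℕ.^ 2 ] → x ≡ y [mod p ]
  cancel-p x y (congruent (divides q eq)) = congruent (divides q (ℤ.*-cancelˡ-≡ (+ p) (x - y) (q * + p)
    (trans (lemma₁ (+ p) x y) (trans eq (trans (cong (q *_) +p²) (lemma₂ (+ p) q))))))
    where
    lemma₁ : ∀ a x y → a * (x - y) ≡ a * x - a * y
    lemma₁ a x y = solve (a ∷ x ∷ y ∷ [])
    lemma₂ : ∀ a q → q * (a * a) ≡ a * (q * a)
    lemma₂ a q = solve (a ∷ q ∷ [])

  mod-square : ∀ {x y} → x ≡ 0ℤ [mod p ] → y ≡ 0ℤ [mod p ] → x * y ≡ 0ℤ [mod p ℕ.^ 2 ]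
  mod-square {x} {y} h k with mod⇒∣ h | mod⇒∣ k
  ... | divides a refl | divides b refl = ∣⇒mod (divides (a * b) (trans (lemma a b (+ p)) (cong (a * b *_) (sym +p²))))
    where
    lemma : ∀ a b c → (a * c) * (b * c) ≡ a * b * (c * c)
    lemma a b c = solve (a ∷ b ∷ c ∷ [])

  mod-scale-p : ∀ {x y} → x ≡ y [mod p ] → + p * x ≡ + p * y [mod p ℕ.^ 2 ]
  mod-scale-p {x} {y} h = lemma (+ p) (mod-square (modulus≡0 {p}) (mod-conv {w = 0ℤ} h (ℤ.+-identityʳ (x - y))))
    where
    lemma : ∀ a → a * (x - y) ≡ 0ℤ [mod p ℕ.^ 2 ] → a * x ≡ a * y [mod p ℕ.^ 2 ]
    lemma a h = mod-conv h (solve (a ∷ x ∷ y ∷ []))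

  -- The square of `x - 1` vanishes modulo p², so powers of `x` are linear in the exponent; at
  -- exponent p the linear term is again a product of two multiples of p.
  ^p≡1 : ∀ {x} → x ≡ 1ℤ [mod p ] → x ^ p ≡ 1ℤ [mod p ℕ.^ 2 ]
  ^p≡1 {x} h = mod-trans (linear p) (lemma (+ p) (mod-square (modulus≡0 {p}) x-1))
    where
    x-1 : x - 1ℤ ≡ 0ℤ [mod p ]
    x-1 = mod-conv h (solve (x ∷ []))
    lemma : ∀ a → a * (x - 1ℤ) ≡ 0ℤ [mod p ℕ.^ 2 ] → 1ℤ + a * (x - 1ℤ) ≡ 1ℤ [mod p ℕ.^ 2 ]
    lemma a h = mod-conv h (solve (a ∷ x ∷ []))
    step : ∀ y k → y ≡ 1ℤ + k * (x - 1ℤ) [mod p ℕ.^ 2 ] → x * y ≡ 1ℤ + (1ℤ + k) * (x - 1ℤ) [mod p ℕ.^ 2 ]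
    step y k h = mod-conv (mod-+ (mod-scale x h) (mod-scale k (mod-square x-1 x-1))) (solve (x ∷ y ∷ k ∷ []))
    linear : ∀ n → x ^ n ≡ 1ℤ + + n * (x - 1ℤ) [mod p ℕ.^ 2 ]
    linear zero    = mod-refl
    linear (suc n) = step (x ^ n) (+ n) (linear n)

*-^ : ∀ n x y → (x * y) ^ n ≡ x ^ n * y ^ n
*-^ zero    x y = refl
*-^ (suc n) x y = trans (cong (x * y *_) (*-^ n x y)) (lemma (x ^ n) (y ^ n))
  where
  lemma : ∀ a b → x * y * (a * b) ≡ x * a * (y * b)
  lemma a b = solve (x ∷ y ∷ a ∷ b ∷ [])

-- Units modulo p and choice from finite lists

module _ (p : ℕ) where
  private
    indicator : ∀ {u} → Dec (u ≡ 0ℤ [mod p ]) → ℤ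
    indicator (yes _) = 0ℤ
    indicator (no  _) = 1ℤ

  nonzero : ℤ → ℤ
  nonzero u = indicator (mod? p u 0ℤ)

  nonzero-cong : ∀ {u v} → (u ≡ 0ℤ [mod p ] → v ≡ 0ℤ [mod p ]) → (v ≡ 0ℤ [mod p ] → u ≡ 0ℤ [mod p ]) → nonzero u ≡ nonzero v
  nonzero-cong {u} {v} f g = go (mod? p u 0ℤ) (mod? p v 0ℤ)
    where
    go : ∀ a b → indicator {u} a ≡ indicator {v} b
    go (yes _) (yes _) = refl
    go (no  _) (no  _) = refl
    go (yes a) (no  b) = contradiction (f a) b
    go (no  a) (yes b) = contradiction (g b) a

  nonzero-* : ∀ {m} u {a b} → (¬ u ≡ 0ℤ [mod p ] → a ≡ b [mod m ]) → nonzero u * a ≡ nonzero u * b [mod m ]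
  nonzero-* {m} u {a} {b} h = go (mod? p u 0ℤ)
    where
    go : ∀ d → indicator {u} d * a ≡ indicator {u} d * b [mod m ]
    go (yes _) = ≡⇒mod (trans (ℤ.*-zeroˡ a) (sym (ℤ.*-zeroˡ b)))
    go (no ¬0) = mod-scale 1ℤ (h ¬0)

  nonzero-≢0 : ∀ {u} → ¬ u ≡ 0ℤ [mod p ] → nonzero u ≡ 1ℤ
  nonzero-≢0 {u} h = go (mod? p u 0ℤ)
    where
    go : ∀ d → indicator {u} d ≡ 1ℤ
    go (yes a) = contradiction a h
    go (no  _) = refl

  nonzero-0 : nonzero 0ℤ ≡ 0ℤ
  nonzero-0 = go (mod? p 0ℤ 0ℤ)
    where
    go : ∀ d → indicator {0ℤ} d ≡ 0ℤ
    go (yes _) = refl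
    go (no  h) = contradiction mod-refl h

∑-nonzero : ∀ {p} → Prime p → ∑ p (λ u → nonzero p (+ u)) ≡ -1ℤ [mod p ]
∑-nonzero {suc n} p-prime = mod-trans
  (≡⇒mod (trans (∑-head n (λ u → nonzero (suc n) (+ u)))
    (cong₂ _+_ (nonzero-0 (suc n))
      (trans (∑-cong n (λ u u<n → nonzero-≢0 (suc n) (<p⇒≢0 p-prime (ℕ.s≤s u<n)))) (∑-const n 1ℤ)))))
  (lemma (+ n) (modulus≡0 {suc n}))
  where
  lemma : ∀ a → 1ℤ + a ≡ 0ℤ [mod suc n ] → 0ℤ + a * 1ℤ ≡ -1ℤ [mod suc n ]
  lemma a h = mod-conv h (solve (a ∷ []))

module _ {A : Set} where
  -- Canonical choice: by `first-cong` the result depends on the predicate only up to equivalence,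
  -- so congruent points receive choices that are strictly equal.
  first : {P : A → Set} (P? : ∀ x → Dec (P x)) (d : A) (xs : List A) → A
  first P? d []       = d
  first P? d (x ∷ xs) with P? x
  ... | yes _ = x
  ... | no  _ = first P? d xs

  first-satisfies : {P : A → Set} (P? : ∀ x → Dec (P x)) (d : A) {xs : List A} → Any P xs → P (first P? d xs)
  first-satisfies P? d {x ∷ xs} any with P? x | any
  ... | yes Px | _          = Px
  ... | no ¬Px | here Px    = contradiction Px ¬Px
  ... | no ¬Px | there any′ = first-satisfies P? d any′

  first-cong : {P Q : A → Set} (P? : ∀ x → Dec (P x)) (Q? : ∀ x → Dec (Q x)) (d : A) (xs : List A) →
               (∀ x → P x → Q x) → (∀ x → Q x → P x) → first P? d xs ≡ first Q? d xs
  first-cong P? Q? d []       f g = refl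
  first-cong P? Q? d (x ∷ xs) f g with P? x | Q? x
  ... | yes _ | yes _ = refl
  ... | no  _ | no  _ = first-cong P? Q? d xs f g
  ... | yes a | no  b = contradiction (f x a) b
  ... | no  a | yes b = contradiction (g x b) a

∑-telescope : ∀ n (f : ℕ → ℤ) → ∑ n (λ i → f i - f (suc i)) ≡ f 0 - f n
∑-telescope zero    f = sym (ℤ.+-inverseʳ (f 0))
∑-telescope (suc n) f = trans (cong (_+ (f n - f (suc n))) (∑-telescope n f)) (lemma (f 0) (f n) (f (suc n)))
  where
  lemma : ∀ a b c → a - b + (b - c) ≡ a - c
  lemma a b c = solve (a ∷ b ∷ c ∷ [])

divide : ∀ {p x} → x ≡ 0ℤ [mod p ] → Σ[ q ∈ ℤ ] x ≡ + p * q
divide {p} h with mod⇒∣ h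
... | divides q eq = q , trans eq (ℤ.*-comm q (+ p))

∑-- : ∀ n f g → ∑ n (λ i → f i - g i) ≡ ∑ n f - ∑ n g
∑-- zero    f g = refl
∑-- (suc n) f g = trans (cong (_+ (f n - g n)) (∑-- n f g)) (lemma (∑ n f) (∑ n g) (f n) (g n))
  where
  lemma : ∀ a b c d → a - b + (c - d) ≡ a + c - (b + d)
  lemma a b c d = solve (a ∷ b ∷ c ∷ d ∷ [])

-- Weighted sums and moments of coefficients

triangular : ℕ → ℤ
triangular n = ∑ n (λ k → + k)

-- Abel summation: consecutive triangular weights differ by `i`, so shifting a second-order sum
-- produces a first moment.
∑-by-parts : ∀ n (f : ℕ → ℤ) → ∑ n (λ i → triangular (suc i) * f (suc i)) - ∑ n (λ i → triangular (suc i) * f i) ≡ triangular n * f n - ∑ n (λ i → + i * f i)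
∑-by-parts zero    f = sym (cong (_- 0ℤ) (ℤ.*-zeroˡ (f 0)))
∑-by-parts (suc n) f = lemma (∑ n (λ i → triangular (suc i) * f (suc i))) (∑ n (λ i → triangular (suc i) * f i)) (triangular n) (+ n) (f n) (f (suc n)) (∑ n (λ i → + i * f i)) (∑-by-parts n f)
  where
  lemma : ∀ a b k n x y c → a - b ≡ k * x - c → a + (k + n) * y - (b + (k + n) * x) ≡ (k + n) * y - (c + n * x)
  lemma a b k n x y c h = ≡-conv h (solve (a ∷ b ∷ k ∷ n ∷ x ∷ y ∷ c ∷ []))

-- Kept doubled to include p = 2, where `triangular p` is 1 and only its double vanishes modulo p.
2*∑id : ∀ n → triangular n + triangular n ≡ + n * (+ n - 1ℤ)
2*∑id zero    = refl
2*∑id (suc n) = lemma (triangular n) (+ n) (2*∑id n)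
  where
  lemma : ∀ a n → a + a ≡ n * (n - 1ℤ) → a + n + (a + n) ≡ (1ℤ + n) * (1ℤ + n - 1ℤ)
  lemma a n h = ≡-conv h (solve (a ∷ n ∷ []))

module _ {p : ℕ} where
  -- Write `k` as `(k + r) - r`: since p ≡ 0, the function `k * f k` is periodic as well, and both
  -- parts reduce to `∑-shift`.
  ∑-shift-weighted : ∀ {f} → Periodic p p f → ∀ r → ∑ p (λ k → + k * f (k ℕ.+ r)) ≡ ∑ p (λ k → + k * f k) - + r * ∑ p f [mod p ]
  ∑-shift-weighted {f} f-per r = lemma (∑ p (λ k → + k * f (k ℕ.+ r))) (∑ p (λ k → f (k ℕ.+ r))) (∑ p (λ k → + (k ℕ.+ r) * f (k ℕ.+ r)))
      (∑ p (λ k → + k * f k)) (∑ p f) (+ r)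
      (trans (∑-cong p (λ k _ → distribute (+ k) (+ r) (f (k ℕ.+ r))))
        (trans (∑-+ p (λ k → + k * f (k ℕ.+ r)) (λ k → + r * f (k ℕ.+ r)))
          (cong (λ w → ∑ p (λ k → + k * f (k ℕ.+ r)) + w) (∑-* p (+ r) (λ k → f (k ℕ.+ r))))))
      (∑-shift p {f = λ k → + k * f k} per r) (∑-shift p f-per r)
    where
    distribute : ∀ k r x → (k + r) * x ≡ k * x + r * x
    distribute k r x = solve (k ∷ r ∷ x ∷ [])
    per : Periodic p p (λ k → + k * f k)
    per k = step (+ p) (+ k) (f (p ℕ.+ k)) (f k) modulus≡0 (f-per k)
      where
      step : ∀ q k x y → q ≡ 0ℤ [mod p ] → x ≡ y [mod p ] → (q + k) * x ≡ k * y [mod p ]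
      step q k x y h₁ h₂ = mod-conv (mod-+ (mod-scale x h₁) (mod-scale k h₂)) (solve (q ∷ k ∷ x ∷ y ∷ []))
    lemma : ∀ a b c d e r → c ≡ a + r * b → c ≡ d [mod p ] → b ≡ e [mod p ] → a ≡ d - r * e [mod p ]
    lemma a b c d e r eq h₁ h₂ = mod-conv (mod-+ (≡⇒mod (sym eq)) (mod-+ h₁ (mod-scale (- r) h₂))) (solve (a ∷ b ∷ c ∷ d ∷ e ∷ r ∷ []))

  -- The coefficients at a fixed group element of a cocycle δ in the
  -- permutation module on (ℤ/p)², with first differences γ − α.
  module Coefficients {α γ : ℕ → ℤ} {δ : ℕ → ℕ → ℤ} {b : ℤ}
    (α-per : Periodic p p α) (γ-per : Periodic p p γ)
    (∑α≡b : ∑ p α ≡ b [mod p ]) (∑γ≡b : ∑ p γ ≡ b [mod p ])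
    (δ-step : ∀ i k → δ (suc i) k ≡ δ i k + (γ (k ℕ.+ i) - α i) [mod p ]) where

    -- Under group multiplication `q` is translated by χ′ - χ and picks up a multiple of `u`; the
    -- summand `s u s` of `E` takes the χ part of it. `Z`, whose own multiplication rule is
    -- additive, cancels what keeps the rest from being linear in `s`.
    u q Z E : ℕ → ℤ
    u i = ∑ p (δ i)
    q i = ∑ p (λ k → + k * δ i k)
    Z s = ∑ p (λ i → triangular (suc i) * α (i ℕ.+ s))
    E s = q s + + s * u s - Z s

    Γ̂ Â : ℤ
    Γ̂ = ∑ p (λ k → + k * γ k)
    Â = ∑ p (λ i → + i * α i)

    u-suc : ∀ i → u (suc i) ≡ u i + b [mod p ]
    u-suc i = mod-trans (mod-∑ p (δ-step i)) (mod-trans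
      (≡⇒mod (trans (∑-+ p (δ i) (λ k → γ (k ℕ.+ i) - α i)) (cong (λ w → u i + w)
        (trans (∑-- p (λ k → γ (k ℕ.+ i)) (const (α i))) (cong (λ w → ∑ p (λ k → γ (k ℕ.+ i)) - w) (∑-const p (α i)))))))
      (lemma (u i) (∑ p (λ k → γ (k ℕ.+ i))) (∑ p γ) b (+ p) (α i) (∑-shift p γ-per i) ∑γ≡b modulus≡0))
      where
      lemma : ∀ u a c b q x → a ≡ c [mod p ] → c ≡ b [mod p ] → q ≡ 0ℤ [mod p ] → u + (a - q * x) ≡ u + b [mod p ]
      lemma u a c b q x h₁ h₂ h₃ = mod-conv (mod-+ h₁ (mod-+ h₂ (mod-scale (- x) h₃))) (solve (u ∷ a ∷ c ∷ b ∷ q ∷ x ∷ []))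

    u-linear : ∀ s → u s ≡ u 0 + + s * b [mod p ]
    u-linear zero    = ≡⇒mod (sym (trans (cong (λ w → u 0 + w) (ℤ.*-zeroˡ b)) (ℤ.+-identityʳ (u 0))))
    u-linear (suc s) = lemma (u (suc s)) (u s) (u 0) (+ s) (u-suc s) (u-linear s)
      where
      lemma : ∀ x y z s → x ≡ y + b [mod p ] → y ≡ z + s * b [mod p ] → x ≡ z + (1ℤ + s) * b [mod p ]
      lemma x y z s h₁ h₂ = mod-conv (mod-+ h₁ h₂) (solve (x ∷ y ∷ z ∷ s ∷ b ∷ []))

    q-suc : ∀ s → q (suc s) ≡ q s + (Γ̂ - + s * b - α s * triangular p) [mod p ]
    q-suc s = mod-trans
      (mod-∑ p (λ k → mod-scale (+ k) (δ-step s k)))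
      (mod-trans (≡⇒mod (trans (∑-cong p (λ k _ → distribute (+ k) (δ s k) (γ (k ℕ.+ s)) (α s)))
          (trans (∑-+ p (λ k → + k * δ s k) (λ k → + k * γ (k ℕ.+ s) - α s * + k))
            (cong (λ w → q s + w) (trans (∑-- p (λ k → + k * γ (k ℕ.+ s)) (λ k → α s * + k))
              (cong (λ w → ∑ p (λ k → + k * γ (k ℕ.+ s)) - w) (∑-* p (α s) (λ k → + k))))))))
        (lemma (q s) (∑ p (λ k → + k * γ (k ℕ.+ s))) Γ̂ (∑ p γ) (+ s) (α s * triangular p) (∑-shift-weighted γ-per s) ∑γ≡b))
      where
      distribute : ∀ k d c a → k * (d + (c - a)) ≡ k * d + (k * c - a * k)
      distribute k d c a = solve (k ∷ d ∷ c ∷ a ∷ [])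
      lemma : ∀ q w c σ s y → w ≡ c - s * σ [mod p ] → σ ≡ b [mod p ] → q + (w - y) ≡ q + (c - s * b - y) [mod p ]
      lemma q w c σ s y h₁ h₂ = mod-conv (mod-+ h₁ (mod-scale (- s) h₂)) (solve (q ∷ w ∷ c ∷ σ ∷ s ∷ y ∷ b ∷ []))

    Z-suc : ∀ s → Z (suc s) ≡ Z s + (α s * triangular p - (Â - + s * b)) [mod p ]
    Z-suc s = lemma (Z (suc s)) (∑ p (λ i → triangular (suc i) * α (suc i ℕ.+ s))) (Z s) (triangular p) (α (p ℕ.+ s)) (α s)
        (∑ p (λ i → + i * α (i ℕ.+ s))) Â (∑ p α) (+ s)
        (∑-cong p (λ i _ → cong (λ k → triangular (suc i) * α k) (ℕ.+-suc i s)))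
        (∑-by-parts p (λ i → α (i ℕ.+ s))) (α-per s) (∑-shift-weighted α-per s) ∑α≡b
      where
      lemma : ∀ z′ z″ z κ x y w a σ s → z′ ≡ z″ → z″ - z ≡ κ * x - w → x ≡ y [mod p ] → w ≡ a - s * σ [mod p ] → σ ≡ b [mod p ] →
              z′ ≡ z + (y * κ - (a - s * b)) [mod p ]
      lemma z′ z″ z κ x y w a σ s e₁ e₂ h₁ h₂ h₃ = mod-conv
        (mod-+ (≡⇒mod e₁) (mod-+ (≡⇒mod e₂) (mod-+ (mod-scale κ h₁) (mod-+ (mod-neg h₂) (mod-scale s h₃)))))
        (solve (z′ ∷ z″ ∷ z ∷ κ ∷ x ∷ y ∷ w ∷ a ∷ σ ∷ s ∷ b ∷ []))

    -- The increments of `q`, `s u s` and `Z` contain `- s b`, `2 s b` and `s b`, which cancel in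
    -- `E`. The terms `α s * triangular p` do not cancel but double, and so vanish modulo p.
    E-linear : ∀ s → E s ≡ E 0 + + s * (Γ̂ + Â + u 0 + b) [mod p ]
    E-linear zero    = ≡⇒mod (sym (trans (cong (λ w → E 0 + w) (ℤ.*-zeroˡ (Γ̂ + Â + u 0 + b))) (ℤ.+-identityʳ (E 0))))
    E-linear (suc s) = lemma (q (suc s)) (q s) (u (suc s)) (u s) (u 0) (Z (suc s)) (Z s) (E 0) Γ̂ Â (+ s) (triangular p) (α s)
        (q-suc s) (u-linear (suc s)) (u-linear s) (Z-suc s)
        (mod-trans (≡⇒mod (2*∑id p)) (mod-trans (mod-* modulus≡0 (mod-refl {x = + p - 1ℤ})) (≡⇒mod (ℤ.*-zeroˡ (+ p - 1ℤ)))))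
        (E-linear s)
      where
      lemma : ∀ q′ q u′ u u₀ z′ z e₀ c a s κ x →
        q′ ≡ q + (c - s * b - x * κ) [mod p ] → u′ ≡ u₀ + (1ℤ + s) * b [mod p ] → u ≡ u₀ + s * b [mod p ] →
        z′ ≡ z + (x * κ - (a - s * b)) [mod p ] → κ + κ ≡ 0ℤ [mod p ] →
        q + s * u - z ≡ e₀ + s * (c + a + u₀ + b) [mod p ] →
        q′ + (1ℤ + s) * u′ - z′ ≡ e₀ + (1ℤ + s) * (c + a + u₀ + b) [mod p ]
      lemma q′ q u′ u u₀ z′ z e₀ c a s κ x h₁ h₂ h₃ h₄ h₅ h₆ = mod-conv
        (mod-+ h₁ (mod-+ (mod-scale (1ℤ + s) h₂) (mod-+ (mod-scale (- s) h₃) (mod-+ (mod-neg h₄) (mod-+ (mod-scale (- x) h₅) h₆)))))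
        (solve (q′ ∷ q ∷ u′ ∷ u ∷ u₀ ∷ z′ ∷ z ∷ e₀ ∷ c ∷ a ∷ s ∷ κ ∷ x ∷ b ∷ []))

-- Locally constant functions

module LocalConstancy (G : TopologicalGroup) where
  private module G = TopologicalGroup G

  -- Continuity into the discrete ring `ℤ/ m`, for integer-valued functions: one function can be
  -- read both modulo p² and modulo p. Compatibility with the equality of the group is derived in
  -- `lc-resp-≈`, as open sets respect it.
  record LocallyConstant (m : ℕ) (f : G.Carrier → ℤ) : Set₁ where
    constructor locallyConstant
    field
      nearby : ∀ g → Σ[ V ∈ Pred G.Carrier 0ℓ ] G.Open V × V g × (∀ {h} → V h → f h ≡ f g [mod m ])
  open LocallyConstant

  module _ {m : ℕ} where
    lc-resp-≈ : ∀ {f} → LocallyConstant m f → ∀ {g h} → g G.≈ h → f g ≡ f h [mod m ]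
    lc-resp-≈ lc {g} eq = let V , o , v , c = nearby lc g in mod-sym (c (G.resp-≈ o eq v))

    lc-const : ∀ c → LocallyConstant m (const c)
    lc-const c = locallyConstant λ g → U , G.open-U , tt , λ _ → mod-refl

    lc-via : ∀ {k f F} → LocallyConstant k f →
             (∀ g h → f h ≡ f g [mod k ] → F h ≡ F g [mod m ]) → LocallyConstant m F
    lc-via lc step = locallyConstant λ g → let V , o , v , c = nearby lc g in
      V , o , v , λ w → step g _ (c w)

    lc-via₂ : ∀ {k l f f′ F} → LocallyConstant k f → LocallyConstant l f′ →
              (∀ g h → f h ≡ f g [mod k ] → f′ h ≡ f′ g [mod l ] → F h ≡ F g [mod m ]) → LocallyConstant m F
    lc-via₂ lc lc′ step = locallyConstant λ g →
      let V , o , v , c = nearby lc g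
          W , q , w , d = nearby lc′ g
      in V ∩ W , G.open-∩ o q , (v , w) , λ (v′ , w′) → step g _ (c v′) (d w′)

    lc-+ : ∀ {f f′} → LocallyConstant m f → LocallyConstant m f′ → LocallyConstant m (λ g → f g + f′ g)
    lc-+ lc lc′ = lc-via₂ lc lc′ λ _ _ → mod-+

    lc-* : ∀ {f f′} → LocallyConstant m f → LocallyConstant m f′ → LocallyConstant m (λ g → f g * f′ g)
    lc-* lc lc′ = lc-via₂ lc lc′ λ _ _ → mod-*

    lc-neg : ∀ {f} → LocallyConstant m f → LocallyConstant m (λ g → - f g)
    lc-neg lc = lc-via lc λ _ _ → mod-neg

    lc-∑ : ∀ n {f : ℕ → G.Carrier → ℤ} → (∀ i → LocallyConstant m (f i)) → LocallyConstant m (λ g → ∑ n (λ i → f i g))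
    lc-∑ zero    lc = lc-const 0ℤ
    lc-∑ (suc n) lc = lc-+ (lc-∑ n lc) (lc n)

    lc-open : ∀ {f} → LocallyConstant m f → ∀ c → G.Open (λ g → f g ≡ c [mod m ])
    lc-open {f} lc c = G.resp-≐ ((λ ((g , e) , v) → mod-trans (proj₂ (proj₂ (proj₂ (nearby lc g))) v) e) ,
                                 (λ {g} e → (g , e) , proj₁ (proj₂ (proj₂ (nearby lc g)))))
      (G.open-⋃ (Σ[ g ∈ G.Carrier ] f g ≡ c [mod m ]) (λ (g , _) → proj₁ (nearby lc g)) (λ (g , _) → proj₁ (proj₂ (nearby lc g))))

    lc-translate : ∀ {f} → LocallyConstant m f → ∀ a b → LocallyConstant m (λ g → f (a G.∙ g G.∙ b))
    lc-translate lc a b = locallyConstant λ g →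
      let V , o , v , c = nearby lc (a G.∙ g G.∙ b)
          A , _ , oA , _ , x , y , sub = G.∙-continuous V o (a G.∙ g) b v
          _ , B , _ , oB , x′ , y′ , sub′ = G.∙-continuous A oA a g x
      in B , oB , y′ , λ w → c (sub (sub′ x′ w) y)

    -- `S` takes values in a bare set with strict equality, which is what `first-cong` provides for
    -- choices of group elements.
    lc-choose : ∀ {A : Set} (S : G.Carrier → A) {F : A → G.Carrier → ℤ} →
                (∀ g → Σ[ V ∈ Pred G.Carrier 0ℓ ] G.Open V × V g × (∀ {h} → V h → S h ≡ S g)) →
                (∀ a → LocallyConstant m (F a)) → LocallyConstant m (λ g → F (S g) g)
    lc-choose S {F} S-nearby F-lc = locallyConstant λ g →
      let V , o , v , c = S-nearby g
          W , q , w , d = nearby (F-lc (S g)) g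
      in V ∩ W , G.open-∩ o q , (v , w) , λ {h} (v′ , w′) →
        mod-trans (≡⇒mod (cong (λ a → F a h) (c v′))) (d w′)

  lc-∣ : ∀ {k m f} → k ℕ.∣ m → LocallyConstant m f → LocallyConstant k f
  lc-∣ k∣m lc = lc-via lc λ _ _ → mod-∣ k∣m

  toMap : ∀ {m f} → LocallyConstant m f → Map (power G 1) (Ring.+-abelianGroup (ℤ/ m))
  toMap {m} {f} lc = record
    { to         = λ (g , _) → f g
    ; cong       = λ (eq , _) → lc-resp-≈ lc eq
    ; continuous = λ W (lift r) g _ w →
        let V , o , v , c = nearby lc g
        in V , U , o , Space.open-U point , v , tt , λ v′ _ → r (mod-sym (c v′)) w
    }

  fromMap : ∀ {m} (f : Map (power G 1) (Ring.+-abelianGroup (ℤ/ m))) → LocallyConstant m (λ g → ContinuousMap.to f (g , tt))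
  fromMap {m} f = locallyConstant λ g →
    let W = λ x → x ≡ ContinuousMap.to f (g , tt) [mod m ]
        A , B , oA , oB , a , b , sub = ContinuousMap.continuous f W (lift (λ eq e → mod-trans (mod-sym eq) e)) g tt mod-refl
    in A , oA , a , λ a′ → sub a′ b

-- Lifting cocycles of permutation modules from ℤ/p to ℤ/p²

module Oriented {p : ℕ} (p-prime : Prime p) (𝒢 : OrientedProfiniteGroup p) (hilbert90 : FormalHilbert90 𝒢) where
  open OrientedProfiniteGroup 𝒢 using (G; isProfinite; θ; isHomomorphism; isContinuous)
  open TopologicalGroup G using (Carrier; _∙_; ε; _⁻¹; Open)
  private module G = TopologicalGroup G
  private module θ = GroupMorphisms.IsGroupHomomorphism isHomomorphism
  open LocalConstancy G
  open LocallyConstant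

  private instance
    p≢0 : ℕ.NonZero p
    p≢0 = prime⇒nonZero p-prime

  private
    p² : ℕ
    p² = p ℕ.^ 2

    p∣p² : p ℕ.∣ p²
    p∣p² = ℕ.m∣m*n (p ℕ.* 1)

  -- The characters ϑ and t modulo p²

  ϑ ϑ⁻¹ : Carrier → ℤ
  ϑ g   = residueᵤ (θ g) 2
  ϑ⁻¹ g = PAdicInteger.residue (PAdicUnit.inverse (θ g)) 2

  ϑ-inverse : ∀ g → ϑ g * ϑ⁻¹ g ≡ 1ℤ [mod p² ]
  ϑ-inverse g = PAdicUnit.isInverse (θ g) 2

  ϑ-∙ : ∀ g h → ϑ (g ∙ h) ≡ ϑ g * ϑ h [mod p² ]
  ϑ-∙ g h = θ.homo g h 2

  ϑ-ε : ϑ ε ≡ 1ℤ [mod p² ]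
  ϑ-ε = θ.ε-homo 2

  ϑ-lc : LocallyConstant p² ϑ
  ϑ-lc = locallyConstant λ g → Ball (θ g) 2 ∘ θ ,
    isContinuous (Ball (θ g) 2) (lift λ u b → 2 , λ b′ → mod-trans b′ b) , mod-refl , id

  ϑ-⁻¹ : ∀ g → ϑ g * ϑ (g ⁻¹) ≡ 1ℤ [mod p ]
  ϑ-⁻¹ g = mod-p²⇒p (mod-trans (mod-sym (ϑ-∙ g (g ⁻¹))) (mod-trans (lc-resp-≈ ϑ-lc (G.inverseʳ g)) ϑ-ε))

  ϑ⁻¹-∙ : ∀ g h → ϑ⁻¹ (g ∙ h) ≡ ϑ⁻¹ g * ϑ⁻¹ h [mod p² ]
  ϑ⁻¹-∙ g h = inverse-unique (ϑ-inverse (g ∙ h)) (lemma (ϑ g) (ϑ⁻¹ g) (ϑ h) (ϑ⁻¹ h) (ϑ-inverse g) (ϑ-inverse h)) (ϑ-∙ g h)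
    where
    lemma : ∀ a a′ b b′ → a * a′ ≡ 1ℤ [mod p² ] → b * b′ ≡ 1ℤ [mod p² ] → a * b * (a′ * b′) ≡ 1ℤ [mod p² ]
    lemma a a′ b b′ p q = mod-conv (mod-* p q) (solve (a ∷ a′ ∷ b ∷ b′ ∷ []))

  ϑ⁻¹-lc : LocallyConstant p² ϑ⁻¹
  ϑ⁻¹-lc = lc-via ϑ-lc λ g h → inverse-unique (ϑ-inverse h) (ϑ-inverse g)

  -- θ divided by its Teichmüller part, modulo p².
  t : Carrier → ℤ
  t g = ϑ g * ϑ⁻¹ g ^ p

  t-∙ : ∀ g h → t (g ∙ h) ≡ t g * t h [mod p² ]
  t-∙ g h = mod-trans
    (mod-* (ϑ-∙ g h) (mod-trans (mod-^ p (ϑ⁻¹-∙ g h)) (≡⇒mod (*-^ p (ϑ⁻¹ g) (ϑ⁻¹ h)))))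
    (≡⇒mod (lemma (ϑ g) (ϑ h) (ϑ⁻¹ g ^ p) (ϑ⁻¹ h ^ p)))
    where
    lemma : ∀ a b c d → a * b * (c * d) ≡ a * c * (b * d)
    lemma a b c d = solve (a ∷ b ∷ c ∷ d ∷ [])

  -- Fermat gives `ϑ⁻¹ g ^ p ≡ ϑ⁻¹ g`. Consequently every untwisted cocycle modulo p is also a
  -- `t`-twisted one.
  t≡1 : ∀ g → t g ≡ 1ℤ [mod p ]
  t≡1 g = mod-trans (mod-scale (ϑ g) (fermat p-prime (ϑ⁻¹ g) (ϑ g) (mod-trans (≡⇒mod (ℤ.*-comm (ϑ⁻¹ g) (ϑ g))) ϑϑ⁻¹))) ϑϑ⁻¹
    where
    ϑϑ⁻¹ : ϑ g * ϑ⁻¹ g ≡ 1ℤ [mod p ]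
    ϑϑ⁻¹ = mod-p²⇒p (ϑ-inverse g)

  -- The second factor of `t` is the p-th power of an element congruent to 1. On ker (θ mod p) the
  -- θ-twisted lifts supplied by formal Hilbert 90 are therefore `t`-twisted.
  t≡ϑ : ∀ {g} → ϑ g ≡ 1ℤ [mod p ] → t g ≡ ϑ g [mod p² ]
  t≡ϑ {g} h = mod-trans (mod-scale (ϑ g) (^p≡1 (inverse-unique (mod-p²⇒p (ϑ-inverse g)) mod-refl h))) (≡⇒mod (ℤ.*-identityʳ (ϑ g)))

  t-ε : t ε ≡ 1ℤ [mod p² ]
  t-ε = mod-trans (t≡ϑ (mod-p²⇒p ϑ-ε)) ϑ-ε

  lc-^ : ∀ n {f} → LocallyConstant p² f → LocallyConstant p² (λ g → f g ^ n)
  lc-^ n lc = lc-via lc λ _ _ → mod-^ n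

  t-lc : LocallyConstant p² t
  t-lc = lc-* ϑ-lc (lc-^ p ϑ⁻¹-lc)

  t-inverse : ∀ g → t g * t (g ⁻¹) ≡ 1ℤ [mod p² ]
  t-inverse g = mod-trans (mod-sym (t-∙ g (g ⁻¹))) (mod-trans (lc-resp-≈ t-lc (G.inverseʳ g)) t-ε)

  -- Values lie in ℕ so that translating a family indexed by ℕ is plain addition; only residues
  -- modulo p matter.
  record Character (χ : Carrier → ℕ) : Set₁ where
    field
      χ-lc : LocallyConstant p (λ g → + χ g)
      χ-∙  : ∀ g h → + χ (g ∙ h) ≡ + χ g + + χ h [mod p ]

    χ-ε : + χ ε ≡ 0ℤ [mod p ]
    χ-ε = lemma (+ χ ε) (mod-trans (lc-resp-≈ χ-lc (G.sym (G.identityʳ ε))) (χ-∙ ε ε))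
      where
      lemma : ∀ a → a ≡ a + a [mod p ] → a ≡ 0ℤ [mod p ]
      lemma a h = mod-sym (mod-conv h (solve (a ∷ [])))

    χ-⁻¹ : ∀ g → + χ g + + χ (g ⁻¹) ≡ 0ℤ [mod p ]
    χ-⁻¹ g = mod-trans (mod-sym (χ-∙ g (g ⁻¹))) (mod-trans (lc-resp-≈ χ-lc (G.inverseʳ g)) χ-ε)

  -- 1-cocycles of G in the permutation module on ℤ/p, on which g acts by
  -- translation by χ g, with coefficients in ℤ/m twisted by t.
  record Cocycle (m : ℕ) (χ : Carrier → ℕ) (x : ℕ → Carrier → ℤ) : Set₁ where
    field
      lc       : ∀ i → LocallyConstant m (x i)
      periodic : ∀ i g → x (p ℕ.+ i) g ≡ x i g [mod m ]
      cocycle  : ∀ i g h → x i (g ∙ h) ≡ x i g + t g * x (i ℕ.+ χ g) h [mod m ]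

    index-mod : ∀ {i j} → + i ≡ + j [mod p ] → ∀ g → x i g ≡ x j g [mod m ]
    index-mod h g = periodic-mod p {f = λ i → x i g} (λ i → periodic i g) h

  -- Formal Hilbert 90 on the kernel of (χ, θ mod p)

  module Kernel {χ : Carrier → ℕ} (χ-character : Character χ) where
    open Character χ-character

    K : OpenSubgroup G
    K = record
      { member    = λ g → (+ χ g ≡ 0ℤ [mod p ]) × (ϑ g ≡ 1ℤ [mod p ])
      ; is-open   = G.open-∩ (lc-open χ-lc 0ℤ) (lc-open (lc-∣ p∣p² ϑ-lc) 1ℤ)
      ; ε-member  = χ-ε , mod-p²⇒p ϑ-ε
      ; ∙-member  = λ {g} {h} (a , b) (c , d) → mod-trans (χ-∙ g h) (mod-+ a c) , mod-trans (mod-p²⇒p (ϑ-∙ g h)) (mod-* b d)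
      ; ⁻¹-member = λ {g} (a , b) →
          lemma₁ (+ χ g) (+ χ (g ⁻¹)) a (χ-⁻¹ g) ,
          inverse-unique {x = ϑ g} (ϑ-⁻¹ g) mod-refl b
      }
      where
      lemma₁ : ∀ a b → a ≡ 0ℤ [mod p ] → a + b ≡ 0ℤ [mod p ] → b ≡ 0ℤ [mod p ]
      lemma₁ a b h k = mod-conv (mod-+ k (mod-neg h)) (solve (a ∷ b ∷ []))

    open OpenSubgroup K using (member)

    member? : ∀ g → Dec (member g)
    member? g = mod? p (+ χ g) 0ℤ ×-dec mod? p (ϑ g) 1ℤ

    module _ {x : ℕ → Carrier → ℤ} (x-cocycle : Cocycle p χ x) (i : ℕ) where
      open Cocycle x-cocycle
      private
        GK : TopologicalGroup
        GK = subgroup G K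
        module C₁ = CochainComplex (cochains GK (restrict G K (twisted 𝒢 1)))
        module C₂ = CochainComplex (cochains GK (restrict G K (twisted 𝒢 2)))

        restricted : C₁.Cochain 1
        restricted = record
          { to         = λ ((g , _) , _) → x i g
          ; cong       = λ (eq , _) → mod-p⇒p¹ (lc-resp-≈ (lc i) eq)
          ; continuous = λ W (lift r) (g , _) _ w →
              let V , o , v , c = nearby (lc i) g
              in V ∘ proj₁ , U , (V , o , id , id) , Space.open-U point , v , tt , λ v′ _ → r (mod-p⇒p¹ (mod-sym (c v′))) w
          }

        -- On `K` the indices do not move modulo p, and θ and `t` are both 1 modulo p, so each
        -- single coefficient of `x` is a cocycle in ℤ/p(1).
        restricted-cocycle : C₁.IsCocycle {1} restricted
        restricted-cocycle ((g , χg , ϑg) , (h , _) , _) = mod-p⇒p¹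
          (lemma (residueᵤ (θ g) 1) (x i g) (x i h) (x i (g ∙ h)) (t g) (x (i ℕ.+ χ g) h)
            (mod-trans (mod-p¹⇒p (mod-sym (residue-≤ (PAdicUnit.value (θ g)) (ℕ.n≤1+n 1)))) ϑg)
            (cocycle i g h) (t≡1 g)
            (index-mod (lemma′ (+ i) (+ χ g) χg) h))
          where
          lemma : ∀ a xg xh xgh s y → a ≡ 1ℤ [mod p ] → xgh ≡ xg + s * y [mod p ] → s ≡ 1ℤ [mod p ] → y ≡ xh [mod p ] →
                  a * xh - (xgh - (xg - 0ℤ)) ≡ 0ℤ [mod p ]
          lemma a xg xh xgh s y h₁ h₂ h₃ h₄ = mod-conv
            (mod-+ (mod-scale xh h₁) (mod-+ (mod-neg h₂) (mod-+ (mod-scale (- y) h₃) (mod-neg h₄))))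
            (solve (a ∷ xg ∷ xh ∷ xgh ∷ s ∷ y ∷ []))
          lemma′ : ∀ a c → c ≡ 0ℤ [mod p ] → a + c ≡ a [mod p ]
          lemma′ a c h = mod-conv h (solve (a ∷ c ∷ []))

        lifted = hilbert90 K 2 (ℕ.s≤s ℕ.z≤n) (restricted , restricted-cocycle)

        F : C₂.Cochain 1
        F = proj₁ (proj₁ lifted)

        Y : ∀ g → member g → ℤ
        Y g k = ContinuousMap.to F ((g , k) , tt)

        Y-∙ : ∀ {g h} (k : member g) (l : member h) →
              Y (g ∙ h) (OpenSubgroup.∙-member K k l) ≡ Y g k + ϑ g * Y h l [mod p² ]
        Y-∙ {g} {h} k l = lemma (ϑ g) (Y g k) (Y h l) (Y (g ∙ h) (OpenSubgroup.∙-member K k l)) (proj₂ (proj₁ lifted) ((g , k) , (h , l) , tt))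
          where
          lemma : ∀ a xg xh xgh → a * xh - (xgh - (xg - 0ℤ)) ≡ 0ℤ [mod p² ] → xgh ≡ xg + a * xh [mod p² ]
          lemma a xg xh xgh h = mod-sym (mod-conv h (solve (a ∷ xg ∷ xh ∷ xgh ∷ [])))

        -- Formal Hilbert 90 lifts only up to a coboundary, but `K` acts trivially on ℤ/p(1), where
        -- 1-coboundaries vanish.
        Y≡x : ∀ {g} (k : member g) → Y g k ≡ x i g [mod p ]
        Y≡x {g} k@(_ , ϑg) =
          let c , ∂c = proj₂ lifted {proj₁ lifted} (AbelianGroup.refl (H GK (restrict G K (twisted 𝒢 2)) 1) {proj₁ lifted})
          in lemma (residueᵤ (θ g) 1) (ContinuousMap.to c tt) (Y g k) (x i g)
            (mod-p¹⇒p (∂c ((g , k) , tt)))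
            (mod-trans (mod-p¹⇒p (mod-sym (residue-≤ (PAdicUnit.value (θ g)) (ℕ.n≤1+n 1)))) ϑg)
          where
          lemma : ∀ a c y z → a * c - (c - 0ℤ) ≡ y - z [mod p ] → a ≡ 1ℤ [mod p ] → y ≡ z [mod p ]
          lemma a c y z h h′ = mod-conv (mod-+ (mod-neg h) (mod-scale c h′)) (solve (a ∷ c ∷ y ∷ z ∷ []))

        Y-resp : ∀ {g h} → g G.≈ h → (k : member g) (l : member h) → Y g k ≡ Y h l [mod p² ]
        Y-resp eq k l = ContinuousMap.cong F (eq , tt)

        Y-nearby : ∀ {g} (k : member g) → Σ[ V ∈ Pred Carrier 0ℓ ] Open V × V g × (∀ {h} → V h → ∀ (l : member h) → Y h l ≡ Y g k [mod p² ])
        Y-nearby {g} k =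
          let A , B , (V , oV , A⊆V , V⊆A) , oB , a , b , sub =
                ContinuousMap.continuous F (λ y → y ≡ Y g k [mod p² ]) (lift (λ eq e → mod-trans (mod-sym eq) e)) (g , k) tt mod-refl
          in V , oV , A⊆V a , λ v l → sub (V⊆A {_ , l} v) b

        extension : ∀ {g} → Dec (member g) → ℤ
        extension {g} (yes k) = Y g k
        extension     (no  _) = 0ℤ

      -- Extended by 0 off `K`, so that formulas in it carry no membership proofs.
      liftOnKernel : Carrier → ℤ
      liftOnKernel g = extension (member? g)

      private
        extension≡Y : ∀ {g} (d : Dec (member g)) (k : member g) → extension d ≡ Y g k [mod p² ]
        extension≡Y (yes l) k = Y-resp G.refl l k
        extension≡Y (no ¬k) k = contradiction k ¬k

        extension≡0 : ∀ {g} (d : Dec (member g)) → ¬ member g → extension d ≡ 0ℤ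
        extension≡0 (yes l) ¬l = contradiction l ¬l
        extension≡0 (no  _) _  = refl

        liftOnKernel≡Y : ∀ {g} (k : member g) → liftOnKernel g ≡ Y g k [mod p² ]
        liftOnKernel≡Y {g} = extension≡Y (member? g)

      liftOnKernel-∙ : ∀ {g h} → member g → member h →
                       liftOnKernel (g ∙ h) ≡ liftOnKernel g + ϑ g * liftOnKernel h [mod p² ]
      liftOnKernel-∙ {g} {h} k l = mod-trans (liftOnKernel≡Y (OpenSubgroup.∙-member K k l))
        (mod-trans (Y-∙ k l) (mod-sym (mod-+ (liftOnKernel≡Y k) (mod-scale (ϑ g) (liftOnKernel≡Y l)))))

      liftOnKernel-lifts : ∀ {g} → member g → liftOnKernel g ≡ x i g [mod p ]
      liftOnKernel-lifts k = mod-trans (mod-p²⇒p (liftOnKernel≡Y k)) (Y≡x k)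

      liftOnKernel-lc : LocallyConstant p² liftOnKernel
      liftOnKernel-lc = locallyConstant λ g → near g (member? g)
        where
        near : ∀ g (d : Dec (member g)) → Σ[ V ∈ Pred Carrier 0ℓ ] Open V × V g × (∀ {h} → V h → liftOnKernel h ≡ extension d [mod p² ])
        near g (yes k) = let V , oV , v , c = Y-nearby k in
          V ∩ member , G.open-∩ oV (OpenSubgroup.is-open K) , (v , k) , λ (v′ , l) → mod-trans (liftOnKernel≡Y l) (c v′ l)
        -- The fibre of (χ, θ mod p) through `g` is open and misses `K`, so the extension is 0 on
        -- it.
        near g (no ¬k) =
          (λ h → (+ χ h ≡ + χ g [mod p ]) × (ϑ h ≡ ϑ g [mod p ])) ,
          G.open-∩ (lc-open χ-lc (+ χ g)) (lc-open (lc-∣ p∣p² ϑ-lc) (ϑ g)) ,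
          (mod-refl , mod-refl) ,
          λ {h} (a , b) → ≡⇒mod (extension≡0 (member? h) (λ (c , d) → ¬k (mod-trans (mod-sym a) c , mod-trans (mod-sym b) d)))

  -- Averaging over the units u modulo p descends from ker θ̄ to G.
  module Average {χ : Carrier → ℕ} {x : ℕ → Carrier → ℤ} (z : ℕ → ℤ → Carrier → ℤ)
    (z-cong : ∀ {i j u v} g → + i ≡ + j [mod p ] → u ≡ v [mod p ] → z i u g ≡ z j v g)
    (z-lc : ∀ i u → LocallyConstant p² (z i u))
    (z-∙ : ∀ i u g h → ¬ u ≡ 0ℤ [mod p ] → z i u (g ∙ h) ≡ z i u g + t g * z (i ℕ.+ χ g) (ϑ g * u) h [mod p² ])
    (z-lifts : ∀ i u g → ¬ u ≡ 0ℤ [mod p ] → z i u g ≡ x i g [mod p ])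
    where

    -- The sign divides by the number p - 1 of units; this is exact modulo p, which is all that
    -- lifting `x` asks for.
    average : ℕ → Carrier → ℤ
    average i g = - ∑ p (λ u → nonzero p (+ u) * z i (+ u) g)

    average-lifts : ∀ i g → average i g ≡ x i g [mod p ]
    average-lifts i g = mod-trans
      (mod-neg (mod-trans (mod-∑ p (λ u → nonzero-* p (+ u) (z-lifts i (+ u) g)))
        (mod-trans (≡⇒mod (trans (∑-cong p (λ u _ → ℤ.*-comm (nonzero p (+ u)) (x i g))) (∑-* p (x i g) (λ u → nonzero p (+ u)))))
          (mod-scale (x i g) (∑-nonzero p-prime)))))
      (≡⇒mod (lemma (x i g)))
      where
      lemma : ∀ a → - (a * -1ℤ) ≡ a
      lemma a = solve (a ∷ [])

    average-cocycle : Cocycle p² χ average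
    average-cocycle = record
      { lc       = λ i → lc-neg (lc-∑ p (λ u → lc-* (lc-const (nonzero p (+ u))) (z-lc i (+ u))))
      ; periodic = λ i g → mod-neg (mod-∑ p (λ u → mod-scale (nonzero p (+ u)) (≡⇒mod (z-cong g (lemma (+ i)) mod-refl))))
      ; cocycle  = cocycle′
      }
      where
      lemma : ∀ a → + p + a ≡ a [mod p ]
      lemma a = mod-trans (mod-+ modulus≡0 (mod-refl {x = a})) (≡⇒mod (ℤ.+-identityˡ a))
      -- Multiplication by `ϑ g` permutes the units, so the sum absorbs the action on the second
      -- index and only the translation by `χ g` survives.
      cocycle′ : ∀ i g h → average i (g ∙ h) ≡ average i g + t g * average (i ℕ.+ χ g) h [mod p² ]
      cocycle′ i g h = combine (∑ p (λ u → nonzero p (+ u) * z i (+ u) (g ∙ h))) (∑ p (λ u → nonzero p (+ u) * z i (+ u) g))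
          (∑ p (λ u → nonzero p (+ u) * z (i ℕ.+ χ g) (ϑ g * + u) h)) (∑ p (λ u → F (+ u)))  (t g)
          (expand (λ u → nonzero p (+ u)) (λ u → z i (+ u) (g ∙ h)) (λ u → z i (+ u) g) (λ u → z (i ℕ.+ χ g) (ϑ g * + u) h) (t g)
            (λ u → nonzero-* p (+ u) (z-∙ i (+ u) g h)))
          rescale
        where
        F : ℤ → ℤ
        F v = nonzero p v * z (i ℕ.+ χ g) v h
        F-cong : ∀ {u v} → u ≡ v [mod p ] → F u ≡ F v [mod p² ]
        F-cong {u} {v} eq = ≡⇒mod (cong₂ _*_ (nonzero-cong p (mod-trans (mod-sym eq)) (mod-trans eq)) (z-cong h mod-refl eq))
        rescale : ∑ p (λ u → F (+ u)) ≡ ∑ p (λ u → nonzero p (+ u) * z (i ℕ.+ χ g) (ϑ g * + u) h) [mod p² ]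
        rescale = mod-trans (∑-scale (ϑ g) (ϑ (g ⁻¹)) (ϑ-⁻¹ g) F F-cong)
          (≡⇒mod (∑-cong p (λ u _ → cong (_* z (i ℕ.+ χ g) (ϑ g * + u) h)
            (nonzero-cong p (unit-cancel (ϑ g) (ϑ (g ⁻¹)) (+ u) (ϑ-⁻¹ g)) (λ u≡0 → mod-trans (mod-scale (ϑ g) u≡0) (≡⇒mod (ℤ.*-zeroʳ (ϑ g))))))))
        expand : ∀ (e a b c : ℕ → ℤ) s → (∀ u → e u * a u ≡ e u * (b u + s * c u) [mod p² ]) →
                 ∑ p (λ u → e u * a u) ≡ ∑ p (λ u → e u * b u) + s * ∑ p (λ u → e u * c u) [mod p² ]
        expand e a b c s hyp = mod-trans (mod-∑ p hyp) (≡⇒mod (trans (∑-cong p (λ u _ → distribute (e u) (b u) (c u)))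
            (trans (∑-+ p (λ u → e u * b u) (λ u → s * (e u * c u)))
              (cong (λ w → ∑ p (λ u → e u * b u) + w) (∑-* p s (λ u → e u * c u))))))
          where
          distribute : ∀ e b c → e * (b + s * c) ≡ e * b + s * (e * c)
          distribute e b c = solve (e ∷ b ∷ c ∷ s ∷ [])
        combine : ∀ a b c d s → a ≡ b + s * c [mod p² ] → d ≡ c [mod p² ] → - a ≡ - b + s * - d [mod p² ]
        combine a b c d s h₁ h₂ = mod-conv (mod-+ (mod-neg h₁) (mod-scale s h₂)) (solve (a ∷ b ∷ c ∷ d ∷ s ∷ []))

  -- Shapiro's lemma on the orbits of (χ, θ mod p)

  module Transfer {χ : Carrier → ℕ} (χ-character : Character χ) {x : ℕ → Carrier → ℤ} (x-cocycle : Cocycle p χ x) where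
    open Character χ-character
    open Cocycle x-cocycle
    open Kernel χ-character
    open OpenSubgroup K using (member)

    private
      ϑ-lc-p : LocallyConstant p ϑ
      ϑ-lc-p = lc-∣ p∣p² ϑ-lc

      -- G acts through (χ , θ mod p) on ℤ/p × ℤ/p; K is the stabiliser of every
      -- point whose second coordinate is a unit.
      Point : Set
      Point = ℕ × ℤ

      infixl 7 _·_
      _·_ : Point → Carrier → Point
      (i , u) · g = i ℕ.+ χ g , ϑ g * u

      infix 4 _≈_
      _≈_ : Point → Point → Set
      (i , u) ≈ (j , v) = (+ i ≡ + j [mod p ]) × (u ≡ v [mod p ])

      _≈?_ : ∀ P Q → Dec (P ≈ Q)
      (i , u) ≈? (j , v) = mod? p (+ i) (+ j) ×-dec mod? p u v

      ≈-trans : ∀ {P Q R} → P ≈ Q → Q ≈ R → P ≈ R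
      ≈-trans (a , b) (c , d) = mod-trans a c , mod-trans b d

      ≈-sym : ∀ {P Q} → P ≈ Q → Q ≈ P
      ≈-sym (a , b) = mod-sym a , mod-sym b

      ·-cong : ∀ {P Q} g → P ≈ Q → P · g ≈ Q · g
      ·-cong g (a , b) = mod-+ a (mod-refl {x = + χ g}) , mod-scale (ϑ g) b

      ·-∙ : ∀ P g h → P · (g ∙ h) ≈ P · g · h
      ·-∙ (i , u) g h = lemma₁ (+ i) (+ χ g) (+ χ h) (+ χ (g ∙ h)) (χ-∙ g h) ,
                        lemma₂ (ϑ g) (ϑ h) (ϑ (g ∙ h)) (mod-p²⇒p (ϑ-∙ g h))
        where
        lemma₁ : ∀ i a b c → c ≡ a + b [mod p ] → i + c ≡ i + a + b [mod p ]
        lemma₁ i a b c h = mod-conv h (solve (i ∷ a ∷ b ∷ c ∷ []))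
        lemma₂ : ∀ a b c → c ≡ a * b [mod p ] → c * u ≡ b * (a * u) [mod p ]
        lemma₂ a b c h = mod-conv (mod-scale u h) (solve (a ∷ b ∷ c ∷ u ∷ []))

      ·-ε : ∀ P → P · ε ≈ P
      ·-ε (i , u) = mod-trans (mod-+ (mod-refl {x = + i}) χ-ε) (≡⇒mod (ℤ.+-identityʳ (+ i))) ,
                    mod-trans (mod-* (mod-p²⇒p ϑ-ε) (mod-refl {x = u})) (≡⇒mod (ℤ.*-identityˡ u))

      ·-≈ : ∀ P {g h} → + χ g ≡ + χ h [mod p ] → ϑ g ≡ ϑ h [mod p ] → P · g ≈ P · h
      ·-≈ (i , u) a b = mod-+ (mod-refl {x = + i}) a , mod-* b (mod-refl {x = u})

      ·-⁻¹ : ∀ P g → P · g · g ⁻¹ ≈ P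
      ·-⁻¹ P g = ≈-trans (≈-sym (·-∙ P g (g ⁻¹)))
        (≈-trans (·-≈ P (lc-resp-≈ χ-lc (G.inverseʳ g)) (lc-resp-≈ ϑ-lc-p (G.inverseʳ g))) (·-ε P))

      SameImage : Carrier → Carrier → Set
      SameImage g h = (+ χ h ≡ + χ g [mod p ]) × (ϑ h ≡ ϑ g [mod p ])

      sameImage-open : ∀ g → Open (SameImage g)
      sameImage-open g = G.open-∩ (lc-open χ-lc (+ χ g)) (lc-open ϑ-lc-p (ϑ g))

      -- The fibres of (χ, θ mod p) form an open cover, so a finite list realises every value of the
      -- pair that occurs.
      representatives : ∃[ gs ] (∀ h → Any (λ g → SameImage g h) gs)
      representatives = IsProfinite.compact isProfinite Carrier SameImage sameImage-open (λ g → g , mod-refl , mod-refl)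

      -- The default `ε` is reached only if `Q` and `P` lie in different orbits.
      connect : Point → Point → Carrier
      connect Q P = first (λ g → (Q · g) ≈? P) ε (proj₁ representatives)

      connect-connects : ∀ {Q P} g → Q · g ≈ P → Q · connect Q P ≈ P
      connect-connects {Q} {P} g eq = first-satisfies (λ g → (Q · g) ≈? P) ε
        (Any.map (λ {h} (a , b) → ≈-trans (·-≈ Q (mod-sym a) (mod-sym b)) eq) (proj₂ representatives g))

      connect-cong : ∀ Q {P P′} → P ≈ P′ → connect Q P ≡ connect Q P′
      connect-cong Q {P} {P′} eq = first-cong (λ g → (Q · g) ≈? P) (λ g → (Q · g) ≈? P′) ε (proj₁ representatives)
        (λ _ e → ≈-trans e eq) (λ _ e → ≈-trans e (≈-sym eq))

      Reaches : Point → Point → Set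
      Reaches P Q = Q · connect Q P ≈ P

      reaches? : ∀ P Q → Dec (Reaches P Q)
      reaches? P Q = (Q · connect Q P) ≈? P

      points : List Point
      points = cartesianProduct (upTo p) (map +_ (upTo p))

      -- The first listed point of the orbit. It is strictly the same along an orbit (`base-·`), so
      -- loops built for different points of the orbit start at one base point and compose.
      base : Point → Point
      base P = first (reaches? P) (0 , 0ℤ) points

      base-reaches : ∀ P → base P · connect (base P) P ≈ P
      base-reaches P@(i , u) = first-satisfies (reaches? P) (0 , 0ℤ)
        (lose (∈-cartesianProduct⁺ (∈-upTo⁺ (n%ℕd<d (+ i) p)) (∈-map⁺ +_ (∈-upTo⁺ (n%ℕd<d u p))))
          (connect-connects ε (≈-trans (·-ε _) (mod-% (+ i) p , mod-% u p))))

      reaches-≈ : ∀ {P P′ Q} → P ≈ P′ → Reaches P Q → Reaches P′ Q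
      reaches-≈ {P} {P′} {Q} eq e = connect-connects (connect Q P) (≈-trans e eq)

      reaches-· : ∀ {P Q} g → Reaches P Q → Reaches (P · g) Q
      reaches-· {P} {Q} g e = connect-connects (connect Q P ∙ g) (≈-trans (·-∙ Q (connect Q P) g) (·-cong g e))

      base-cong : ∀ {P P′} → P ≈ P′ → base P ≡ base P′
      base-cong {P} {P′} eq = first-cong (reaches? P) (reaches? P′) (0 , 0ℤ) points
        (λ Q → reaches-≈ {Q = Q} eq) (λ Q → reaches-≈ {Q = Q} (≈-sym eq))

      base-· : ∀ P g → base (P · g) ≡ base P
      base-· P g = first-cong (reaches? (P · g)) (reaches? P) (0 , 0ℤ) points
        (λ Q e → reaches-≈ {Q = Q} (·-⁻¹ P g) (reaches-· {Q = Q} (g ⁻¹) e)) (λ Q → reaches-· {Q = Q} g)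

      Y : ℕ → Carrier → ℤ
      Y = liftOnKernel x-cocycle

      -- Shapiro's lemma: r leads from the base point Q to P and r′ from Q to P · g.
      -- The coboundary correction by x makes the reduction equal to x, not just
      -- cohomologous to it.
      term : Point → Carrier → Carrier → Carrier → ℤ
      term (o , _) r r′ g = t (r ⁻¹) * Y o (r ∙ g ∙ r′ ⁻¹) + (- x o r + t g * x o r′)

      loop-member : ∀ {Q P g r r′} → ¬ proj₂ P ≡ 0ℤ [mod p ] → Q · r ≈ P → Q · r′ ≈ P · g → member (r ∙ g ∙ r′ ⁻¹)
      loop-member {o , w} {i , u} {g} {r} {r′} u≢0 (a , b) (c , d) =
        lemma₁ (+ o) (+ χ r) (+ i) (+ χ g) (+ χ r′) (+ χ (r′ ⁻¹)) (+ χ (r ∙ g)) (+ χ (r ∙ g ∙ r′ ⁻¹)) a c (χ-⁻¹ r′) (χ-∙ r g) (χ-∙ (r ∙ g) (r′ ⁻¹)) ,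
        lemma₂ (ϑ r) (ϑ g) (ϑ r′) (ϑ (r′ ⁻¹)) (ϑ (r ∙ g)) (ϑ (r ∙ g ∙ r′ ⁻¹)) b d (ϑ-⁻¹ r′) (mod-p²⇒p (ϑ-∙ r g)) (mod-p²⇒p (ϑ-∙ (r ∙ g) (r′ ⁻¹)))
        where
        lemma₁ : ∀ o r i g r′ s rg n → o + r ≡ i [mod p ] → o + r′ ≡ i + g [mod p ] → r′ + s ≡ 0ℤ [mod p ] →
                 rg ≡ r + g [mod p ] → n ≡ rg + s [mod p ] → n ≡ 0ℤ [mod p ]
        lemma₁ o r i g r′ s rg n h₁ h₂ h₃ h₄ h₅ = mod-conv
          (mod-+ h₁ (mod-+ (mod-neg h₂) (mod-+ h₃ (mod-+ h₄ h₅))))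
          (solve (o ∷ r ∷ i ∷ g ∷ r′ ∷ s ∷ rg ∷ n ∷ []))
        lemma₂ : ∀ r g r′ s rg n → r * w ≡ u [mod p ] → r′ * w ≡ g * u [mod p ] → r′ * s ≡ 1ℤ [mod p ] →
                 rg ≡ r * g [mod p ] → n ≡ rg * s [mod p ] → n ≡ 1ℤ [mod p ]
        lemma₂ r g r′ s rg n h₁ h₂ h₃ h₄ h₅ =
          -- `w` is nonzero because `r` carries it to the nonzero `u`; hence `w * n ≡ w` forces
          -- `n ≡ 1`.
          [ (λ w≡0 → contradiction (w≡0⇒ w≡0) u≢0) , n-1≡0⇒ ]′ (euclid p-prime w (n - 1ℤ) w[n-1]≡0)
          where
          w≡0⇒ : w ≡ 0ℤ [mod p ] → u ≡ 0ℤ [mod p ]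
          w≡0⇒ h = mod-conv (mod-+ (mod-neg h₁) (mod-scale r h)) (solve (r ∷ w ∷ u ∷ []))
          n-1≡0⇒ : n - 1ℤ ≡ 0ℤ [mod p ] → n ≡ 1ℤ [mod p ]
          n-1≡0⇒ h = mod-conv h (solve (n ∷ []))
          w[n-1]≡0 : w * (n - 1ℤ) ≡ 0ℤ [mod p ]
          w[n-1]≡0 = mod-conv
            (mod-+ (mod-scale w h₅) (mod-+ (mod-scale (s * w) h₄) (mod-+ (mod-scale (g * s) h₁) (mod-+ (mod-scale (- s) h₂) (mod-scale w h₃)))))
            (solve (r ∷ g ∷ r′ ∷ s ∷ rg ∷ n ∷ w ∷ u ∷ []))

      loop-∙ : ∀ r g r′ h r″ → r ∙ (g ∙ h) ∙ r″ ⁻¹ G.≈ (r ∙ g ∙ r′ ⁻¹) ∙ (r′ ∙ h ∙ r″ ⁻¹)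
      loop-∙ r g r′ h r″ = G.sym (begin
        (r ∙ g ∙ r′ ⁻¹) ∙ (r′ ∙ h ∙ r″ ⁻¹)   ≈⟨ G.assoc _ _ _ ⟩
        r ∙ g ∙ (r′ ⁻¹ ∙ (r′ ∙ h ∙ r″ ⁻¹))   ≈⟨ G.∙-congˡ (G.assoc _ _ _) ⟨
        r ∙ g ∙ (r′ ⁻¹ ∙ (r′ ∙ h) ∙ r″ ⁻¹)   ≈⟨ G.∙-congˡ (G.∙-congʳ (G.assoc _ _ _)) ⟨
        r ∙ g ∙ (r′ ⁻¹ ∙ r′ ∙ h ∙ r″ ⁻¹)     ≈⟨ G.∙-congˡ (G.∙-congʳ (G.∙-congʳ (G.inverseˡ r′))) ⟩
        r ∙ g ∙ (ε ∙ h ∙ r″ ⁻¹)              ≈⟨ G.∙-congˡ (G.∙-congʳ (G.identityˡ h)) ⟩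
        r ∙ g ∙ (h ∙ r″ ⁻¹)                  ≈⟨ G.assoc _ _ _ ⟨
        r ∙ g ∙ h ∙ r″ ⁻¹                    ≈⟨ G.∙-congʳ (G.assoc _ _ _) ⟩
        r ∙ (g ∙ h) ∙ r″ ⁻¹                  ∎)
        where open import Relation.Binary.Reasoning.Setoid G.setoid

      -- The loops compose. The first lies in `K`, where θ agrees with `t`, so `t (r ⁻¹) * ϑ n₁`
      -- becomes `t g * t (r′ ⁻¹)`; the terms in `x` telescope.
      term-∙ : ∀ {Q P g r r′} h r″ → ¬ proj₂ P ≡ 0ℤ [mod p ] → Q · r ≈ P → Q · r′ ≈ P · g → Q · r″ ≈ P · g · h →
               term Q r r″ (g ∙ h) ≡ term Q r r′ g + t g * term Q r′ r″ h [mod p² ]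
      term-∙ {Q@(o , w)} {P} {g} {r} {r′} h r″ u≢0 e e′ e″ =
        lemma (t r) (t (r ⁻¹)) (t g) (t h) (t (g ∙ h)) (t (r′ ⁻¹)) (Y o n₁) (Y o n₂) (Y o n₁₂) (ϑ n₁) (x o r) (x o r′) (x o r″)
          (mod-trans (lc-resp-≈ (liftOnKernel-lc x-cocycle o) (loop-∙ r g r′ h r″))
            (liftOnKernel-∙ x-cocycle o n₁∈K (loop-member {Q} {P · g} ug≢0 e′ e″)))
          (mod-trans (mod-sym (t≡ϑ (proj₂ n₁∈K))) (mod-trans (t-∙ (r ∙ g) (r′ ⁻¹)) (mod-* (t-∙ r g) mod-refl)))
          (t-inverse r) (t-∙ g h)
        where
        n₁ n₂ n₁₂ : Carrier
        n₁  = r ∙ g ∙ r′ ⁻¹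
        n₂  = r′ ∙ h ∙ r″ ⁻¹
        n₁₂ = r ∙ (g ∙ h) ∙ r″ ⁻¹
        n₁∈K : member n₁
        n₁∈K = loop-member {Q} {P} u≢0 e e′
        ug≢0 : ¬ ϑ g * proj₂ P ≡ 0ℤ [mod p ]
        ug≢0 eq = u≢0 (unit-cancel (ϑ g) (ϑ (g ⁻¹)) (proj₂ P) (ϑ-⁻¹ g) eq)
        lemma : ∀ T S tg th tgh T′ y₁ y₂ y₁₂ n a a′ a″ → y₁₂ ≡ y₁ + n * y₂ [mod p² ] → n ≡ T * tg * T′ [mod p² ] →
                T * S ≡ 1ℤ [mod p² ] → tgh ≡ tg * th [mod p² ] →
                S * y₁₂ + (- a + tgh * a″) ≡ S * y₁ + (- a + tg * a′) + tg * (T′ * y₂ + (- a′ + th * a″)) [mod p² ]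
        lemma T S tg th tgh T′ y₁ y₂ y₁₂ n a a′ a″ h₁ h₂ h₃ h₄ = mod-conv
          (mod-+ (mod-scale S h₁) (mod-+ (mod-scale (S * y₂) h₂) (mod-+ (mod-scale (tg * T′ * y₂) h₃) (mod-scale a″ h₄))))
          (solve (T ∷ S ∷ tg ∷ th ∷ tgh ∷ T′ ∷ y₁ ∷ y₂ ∷ y₁₂ ∷ n ∷ a ∷ a′ ∷ a″ ∷ []))

      x-ε : ∀ i → x i ε ≡ 0ℤ [mod p ]
      x-ε i = lemma (x i ε) (t ε) (x (i ℕ.+ χ ε) ε) (mod-trans (lc-resp-≈ (lc i) (G.sym (G.identityˡ ε))) (cocycle i ε ε))
        (t≡1 ε) (index-mod (mod-trans (mod-+ (mod-refl {x = + i}) χ-ε) (≡⇒mod (ℤ.+-identityʳ (+ i)))) ε)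
        where
        lemma : ∀ a s b → a ≡ a + s * b [mod p ] → s ≡ 1ℤ [mod p ] → b ≡ a [mod p ] → a ≡ 0ℤ [mod p ]
        lemma a s b h₁ h₂ h₃ = mod-conv (mod-+ (mod-neg h₁) (mod-+ (mod-scale (- b) h₂) (mod-neg h₃))) (solve (a ∷ s ∷ b ∷ []))

      -- Modulo p the cocycle rule splits `x o` on the loop into contributions of `r`, `g` and
      -- `r′ ⁻¹`; the correction removes the first, and the last as well because `x o ε ≡ 0`.
      term-lifts : ∀ {Q P g r r′} → ¬ proj₂ P ≡ 0ℤ [mod p ] → Q · r ≈ P → Q · r′ ≈ P · g →
                   term Q r r′ g ≡ x (proj₁ P) g [mod p ]
      term-lifts {Q@(o , w)} {P@(i , u)} {g} {r} {r′} u≢0 e e′ =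
        lemma (t (r ⁻¹)) (t g) (Y o n) (x o n) (x o (r ∙ g)) (t (r ∙ g)) (x (o ℕ.+ χ (r ∙ g)) (r′ ⁻¹)) (x o r) (t r) (x (o ℕ.+ χ r) g)
          (x i g) (x o r′) (t r′) (x (o ℕ.+ χ r′) (r′ ⁻¹))
          (t≡1 (r ⁻¹)) (t≡1 g) (t≡1 (r ∙ g)) (t≡1 r) (t≡1 r′)
          (liftOnKernel-lifts x-cocycle o (loop-member {Q} {P} u≢0 e e′))
          (cocycle o (r ∙ g) (r′ ⁻¹)) (cocycle o r g)
          (index-mod (proj₁ e) g)
          (mod-trans (mod-sym (cocycle o r′ (r′ ⁻¹))) (mod-trans (lc-resp-≈ (lc o) (G.inverseʳ r′)) (x-ε o)))
          (index-mod (mod-trans (proj₁ (·-∙ Q r g)) (mod-trans (proj₁ (·-cong {Q · r} {P} g e)) (mod-sym (proj₁ e′)))) (r′ ⁻¹))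
        where
        n : Carrier
        n = r ∙ g ∙ r′ ⁻¹
        lemma : ∀ S tg y xn xrg trg xs xr tr xg′ xg xr′ tr′ xs′ →
          S ≡ 1ℤ [mod p ] → tg ≡ 1ℤ [mod p ] → trg ≡ 1ℤ [mod p ] → tr ≡ 1ℤ [mod p ] → tr′ ≡ 1ℤ [mod p ] →
          y ≡ xn [mod p ] → xn ≡ xrg + trg * xs [mod p ] → xrg ≡ xr + tr * xg′ [mod p ] → xg′ ≡ xg [mod p ] →
          xr′ + tr′ * xs′ ≡ 0ℤ [mod p ] → xs ≡ xs′ [mod p ] →
          S * y + (- xr + tg * xr′) ≡ xg [mod p ]
        lemma S tg y xn xrg trg xs xr tr xg′ xg xr′ tr′ xs′ h₁ h₂ h₃ h₄ h₅ h₆ h₇ h₈ h₉ h₁₀ h₁₁ = mod-conv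
          (mod-+ (mod-scale y h₁) (mod-+ (mod-scale xr′ h₂) (mod-+ (mod-scale xs h₃) (mod-+ (mod-scale xg′ h₄) (mod-+ (mod-scale (- xs′) h₅)
            (mod-+ h₆ (mod-+ h₇ (mod-+ h₈ (mod-+ h₉ (mod-+ h₁₀ h₁₁))))))))))
          (solve (S ∷ tg ∷ y ∷ xn ∷ xrg ∷ trg ∷ xs ∷ xr ∷ tr ∷ xg′ ∷ xg ∷ xr′ ∷ tr′ ∷ xs′ ∷ []))

      abstract
        z : Point → Carrier → ℤ
        z P g = term (base P) (connect (base P) P) (connect (base P) (P · g)) g

        z-cong : ∀ {P P′} g → P ≈ P′ → z P g ≡ z P′ g
        z-cong {P} {P′} g eq = go (base P) (base P′) (base-cong eq)
          where
          go : ∀ Q Q′ → Q ≡ Q′ → term Q (connect Q P) (connect Q (P · g)) g ≡ term Q′ (connect Q′ P′) (connect Q′ (P′ · g)) g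
          go Q .Q refl = cong₂ (λ r r′ → term Q r r′ g) (connect-cong Q eq) (connect-cong Q (·-cong g eq))

        z-lc : ∀ P → LocallyConstant p² (z P)
        z-lc P = lc-choose (λ g → connect Q (P · g)) {F = term Q r}
          (λ g → SameImage g , sameImage-open g , (mod-refl , mod-refl) , λ (a , b) → connect-cong Q (·-≈ P a b))
          (λ r′ → lc-+ (lc-* (lc-const (t (r ⁻¹))) (lc-translate (liftOnKernel-lc x-cocycle (proj₁ Q)) r (r′ ⁻¹)))
                       (lc-+ (lc-const (- x (proj₁ Q) r)) (lc-* t-lc (lc-const (x (proj₁ Q) r′)))))
          where
          Q : Point
          Q = base P
          r : Carrier
          r = connect Q P

        z-∙ : ∀ P g h → ¬ proj₂ P ≡ 0ℤ [mod p ] → z P (g ∙ h) ≡ z P g + t g * z (P · g) h [mod p² ]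
        z-∙ P g h u≢0 = go (base P) (base (P · g)) (base-· P g) (base-reaches P) (base-reaches (P · g))
          where
          go : ∀ Q Q′ → Q′ ≡ Q → Q · connect Q P ≈ P → Q′ · connect Q′ (P · g) ≈ P · g →
               term Q (connect Q P) (connect Q (P · (g ∙ h))) (g ∙ h) ≡
               term Q (connect Q P) (connect Q (P · g)) g + t g * term Q′ (connect Q′ (P · g)) (connect Q′ (P · g · h)) h [mod p² ]
          go Q .Q refl e e′ = mod-trans (≡⇒mod (cong (λ r″ → term Q (connect Q P) r″ (g ∙ h)) (connect-cong Q (·-∙ P g h))))
            (term-∙ {Q} {P} h (connect Q (P · g · h)) u≢0 e e′ (reaches-· {P · g} {Q} h e′))

        z-lifts : ∀ P g → ¬ proj₂ P ≡ 0ℤ [mod p ] → z P g ≡ x (proj₁ P) g [mod p ]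
        z-lifts P g u≢0 = term-lifts {base P} {P} u≢0 (base-reaches P) (reaches-· {P} {base P} g (base-reaches P))

    private
      averaged : Σ[ X ∈ (ℕ → Carrier → ℤ) ] Cocycle p² χ X × (∀ i g → X i g ≡ x i g [mod p ])
      averaged = average , average-cocycle , average-lifts
        where
        open Average {χ} {x} (λ i u → z (i , u))
          (λ {i} {j} {u} {v} g a b → z-cong {i , u} {j , v} g (a , b))
          (λ i u → z-lc (i , u)) (λ i u → z-∙ (i , u)) (λ i u → z-lifts (i , u))

    abstract
      -- Every later use of formal Hilbert 90 passes through this statement, for χ, χ′, χ′ - χ and
      -- the trivial character.
      liftCocycle : Σ[ X ∈ (ℕ → Carrier → ℤ) ] Cocycle p² χ X × (∀ i g → X i g ≡ x i g [mod p ])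
      liftCocycle = averaged

  open Transfer using (liftCocycle)

  -- Norms

  open Cocycle

  trivialCharacter : Character (const 0)
  trivialCharacter = record { χ-lc = lc-const 0ℤ ; χ-∙ = λ _ _ → mod-refl }

  Twisted : ℕ → (Carrier → ℤ) → Set₁
  Twisted m f = Cocycle m (const 0) (const f)

  liftTwisted : ∀ {f} → Twisted p f → Σ[ F ∈ (Carrier → ℤ) ] Twisted p² F × (∀ g → F g ≡ f g [mod p ])
  liftTwisted {f} f-tw = let X , X-cocycle , X-lifts = liftCocycle trivialCharacter f-tw in
    X 0 , record { lc = λ _ → lc X-cocycle 0 ; periodic = λ _ _ → mod-refl ; cocycle = λ _ → cocycle X-cocycle 0 } , X-lifts 0

  additive⇒twisted : ∀ {f} → LocallyConstant p f → (∀ g h → f (g ∙ h) ≡ f g + f h [mod p ]) → Twisted p f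
  additive⇒twisted {f} f-lc f-∙ = record
    { lc = λ _ → f-lc ; periodic = λ _ _ → mod-refl
    ; cocycle = λ _ g h → lemma (f g) (f h) (f (g ∙ h)) (t g) (f-∙ g h) (t≡1 g) }
    where
    lemma : ∀ a b c s → c ≡ a + b [mod p ] → s ≡ 1ℤ [mod p ] → c ≡ a + s * b [mod p ]
    lemma a b c s h₁ h₂ = mod-conv (mod-+ h₁ (mod-scale (- b) h₂)) (solve (a ∷ b ∷ c ∷ s ∷ []))

  -- Summing over a full period absorbs the translation of indices: this is the norm map.
  ∑-twisted : ∀ {m χ x} → Cocycle m χ x → Twisted m (λ g → ∑ p (λ i → x i g))
  ∑-twisted {m} {χ} {x} c = record
    { lc = λ _ → lc-∑ p (lc c) ; periodic = λ _ _ → mod-refl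
    ; cocycle = λ _ g h → mod-trans (mod-∑ p (λ i → cocycle c i g h))
        (mod-trans (≡⇒mod (trans (∑-+ p (λ i → x i g) (λ i → t g * x (i ℕ.+ χ g) h))
            (cong (λ w → ∑ p (λ i → x i g) + w) (∑-* p (t g) (λ i → x (i ℕ.+ χ g) h)))))
          (mod-+ (mod-refl {x = ∑ p (λ i → x i g)}) (mod-scale (t g) (∑-shift p {f = λ i → x i h} (λ i → periodic c i h) (χ g))))) }

  -- Multiplication by p embeds ℤ/p in ℤ/p²; its injectivity, `cancel-p`, carries each law over to
  -- the quotient.
  divideCocycle : ∀ {χ N} → Cocycle p² χ N → (∀ i g → N i g ≡ 0ℤ [mod p ]) →
                  Σ[ x ∈ (ℕ → Carrier → ℤ) ] Cocycle p χ x × (∀ i g → N i g ≡ + p * x i g)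
  divideCocycle {χ} {N} c N≡0 = x , record
    { lc       = λ i → lc-via (lc c i) (λ g h e → cancel-p (x i h) (x i g)
        (mod-trans (≡⇒mod (sym (N≡px i h))) (mod-trans e (≡⇒mod (N≡px i g)))))
    ; periodic = λ i g → cancel-p (x (p ℕ.+ i) g) (x i g)
        (mod-trans (≡⇒mod (sym (N≡px (p ℕ.+ i) g))) (mod-trans (periodic c i g) (≡⇒mod (N≡px i g))))
    ; cocycle  = λ i g h → cancel-p (x i (g ∙ h)) (x i g + t g * x (i ℕ.+ χ g) h)
        (mod-trans (≡⇒mod (sym (N≡px i (g ∙ h)))) (mod-trans (cocycle c i g h)
          (≡⇒mod (trans (cong₂ (λ a b → a + t g * b) (N≡px i g) (N≡px (i ℕ.+ χ g) h)) (lemma (+ p) (x i g) (t g) (x (i ℕ.+ χ g) h))))))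
    } , N≡px
    where
    x : ℕ → Carrier → ℤ
    x i g = proj₁ (divide (N≡0 i g))
    N≡px : ∀ i g → N i g ≡ + p * x i g
    N≡px i g = proj₂ (divide (N≡0 i g))
    lemma : ∀ p a s b → p * a + s * (p * b) ≡ p * (a + s * b)
    lemma p a s b = solve (p ∷ a ∷ s ∷ b ∷ [])

  -- If φ trivialises χ ∪ b then ψᵢ = φ + i b is a cocycle, and a cocycle α of
  -- norm b is read off lifts of b and ψ modulo p² by p αᵢ = b + ψᵢ − ψᵢ₊₁.
  module _ {χ : Carrier → ℕ} (χ-character : Character χ) {b φ : Carrier → ℤ}
    (b-lc : LocallyConstant p b) (b-∙ : ∀ g h → b (g ∙ h) ≡ b g + b h [mod p ])
    (φ-lc : LocallyConstant p φ) (φ-∙ : ∀ g h → φ (g ∙ h) ≡ φ g + φ h + + χ g * b h [mod p ]) where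

    private
      ψ : ℕ → Carrier → ℤ
      ψ i g = φ g + + i * b g

      ψ-cocycle : Cocycle p χ ψ
      ψ-cocycle = record
        { lc       = λ i → lc-+ φ-lc (lc-* (lc-const (+ i)) b-lc)
        ; periodic = λ i g → lemma₁ (φ g) (b g) (+ p) (+ i) modulus≡0
        ; cocycle  = λ i g h → lemma₂ (φ g) (φ h) (φ (g ∙ h)) (b g) (b h) (b (g ∙ h)) (+ i) (+ χ g) (t g) (φ-∙ g h) (b-∙ g h) (t≡1 g)
        }
        where
        lemma₁ : ∀ f b q i → q ≡ 0ℤ [mod p ] → f + (q + i) * b ≡ f + i * b [mod p ]
        lemma₁ f b q i h = mod-conv (mod-scale b h) (solve (f ∷ b ∷ q ∷ i ∷ []))
        lemma₂ : ∀ fg fh fgh bg bh bgh i χg s → fgh ≡ fg + fh + χg * bh [mod p ] → bgh ≡ bg + bh [mod p ] → s ≡ 1ℤ [mod p ] →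
                 fgh + i * bgh ≡ fg + i * bg + s * (fh + (i + χg) * bh) [mod p ]
        lemma₂ fg fh fgh bg bh bgh i χg s h₁ h₂ h₃ = mod-conv
          (mod-+ h₁ (mod-+ (mod-scale i h₂) (mod-scale (- (fh + (i + χg) * bh)) h₃)))
          (solve (fg ∷ fh ∷ fgh ∷ bg ∷ bh ∷ bgh ∷ i ∷ χg ∷ s ∷ []))

      module FromLifts
        {Ψ : ℕ → Carrier → ℤ} (Ψ-cocycle : Cocycle p² χ Ψ) (Ψ-lifts : ∀ i g → Ψ i g ≡ ψ i g [mod p ])
        {B : Carrier → ℤ} (B-twisted : Twisted p² B) (B-lifts : ∀ g → B g ≡ b g [mod p ]) where

        N : ℕ → Carrier → ℤ
        N i g = B g + (Ψ i g - Ψ (suc i) g)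
        N-cocycle : Cocycle p² χ N
        N-cocycle = record
          { lc       = λ i → lc-+ (lc B-twisted i) (lc-+ (lc Ψ-cocycle i) (lc-neg (lc Ψ-cocycle (suc i))))
          ; periodic = λ i g → mod-+ (mod-refl {x = B g}) (mod-+ (periodic Ψ-cocycle i g)
              (mod-neg (mod-trans (≡⇒mod (cong (λ k → Ψ k g) (sym (ℕ.+-suc p i)))) (periodic Ψ-cocycle (suc i) g))))
          ; cocycle  = λ i g h → lemma (B g) (B h) (B (g ∙ h)) (Ψ i g) (Ψ (i ℕ.+ χ g) h) (Ψ i (g ∙ h))
              (Ψ (suc i) g) (Ψ (suc (i ℕ.+ χ g)) h) (Ψ (suc i) (g ∙ h)) (t g)
              (cocycle B-twisted 0 g h) (cocycle Ψ-cocycle i g h) (cocycle Ψ-cocycle (suc i) g h)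
          }
          where
          lemma : ∀ bg bh bgh xg xh xgh yg yh ygh s → bgh ≡ bg + s * bh [mod p² ] → xgh ≡ xg + s * xh [mod p² ] →
                  ygh ≡ yg + s * yh [mod p² ] → bgh + (xgh - ygh) ≡ bg + (xg - yg) + s * (bh + (xh - yh)) [mod p² ]
          lemma bg bh bgh xg xh xgh yg yh ygh s h₁ h₂ h₃ = mod-conv (mod-+ h₁ (mod-+ h₂ (mod-neg h₃)))
            (solve (bg ∷ bh ∷ bgh ∷ xg ∷ xh ∷ xgh ∷ yg ∷ yh ∷ ygh ∷ s ∷ []))
        N≡0 : ∀ i g → N i g ≡ 0ℤ [mod p ]
        N≡0 i g = lemma (B g) (Ψ i g) (Ψ (suc i) g) (b g) (φ g) (+ i) (B-lifts g) (Ψ-lifts i g) (Ψ-lifts (suc i) g)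
          where
          lemma : ∀ B x y b f i → B ≡ b [mod p ] → x ≡ f + i * b [mod p ] → y ≡ f + (1ℤ + i) * b [mod p ] → B + (x - y) ≡ 0ℤ [mod p ]
          lemma B x y b f i h₁ h₂ h₃ = mod-conv (mod-+ h₁ (mod-+ h₂ (mod-neg h₃))) (solve (B ∷ x ∷ y ∷ b ∷ f ∷ i ∷ []))
        divided = divideCocycle N-cocycle N≡0
        α : ℕ → Carrier → ℤ
        α = proj₁ divided
        α-cocycle : Cocycle p χ α
        α-cocycle = proj₁ (proj₂ divided)
        -- Over a full period the differences of `Ψ` telescope to 0 modulo p², leaving p times the
        -- norm of `α` equal to `p * B g`.
        ∑α≡b : ∀ g → ∑ p (λ i → α i g) ≡ b g [mod p ]
        ∑α≡b g = mod-trans (cancel-p (∑ p (λ i → α i g)) (B g)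
          (mod-trans (≡⇒mod (trans (sym (∑-* p (+ p) (λ i → α i g)))
              (trans (∑-cong p (λ i _ → sym (proj₂ (proj₂ divided) i g)))
                (trans (∑-+ p (λ _ → B g) (λ i → Ψ i g - Ψ (suc i) g))
                  (cong₂ _+_ (∑-const p (B g)) (∑-telescope p (λ i → Ψ i g)))))))
            (lemma (+ p * B g) (Ψ 0 g) (Ψ p g) (mod-trans (≡⇒mod (cong (λ k → Ψ k g) (sym (ℕ.+-identityʳ p)))) (periodic Ψ-cocycle 0 g)))))
          (B-lifts g)
          where
          lemma : ∀ a x y → y ≡ x [mod p² ] → a + (x - y) ≡ a [mod p² ]
          lemma a x y h = mod-conv (mod-neg h) (solve (a ∷ x ∷ y ∷ []))

    norm : Σ[ α ∈ (ℕ → Carrier → ℤ) ] Cocycle p χ α × (∀ g → ∑ p (λ i → α i g) ≡ b g [mod p ])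
    norm =
      let Ψ , Ψ-cocycle , Ψ-lifts = liftCocycle χ-character ψ-cocycle
          B , B-twisted , B-lifts = liftTwisted (additive⇒twisted b-lc b-∙)
          open FromLifts Ψ-cocycle Ψ-lifts B-twisted B-lifts
      in α , α-cocycle , ∑α≡b

  -- The norms of arbitrary lifts differ by p e, the norm of the constant family e.
  module _ {χ χ′ : Carrier → ℕ} {α γ : ℕ → Carrier → ℤ} (χ-character : Character χ) (χ′-character : Character χ′)
    (α-cocycle : Cocycle p χ α) (γ-cocycle : Cocycle p χ′ γ)
    (norms≡ : ∀ g → ∑ p (λ i → α i g) ≡ ∑ p (λ i → γ i g) [mod p ]) where

    private
      module Difference
        {A₀ : ℕ → Carrier → ℤ} (A₀-cocycle : Cocycle p² χ A₀) (A₀-lifts : ∀ i g → A₀ i g ≡ α i g [mod p ])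
        {Γ : ℕ → Carrier → ℤ} (Γ-cocycle : Cocycle p² χ′ Γ) (Γ-lifts : ∀ i g → Γ i g ≡ γ i g [mod p ]) where

        D : Carrier → ℤ
        D g = ∑ p (λ i → Γ i g) - ∑ p (λ i → A₀ i g)
        D-twisted : Twisted p² D
        D-twisted = record
          { lc = λ i → lc-+ (lc (∑-twisted Γ-cocycle) i) (lc-neg (lc (∑-twisted A₀-cocycle) i))
          ; periodic = λ _ _ → mod-refl
          ; cocycle = λ _ g h → lemma (∑ p (λ i → Γ i g)) (∑ p (λ i → Γ i h)) (∑ p (λ i → Γ i (g ∙ h)))
              (∑ p (λ i → A₀ i g)) (∑ p (λ i → A₀ i h)) (∑ p (λ i → A₀ i (g ∙ h))) (t g)
              (cocycle (∑-twisted Γ-cocycle) 0 g h) (cocycle (∑-twisted A₀-cocycle) 0 g h) }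
          where
          lemma : ∀ xg xh xgh yg yh ygh s → xgh ≡ xg + s * xh [mod p² ] → ygh ≡ yg + s * yh [mod p² ] →
                  xgh - ygh ≡ xg - yg + s * (xh - yh) [mod p² ]
          lemma xg xh xgh yg yh ygh s h₁ h₂ = mod-conv (mod-+ h₁ (mod-neg h₂)) (solve (xg ∷ xh ∷ xgh ∷ yg ∷ yh ∷ ygh ∷ s ∷ []))
        D≡0 : ∀ g → D g ≡ 0ℤ [mod p ]
        D≡0 g = lemma (∑ p (λ i → Γ i g)) (∑ p (λ i → A₀ i g)) (∑ p (λ i → γ i g)) (∑ p (λ i → α i g))
          (mod-∑ p (λ i → Γ-lifts i g)) (mod-∑ p (λ i → A₀-lifts i g)) (norms≡ g)
          where
          lemma : ∀ a b c d → a ≡ c [mod p ] → b ≡ d [mod p ] → d ≡ c [mod p ] → a - b ≡ 0ℤ [mod p ]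
          lemma a b c d h₁ h₂ h₃ = mod-conv (mod-+ h₁ (mod-+ (mod-neg h₂) (mod-neg h₃))) (solve (a ∷ b ∷ c ∷ d ∷ []))

        module Correction {e : Carrier → ℤ} (D≡pe : ∀ g → D g ≡ + p * e g)
          {E : Carrier → ℤ} (E-twisted : Twisted p² E) (E-lifts : ∀ g → E g ≡ e g [mod p ]) where

          A : ℕ → Carrier → ℤ
          A i g = A₀ i g + E g
          A-cocycle : Cocycle p² χ A
          A-cocycle = record
            { lc       = λ i → lc-+ (lc A₀-cocycle i) (lc E-twisted 0)
            ; periodic = λ i g → mod-+ (periodic A₀-cocycle i g) (mod-refl {x = E g})
            ; cocycle  = λ i g h → lemma (A₀ i g) (A₀ (i ℕ.+ χ g) h) (A₀ i (g ∙ h)) (E g) (E h) (E (g ∙ h)) (t g)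
                (cocycle A₀-cocycle i g h) (cocycle E-twisted 0 g h)
            }
            where
            lemma : ∀ xg xh xgh yg yh ygh s → xgh ≡ xg + s * xh [mod p² ] → ygh ≡ yg + s * yh [mod p² ] →
                    xgh + ygh ≡ xg + yg + s * (xh + yh) [mod p² ]
            lemma xg xh xgh yg yh ygh s h₁ h₂ = mod-conv (mod-+ h₁ h₂) (solve (xg ∷ xh ∷ xgh ∷ yg ∷ yh ∷ ygh ∷ s ∷ []))
          sums : ∀ g → ∑ p (λ i → A i g) ≡ ∑ p (λ i → Γ i g) [mod p² ]
          sums g = mod-trans (≡⇒mod (trans (∑-+ p (λ i → A₀ i g) (λ _ → E g)) (cong (λ w → ∑ p (λ i → A₀ i g) + w) (∑-const p (E g)))))
            (lemma (∑ p (λ i → A₀ i g)) (∑ p (λ i → Γ i g)) (+ p * E g) (+ p * e g) (mod-scale-p (E-lifts g)) (D≡pe g))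
            where
            lemma : ∀ a c E e → E ≡ e [mod p² ] → c - a ≡ e → a + E ≡ c [mod p² ]
            lemma a c E e h eq = mod-conv (mod-+ h (≡⇒mod (sym eq))) (solve (a ∷ c ∷ E ∷ e ∷ []))

    -- `Γ` still reduces to `γ`, whereas adding `E` changes `α` by `e` modulo p. The norm of `α`
    -- modulo p does not change, being altered by p times `e`.
    equaliseNorms : Σ[ A ∈ (ℕ → Carrier → ℤ) ] Σ[ Γ ∈ (ℕ → Carrier → ℤ) ] Cocycle p² χ A × Cocycle p² χ′ Γ ×
      (∀ g → ∑ p (λ i → A i g) ≡ ∑ p (λ i → Γ i g) [mod p² ]) × (∀ i g → Γ i g ≡ γ i g [mod p ])
    equaliseNorms =
      let A₀ , A₀-cocycle , A₀-lifts = liftCocycle χ-character α-cocycle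
          Γ , Γ-cocycle , Γ-lifts = liftCocycle χ′-character γ-cocycle
          open Difference A₀-cocycle A₀-lifts Γ-cocycle Γ-lifts
          e , e-cocycle , D≡pe = divideCocycle D-twisted (λ _ → D≡0)
          E , E-twisted , E-lifts = liftTwisted {e 0} record
            { lc = λ _ → lc e-cocycle 0 ; periodic = λ _ _ → mod-refl ; cocycle = λ _ → cocycle e-cocycle 0 }
          open Correction (D≡pe 0) E-twisted E-lifts
      in A , Γ , A-cocycle , Γ-cocycle , sums , Γ-lifts

  -- Hilbert 90 along the diagonals of (ℤ/p)²

  untwist : ∀ {χ x} → Cocycle p² χ x → ∀ i g h → x i (g ∙ h) ≡ x i g + x (i ℕ.+ χ g) h [mod p ]
  untwist {χ} {x} c i g h = lemma (x i g) (x (i ℕ.+ χ g) h) (x i (g ∙ h)) (t g) (mod-p²⇒p (cocycle c i g h)) (t≡1 g)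
    where
    lemma : ∀ a b c s → c ≡ a + s * b [mod p ] → s ≡ 1ℤ [mod p ] → c ≡ a + b [mod p ]
    lemma a b c s h₁ h₂ = mod-conv (mod-+ h₁ (mod-scale b h₂)) (solve (a ∷ b ∷ c ∷ s ∷ []))

  module Diagonals {χ χ′ : Carrier → ℕ} (χ-character : Character χ) (χ′-character : Character χ′)
    {α γ : ℕ → Carrier → ℤ} (α-cocycle : Cocycle p² χ α) (γ-cocycle : Cocycle p² χ′ γ)
    (norms≡ : ∀ g → ∑ p (λ i → α i g) ≡ ∑ p (λ i → γ i g) [mod p² ]) where

    open Character

    -- This is χ′ - χ with `- χ` written as `(p - 1) χ` to stay in ℕ. The point (i, j) moves to (i +
    -- χ g, j + χ′ g), so the diagonal k = j - i moves to k + ρ g.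
    ρ : Carrier → ℕ
    ρ g = χ′ g ℕ.+ ℕ.pred p ℕ.* χ g

    ρ+χ : ∀ g → ρ g ℕ.+ χ g ≡ χ g ℕ.* p ℕ.+ χ′ g
    ρ+χ g = trans (ℕ.+-assoc (χ′ g) (ℕ.pred p ℕ.* χ g) (χ g)) (trans (cong (χ′ g ℕ.+_)
      (trans (ℕ.+-comm (ℕ.pred p ℕ.* χ g) (χ g)) (trans (cong (ℕ._* χ g) (ℕ.suc-pred p)) (ℕ.*-comm p (χ g))))) (ℕ.+-comm (χ′ g) (χ g ℕ.* p)))

    ρ≡χ′-χ : ∀ g → + ρ g ≡ + χ′ g - + χ g [mod p ]
    ρ≡χ′-χ g = lemma (+ ρ g) (+ χ g) (+ χ′ g) (+ p) (trans (cong +_ (ρ+χ g)) (cong (_+ + χ′ g) (ℤ.pos-* (χ g) p))) modulus≡0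
      where
      lemma : ∀ r s s′ q → r + s ≡ s * q + s′ → q ≡ 0ℤ [mod p ] → r ≡ s′ - s [mod p ]
      lemma r s s′ q e h = mod-conv (mod-+ (≡⇒mod e) (mod-scale s h)) (solve (r ∷ s ∷ s′ ∷ q ∷ []))

    ρ-character : Character ρ
    ρ-character = record
      { χ-lc = lc-via₂ (χ-lc χ-character) (χ-lc χ′-character) (λ g h e e′ →
          mod-trans (ρ≡χ′-χ h) (mod-trans (mod-+ e′ (mod-neg e)) (mod-sym (ρ≡χ′-χ g))))
      ; χ-∙ = λ g h → mod-trans (ρ≡χ′-χ (g ∙ h)) (mod-trans (mod-+ (χ-∙ χ′-character g h) (mod-neg (χ-∙ χ-character g h)))
          (mod-trans (≡⇒mod (lemma (+ χ g) (+ χ h) (+ χ′ g) (+ χ′ h))) (mod-sym (mod-+ (ρ≡χ′-χ g) (ρ≡χ′-χ h)))))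
      }
      where
      lemma : ∀ a b c d → c + d - (a + b) ≡ c - a + (d - b)
      lemma a b c d = solve (a ∷ b ∷ c ∷ d ∷ [])

    -- Modulo the choice of the diagonal j − i = k, S is the solution of
    -- the Hilbert 90 equation δᵢ₊₁,ⱼ₊₁ − δᵢⱼ = γⱼ − αᵢ, where j = i + k.
    S : ℕ → ℕ → Carrier → ℤ
    S i k g = ∑ i (λ m → γ (k ℕ.+ m) g - α m g)

    S-lc : ∀ i k → LocallyConstant p² (S i k)
    S-lc i k = lc-∑ i (λ m → lc-+ (lc γ-cocycle (k ℕ.+ m)) (lc-neg (lc α-cocycle m)))

    S-periodicʳ : ∀ i k g → S i (p ℕ.+ k) g ≡ S i k g [mod p² ]
    S-periodicʳ i k g = mod-∑ i (λ m → mod-+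
      (mod-trans (≡⇒mod (cong (λ j → γ j g) (ℕ.+-assoc p k m))) (periodic γ-cocycle (k ℕ.+ m) g)) (mod-refl {x = - α m g}))

    -- One turn around a diagonal adds the norm of `γ` minus that of `α`; this is where equality of
    -- the norms modulo p² enters.
    S-periodicˡ : ∀ i k g → S (p ℕ.+ i) k g ≡ S i k g [mod p² ]
    S-periodicˡ i k g = mod-trans (≡⇒mod (∑-++ p i (λ m → γ (k ℕ.+ m) g - α m g)))
      (mod-trans (mod-+ full (mod-∑ i tail)) (≡⇒mod (ℤ.+-identityˡ (S i k g))))
      where
      full : ∑ p (λ m → γ (k ℕ.+ m) g - α m g) ≡ 0ℤ [mod p² ]
      full = mod-trans (≡⇒mod (trans (∑-- p (λ m → γ (k ℕ.+ m) g) (λ m → α m g))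
          (cong (_- ∑ p (λ m → α m g)) (∑-cong p (λ m _ → cong (λ j → γ j g) (ℕ.+-comm k m))))))
        (lemma (∑ p (λ m → γ (m ℕ.+ k) g)) (∑ p (λ m → γ m g)) (∑ p (λ m → α m g)) (∑-shift p {f = λ m → γ m g} (λ m → periodic γ-cocycle m g) k) (norms≡ g))
        where
        lemma : ∀ a b c → a ≡ b [mod p² ] → c ≡ b [mod p² ] → a - c ≡ 0ℤ [mod p² ]
        lemma a b c h₁ h₂ = mod-conv (mod-+ h₁ (mod-neg h₂)) (solve (a ∷ b ∷ c ∷ []))
      swap : ∀ m → k ℕ.+ (p ℕ.+ m) ≡ p ℕ.+ (k ℕ.+ m)
      swap m = trans (sym (ℕ.+-assoc k p m)) (trans (cong (ℕ._+ m) (ℕ.+-comm k p)) (ℕ.+-assoc p k m))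
      tail : ∀ m → γ (k ℕ.+ (p ℕ.+ m)) g - α (p ℕ.+ m) g ≡ γ (k ℕ.+ m) g - α m g [mod p² ]
      tail m = mod-+ (mod-trans (≡⇒mod (cong (λ j → γ j g) (swap m))) (periodic γ-cocycle (k ℕ.+ m) g)) (mod-neg (periodic α-cocycle m g))

    -- The normalisation `S 0 k = 0` is not invariant: after translation by `g` the sums start at
    -- `χ g`. The correction `S (χ g) (k + ρ g)` does not depend on `i` and is the obstruction of
    -- the diagonal.
    S-∙ : ∀ i k g h → S i k (g ∙ h) ≡ S i k g + t g * (S (i ℕ.+ χ g) (k ℕ.+ ρ g) h - S (χ g) (k ℕ.+ ρ g) h) [mod p² ]
    S-∙ i k g h = mod-trans (mod-∑ i summand)
      (≡⇒mod (trans (∑-+ i (λ m → γ (k ℕ.+ m) g - α m g) (λ m → t g * f (χ g ℕ.+ m)))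
        (cong (λ w → S i k g + w) (trans (∑-* i (t g) (λ m → f (χ g ℕ.+ m))) (cong (t g *_)
          (lemma (∑ i (λ m → f (χ g ℕ.+ m))) (∑ (χ g) f) (∑ (i ℕ.+ χ g) f) (trans (cong (λ j → ∑ j f) (ℕ.+-comm i (χ g))) (∑-++ (χ g) i f))))))))
      where
      f : ℕ → ℤ
      f m = γ (k ℕ.+ ρ g ℕ.+ m) h - α m h
      lemma : ∀ a b c → c ≡ b + a → a ≡ c - b
      lemma a b c e = sym (≡-conv e (solve (a ∷ b ∷ c ∷ [])))
      index : ∀ m → + (k ℕ.+ m ℕ.+ χ′ g) ≡ + (k ℕ.+ ρ g ℕ.+ (χ g ℕ.+ m)) [mod p ]
      index m = shift (+ k) (+ m) (+ χ′ g) (+ ρ g) (+ χ g) (ρ≡χ′-χ g)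
        where
        shift : ∀ k m s′ r s → r ≡ s′ - s [mod p ] → k + m + s′ ≡ k + r + (s + m) [mod p ]
        shift k m s′ r s e = mod-conv (mod-neg e) (solve (k ∷ m ∷ s′ ∷ r ∷ s ∷ []))
      summand : ∀ m → γ (k ℕ.+ m) (g ∙ h) - α m (g ∙ h) ≡ γ (k ℕ.+ m) g - α m g + t g * f (χ g ℕ.+ m) [mod p² ]
      summand m = combine (γ (k ℕ.+ m) (g ∙ h)) (γ (k ℕ.+ m) g) (γ (k ℕ.+ m ℕ.+ χ′ g) h) (γ (k ℕ.+ ρ g ℕ.+ (χ g ℕ.+ m)) h)
          (α m (g ∙ h)) (α m g) (α (m ℕ.+ χ g) h) (α (χ g ℕ.+ m) h) (t g)
          (cocycle γ-cocycle (k ℕ.+ m) g h) (index-mod γ-cocycle (index m) h) (cocycle α-cocycle m g h)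
          (≡⇒mod (cong (λ j → α j h) (ℕ.+-comm m (χ g))))
        where
        combine : ∀ xgh xg xh xh′ ygh yg yh yh′ s → xgh ≡ xg + s * xh [mod p² ] → xh ≡ xh′ [mod p² ] →
                  ygh ≡ yg + s * yh [mod p² ] → yh ≡ yh′ [mod p² ] → xgh - ygh ≡ xg - yg + s * (xh′ - yh′) [mod p² ]
        combine xgh xg xh xh′ ygh yg yh yh′ s h₁ h₂ h₃ h₄ = mod-conv
          (mod-+ h₁ (mod-+ (mod-scale s h₂) (mod-+ (mod-neg h₃) (mod-scale (- s) h₄))))
          (solve (xgh ∷ xg ∷ xh ∷ xh′ ∷ ygh ∷ yg ∷ yh ∷ yh′ ∷ s ∷ []))

    z : ℕ → Carrier → ℤ
    z k g = ∑ p (λ i → S i k g)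

    -- Constant along its diagonal, the obstruction is counted p times; it disappears modulo p but
    -- leaves a trace modulo p².
    z-∙ : ∀ k g h → z k (g ∙ h) ≡ z k g + t g * (z (k ℕ.+ ρ g) h - + p * S (χ g) (k ℕ.+ ρ g) h) [mod p² ]
    z-∙ k g h = mod-trans (mod-∑ p (λ i → S-∙ i k g h))
      (mod-trans (≡⇒mod (trans (∑-+ p (λ i → S i k g) (λ i → t g * (S (i ℕ.+ χ g) (k ℕ.+ ρ g) h - S (χ g) (k ℕ.+ ρ g) h)))
          (cong (λ w → z k g + w) (trans (∑-* p (t g) (λ i → S (i ℕ.+ χ g) (k ℕ.+ ρ g) h - S (χ g) (k ℕ.+ ρ g) h)) (cong (t g *_)
            (trans (∑-- p (λ i → S (i ℕ.+ χ g) (k ℕ.+ ρ g) h) (const (S (χ g) (k ℕ.+ ρ g) h)))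
              (cong (λ w → ∑ p (λ i → S (i ℕ.+ χ g) (k ℕ.+ ρ g) h) - w) (∑-const p (S (χ g) (k ℕ.+ ρ g) h)))))))))
        (mod-+ (mod-refl {x = z k g}) (mod-scale (t g) (mod-+
          (∑-shift p {f = λ i → S i (k ℕ.+ ρ g) h} (λ i → S-periodicˡ i (k ℕ.+ ρ g) h) (χ g))
          (mod-refl {x = - (+ p * S (χ g) (k ℕ.+ ρ g) h)})))))

    z-cocycle : Cocycle p ρ z
    z-cocycle = record
      { lc       = λ k → lc-∣ p∣p² (lc-∑ p (λ i → S-lc i k))
      ; periodic = λ k g → mod-p²⇒p (mod-∑ p (λ i → S-periodicʳ i k g))
      ; cocycle  = λ k g h → lemma (z k (g ∙ h)) (z k g) (z (k ℕ.+ ρ g) h) (t g) (+ p) (S (χ g) (k ℕ.+ ρ g) h) (mod-p²⇒p (z-∙ k g h)) modulus≡0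
      }
      where
      lemma : ∀ a b c s q d → a ≡ b + s * (c - q * d) [mod p ] → q ≡ 0ℤ [mod p ] → a ≡ b + s * c [mod p ]
      lemma a b c s q d h₁ h₂ = mod-conv (mod-+ h₁ (mod-scale (- (s * d)) h₂)) (solve (a ∷ b ∷ c ∷ s ∷ q ∷ d ∷ []))

    private
      module Diagonal {z̃ : ℕ → Carrier → ℤ} (z̃-cocycle : Cocycle p² ρ z̃) (z̃-lifts : ∀ k g → z̃ k g ≡ z k g [mod p ]) where
        difference : ∀ k g → Σ[ w ∈ ℤ ] z k g - z̃ k g ≡ + p * w
        difference k g = divide (mod-conv {w = 0ℤ} (mod-sym (z̃-lifts k g)) (ℤ.+-identityʳ _))

        w : ℕ → Carrier → ℤ
        w k g = proj₁ (difference k g)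

        pw : ∀ k g → z k g - z̃ k g ≡ + p * w k g
        pw k g = proj₂ (difference k g)

        w-lc : ∀ k → LocallyConstant p (w k)
        w-lc k = lc-via (lc-+ (lc-∑ p (λ i → S-lc i k)) (lc-neg (lc z̃-cocycle k))) (λ g h e → cancel-p (w k h) (w k g)
          (mod-trans (≡⇒mod (sym (pw k h))) (mod-trans e (≡⇒mod (pw k g)))))

        w-periodic : ∀ k g → w (p ℕ.+ k) g ≡ w k g [mod p ]
        w-periodic k g = cancel-p (w (p ℕ.+ k) g) (w k g) (mod-trans (≡⇒mod (sym (pw (p ℕ.+ k) g)))
          (mod-trans (mod-+ (mod-∑ p (λ i → S-periodicʳ i k g)) (mod-neg (periodic z̃-cocycle k g))) (≡⇒mod (pw k g))))

        -- `z̃` satisfies the cocycle rule modulo p², so `z - z̃` retains just the term with p times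
        -- the obstruction. Divided by p, this is the defect of `S`, and it cancels in `S - w`.
        w-∙ : ∀ k g h → w k (g ∙ h) ≡ w k g + (w (k ℕ.+ ρ g) h - S (χ g) (k ℕ.+ ρ g) h) [mod p ]
        w-∙ k g h = mod-trans (cancel-p (w k (g ∙ h)) (w k g + t g * (w (k ℕ.+ ρ g) h - S (χ g) (k ℕ.+ ρ g) h))
            (lemma (z k (g ∙ h)) (z k g) (z (k ℕ.+ ρ g) h) (z̃ k (g ∙ h)) (z̃ k g) (z̃ (k ℕ.+ ρ g) h) (w k (g ∙ h)) (w k g) (w (k ℕ.+ ρ g) h)
              (t g) (S (χ g) (k ℕ.+ ρ g) h) (+ p) (pw k (g ∙ h)) (pw k g) (pw (k ℕ.+ ρ g) h) (z-∙ k g h) (cocycle z̃-cocycle k g h)))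
          (mod-+ (mod-refl {x = w k g}) (mod-trans (mod-* (t≡1 g) mod-refl) (≡⇒mod (ℤ.*-identityˡ _))))
          where
          lemma : ∀ zgh zg zh ygh yg yh wgh wg wh s o q → zgh - ygh ≡ q * wgh → zg - yg ≡ q * wg → zh - yh ≡ q * wh →
                  zgh ≡ zg + s * (zh - q * o) [mod p² ] → ygh ≡ yg + s * yh [mod p² ] →
                  q * wgh ≡ q * (wg + s * (wh - o)) [mod p² ]
          lemma zgh zg zh ygh yg yh wgh wg wh s o q e₁ e₂ e₃ h₁ h₂ = mod-conv
            (mod-+ (mod-neg (≡⇒mod e₁)) (mod-+ (≡⇒mod e₂) (mod-+ (mod-scale s (≡⇒mod e₃)) (mod-+ h₁ (mod-neg h₂)))))
            (solve (zgh ∷ zg ∷ zh ∷ ygh ∷ yg ∷ yh ∷ wgh ∷ wg ∷ wh ∷ s ∷ o ∷ q ∷ []))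

        δ : ℕ → ℕ → Carrier → ℤ
        δ i k g = S i k g - w k g

        δ-lc : ∀ i k → LocallyConstant p (δ i k)
        δ-lc i k = lc-+ (lc-∣ p∣p² (S-lc i k)) (lc-neg (w-lc k))

        δ-periodic : ∀ i k g → δ i (p ℕ.+ k) g ≡ δ i k g [mod p ]
        δ-periodic i k g = mod-+ (mod-p²⇒p (S-periodicʳ i k g)) (mod-neg (w-periodic k g))

        δ-suc : ∀ i k g → δ (suc i) k g ≡ δ i k g + (γ (k ℕ.+ i) g - α i g) [mod p ]
        δ-suc i k g = ≡⇒mod (lemma (S i k g) (γ (k ℕ.+ i) g - α i g) (w k g))
          where
          lemma : ∀ a b c → a + b - c ≡ a - c + b
          lemma a b c = solve (a ∷ b ∷ c ∷ [])

        δ-∙ : ∀ i k g h → δ i k (g ∙ h) ≡ δ i k g + δ (i ℕ.+ χ g) (k ℕ.+ ρ g) h [mod p ]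
        δ-∙ i k g h = lemma (S i k (g ∙ h)) (S i k g) (S (i ℕ.+ χ g) (k ℕ.+ ρ g) h) (S (χ g) (k ℕ.+ ρ g) h)
            (w k (g ∙ h)) (w k g) (w (k ℕ.+ ρ g) h) (t g) (mod-p²⇒p (S-∙ i k g h)) (w-∙ k g h) (t≡1 g)
          where
          lemma : ∀ a b c o x y z s → a ≡ b + s * (c - o) [mod p ] → x ≡ y + (z - o) [mod p ] → s ≡ 1ℤ [mod p ] →
                  a - x ≡ b - y + (c - z) [mod p ]
          lemma a b c o x y z s h₁ h₂ h₃ = mod-conv (mod-+ h₁ (mod-+ (mod-neg h₂) (mod-scale (c - o) h₃)))
            (solve (a ∷ b ∷ c ∷ o ∷ x ∷ y ∷ z ∷ s ∷ []))

    record DiagonalSolution : Set₁ where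
      field
        δ          : ℕ → ℕ → Carrier → ℤ
        δ-lc       : ∀ i k → LocallyConstant p (δ i k)
        δ-periodic : ∀ i k g → δ i (p ℕ.+ k) g ≡ δ i k g [mod p ]
        δ-suc      : ∀ i k g → δ (suc i) k g ≡ δ i k g + (γ (k ℕ.+ i) g - α i g) [mod p ]
        δ-∙        : ∀ i k g h → δ i k (g ∙ h) ≡ δ i k g + δ (i ℕ.+ χ g) (k ℕ.+ ρ g) h [mod p ]

    diagonalSolution : DiagonalSolution
    diagonalSolution =
      let z̃ , z̃-cocycle , z̃-lifts = liftCocycle ρ-character z-cocycle in
      record { Diagonal z̃-cocycle z̃-lifts }

  open Diagonals using (DiagonalSolution; diagonalSolution; ρ; ρ≡χ′-χ)

  -- Lifting to unitriangular matrices

  -- A continuous homomorphism to the unitriangular 4×4 matrices over ℤ/p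
  -- with superdiagonal χ, b, χ′, given by its remaining three entries.
  record Unitriangular (χ b χ′ : Carrier → ℤ) : Set₁ where
    field
      φ₁₃ φ₂₄ φ₁₄ : Carrier → ℤ
      lc₁₃ : LocallyConstant p φ₁₃
      lc₂₄ : LocallyConstant p φ₂₄
      lc₁₄ : LocallyConstant p φ₁₄
      ∙₁₃  : ∀ g h → φ₁₃ (g ∙ h) ≡ φ₁₃ g + φ₁₃ h + χ g * b h [mod p ]
      ∙₂₄  : ∀ g h → φ₂₄ (g ∙ h) ≡ φ₂₄ g + φ₂₄ h + b g * χ′ h [mod p ]
      ∙₁₄  : ∀ g h → φ₁₄ (g ∙ h) ≡ φ₁₄ g + φ₁₄ h + (χ g * φ₂₄ h + φ₁₃ g * χ′ h) [mod p ]

  ∑-∙ : ∀ (f : ℕ → ℤ) {x y z : ℕ → ℤ} → (∀ k → x k ≡ y k + z k [mod p ]) →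
        ∑ p (λ k → f k * x k) ≡ ∑ p (λ k → f k * y k) + ∑ p (λ k → f k * z k) [mod p ]
  ∑-∙ f {x} {y} {z} h = mod-trans (mod-∑ p (λ k → mod-scale (f k) (h k)))
    (≡⇒mod (trans (∑-cong p (λ k _ → ℤ.*-distribˡ-+ (f k) (y k) (z k))) (∑-+ p (λ k → f k * y k) (λ k → f k * z k))))

  module _ {χ χ′ : Carrier → ℕ} (χ-character : Character χ) (χ′-character : Character χ′)
    {α γ : ℕ → Carrier → ℤ} (α-cocycle : Cocycle p² χ α) (γ-cocycle : Cocycle p² χ′ γ)
    (norms≡ : ∀ g → ∑ p (λ i → α i g) ≡ ∑ p (λ i → γ i g) [mod p² ])
    {b : Carrier → ℤ} (b-lc : LocallyConstant p b) (b-∙ : ∀ g h → b (g ∙ h) ≡ b g + b h [mod p ])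
    (norm≡b : ∀ g → ∑ p (λ i → γ i g) ≡ b g [mod p ])
    (solution : DiagonalSolution χ-character χ′-character α-cocycle γ-cocycle norms≡) where

    open Character
    open DiagonalSolution solution

    private
      ρ′ : Carrier → ℕ
      ρ′ = ρ χ-character χ′-character α-cocycle γ-cocycle norms≡

      α-per : ∀ g → Periodic p p (λ i → α i g)
      α-per g i = mod-p²⇒p (periodic α-cocycle i g)

      γ-per : ∀ g → Periodic p p (λ i → γ i g)
      γ-per g i = mod-p²⇒p (periodic γ-cocycle i g)

      module At (g : Carrier) = Coefficients {α = λ i → α i g} {γ = λ i → γ i g} {δ = λ i k → δ i k g} {b = b g}
        (α-per g) (γ-per g) (mod-trans (mod-p²⇒p (norms≡ g)) (norm≡b g)) (norm≡b g) (λ i k → δ-suc i k g)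
      open At

      u-∙ : ∀ g h → u (g ∙ h) 0 ≡ u g 0 + u h (χ g) [mod p ]
      u-∙ g h = mod-trans (mod-∑ p (λ k → δ-∙ 0 k g h))
        (mod-trans (≡⇒mod (∑-+ p (λ k → δ 0 k g) (λ k → δ (χ g) (k ℕ.+ ρ′ g) h)))
          (mod-+ (mod-refl {x = u g 0}) (∑-shift p {f = λ k → δ (χ g) k h} (λ k → δ-periodic (χ g) k h) (ρ′ g))))

      q-∙ : ∀ g h → q (g ∙ h) 0 ≡ q g 0 + (q h (χ g) - + ρ′ g * u h (χ g)) [mod p ]
      q-∙ g h = mod-trans (∑-∙ (λ k → + k) (λ k → δ-∙ 0 k g h))
        (mod-+ (mod-refl {x = q g 0}) (∑-shift-weighted {f = λ k → δ (χ g) k h} (λ k → δ-periodic (χ g) k h) (ρ′ g)))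

      Γ̂-∙ : ∀ g h → Γ̂ (g ∙ h) ≡ Γ̂ g + (Γ̂ h - + χ′ g * b h) [mod p ]
      Γ̂-∙ g h = mod-trans (∑-∙ (λ k → + k) (λ k → untwist γ-cocycle k g h))
        (mod-+ (mod-refl {x = Γ̂ g}) (mod-trans (∑-shift-weighted {f = λ k → γ k h} (γ-per h) (χ′ g))
          (mod-+ (mod-refl {x = Γ̂ h}) (mod-neg (mod-scale (+ χ′ g) (norm≡b h))))))

      Â-∙ : ∀ g h → Â (g ∙ h) ≡ Â g + (Â h - + χ g * b h) [mod p ]
      Â-∙ g h = mod-trans (∑-∙ (λ k → + k) (λ k → untwist α-cocycle k g h))
        (mod-+ (mod-refl {x = Â g}) (mod-trans (∑-shift-weighted {f = λ k → α k h} (α-per h) (χ g))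
          (mod-+ (mod-refl {x = Â h}) (mod-neg (mod-scale (+ χ g) (mod-trans (mod-p²⇒p (norms≡ h)) (norm≡b h)))))))

      Z-∙ : ∀ g h → Z (g ∙ h) 0 ≡ Z g 0 + Z h (χ g) [mod p ]
      Z-∙ g h = mod-trans (∑-∙ (λ i → triangular (suc i)) (λ i → untwist α-cocycle (i ℕ.+ 0) g h))
        (mod-+ (mod-refl {x = Z g 0}) (≡⇒mod (∑-cong p (λ i _ →
          cong (λ j → triangular (suc i) * α (j ℕ.+ χ g) h) (ℕ.+-identityʳ i)))))

      -- By `E-linear`, the slope and the value at 0 of `E` at the group element `g`, as a function
      -- of `s`.
      Γ′ ω : Carrier → ℤ
      Γ′ g = Γ̂ g + Â g + u g 0 + b g
      ω g = E g 0

      Γ′-∙ : ∀ g h → Γ′ (g ∙ h) ≡ Γ′ g + Γ′ h - + χ′ g * b h [mod p ]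
      Γ′-∙ g h = lemma (Γ̂ (g ∙ h)) (Γ̂ g) (Γ̂ h) (Â (g ∙ h)) (Â g) (Â h) (u (g ∙ h) 0) (u g 0) (u h 0) (u h (χ g)) (b (g ∙ h)) (b g) (b h) (+ χ g) (+ χ′ g)
          (Γ̂-∙ g h) (Â-∙ g h) (u-∙ g h) (u-linear h (χ g)) (b-∙ g h)
        where
        lemma : ∀ cgh cg ch agh ag ah ugh ug uh us bgh bg bh s s′ → cgh ≡ cg + (ch - s′ * bh) [mod p ] → agh ≡ ag + (ah - s * bh) [mod p ] →
                ugh ≡ ug + us [mod p ] → us ≡ uh + s * bh [mod p ] → bgh ≡ bg + bh [mod p ] →
                cgh + agh + ugh + bgh ≡ cg + ag + ug + bg + (ch + ah + uh + bh) - s′ * bh [mod p ]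
        lemma cgh cg ch agh ag ah ugh ug uh us bgh bg bh s s′ h₁ h₂ h₃ h₄ h₅ = mod-conv
          (mod-+ h₁ (mod-+ h₂ (mod-+ h₃ (mod-+ h₄ h₅))))
          (solve (cgh ∷ cg ∷ ch ∷ agh ∷ ag ∷ ah ∷ ugh ∷ ug ∷ uh ∷ us ∷ bgh ∷ bg ∷ bh ∷ s ∷ s′ ∷ []))

      -- Multiplication by `g` replaces row 0 of `h` by row `χ g`. There `E-linear` gives
      -- `ω h + χ g * Γ′ h`, and the χ′ part of ρ leaves `- χ′ g * u h (χ g)`.
      ω-∙ : ∀ g h → ω (g ∙ h) ≡ ω g + ω h + (+ χ g * Γ′ h - + χ′ g * (u h 0 + + χ g * b h)) [mod p ]
      ω-∙ g h = lemma (q (g ∙ h) 0) (q g 0) (q h (χ g)) (u (g ∙ h) 0) (u g 0) (u h (χ g)) (u h 0) (Z (g ∙ h) 0) (Z g 0) (Z h (χ g)) (ω h) (Γ′ h) (b h)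
          (+ ρ′ g) (+ χ g) (+ χ′ g)
          (q-∙ g h) (Z-∙ g h) (E-linear h (χ g)) (u-linear h (χ g))
          (ρ≡χ′-χ χ-character χ′-character α-cocycle γ-cocycle norms≡ g)
        where
        lemma : ∀ qgh qg qs ugh ug us u₀ zgh zg zs w c b r s s′ →
          qgh ≡ qg + (qs - r * us) [mod p ] → zgh ≡ zg + zs [mod p ] → qs + s * us - zs ≡ w + s * c [mod p ] →
          us ≡ u₀ + s * b [mod p ] → r ≡ s′ - s [mod p ] →
          qgh + 0ℤ * ugh - zgh ≡ qg + 0ℤ * ug - zg + w + (s * c - s′ * (u₀ + s * b)) [mod p ]
        lemma qgh qg qs ugh ug us u₀ zgh zg zs w c b r s s′ h₁ h₂ h₃ h₄ h₅ = mod-conv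
          (mod-+ h₁ (mod-+ (mod-neg h₂) (mod-+ h₃ (mod-+ (mod-scale (- s′) h₄) (mod-scale (- us) h₅)))))
          (solve (qgh ∷ qg ∷ qs ∷ ugh ∷ ug ∷ us ∷ u₀ ∷ zgh ∷ zg ∷ zs ∷ w ∷ c ∷ b ∷ r ∷ s ∷ s′ ∷ []))

      u-lc : LocallyConstant p (λ g → u g 0)
      u-lc = lc-∑ p (δ-lc 0)

      lc-weighted : ∀ (f : ℕ → ℤ) {x : ℕ → Carrier → ℤ} → (∀ k → LocallyConstant p (x k)) → LocallyConstant p (λ g → ∑ p (λ k → f k * x k g))
      lc-weighted f x-lc = lc-∑ p (λ k → lc-* (lc-const (f k)) (x-lc k))

      Γ′-lc : LocallyConstant p Γ′
      Γ′-lc = lc-+ (lc-+ (lc-+ (lc-weighted (λ k → + k) (λ k → lc-∣ p∣p² (lc γ-cocycle k)))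
                               (lc-weighted (λ k → + k) (λ k → lc-∣ p∣p² (lc α-cocycle k)))) u-lc) b-lc

      ω-lc : LocallyConstant p ω
      ω-lc = lc-+ (lc-+ (lc-weighted (λ k → + k) (δ-lc 0)) (lc-* (lc-const 0ℤ) u-lc))
                  (lc-neg (lc-weighted (λ i → triangular (suc i)) (λ i → lc-∣ p∣p² (lc α-cocycle (i ℕ.+ 0)))))

    -- The rules for `Γ′` and `ω` have χ′ on the left with a minus sign; adding the products `b χ′`
    -- and `u χ′` moves it to the right with a plus sign.
    unitriangular-from-δ : Unitriangular (λ g → + χ g) b (λ g → + χ′ g)
    unitriangular-from-δ = record
      { φ₁₃  = λ g → u g 0
      ; φ₂₄  = λ g → Γ′ g + b g * + χ′ g
      ; φ₁₄  = λ g → ω g + u g 0 * + χ′ g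
      ; lc₁₃ = u-lc
      ; lc₂₄ = lc-+ Γ′-lc (lc-* b-lc (χ-lc χ′-character))
      ; lc₁₄ = lc-+ ω-lc (lc-* u-lc (χ-lc χ′-character))
      ; ∙₁₃  = λ g h → lemma₁ (u (g ∙ h) 0) (u g 0) (u h (χ g)) (u h 0) (+ χ g * b h) (u-∙ g h) (u-linear h (χ g))
      ; ∙₂₄  = λ g h → lemma₂ (Γ′ (g ∙ h)) (Γ′ g) (Γ′ h) (b (g ∙ h)) (b g) (b h) (+ χ′ (g ∙ h)) (+ χ′ g) (+ χ′ h) (Γ′-∙ g h) (b-∙ g h) (χ-∙ χ′-character g h)
      ; ∙₁₄  = λ g h → lemma₃ (ω (g ∙ h)) (ω g) (ω h) (u (g ∙ h) 0) (u g 0) (u h (χ g)) (u h 0) (Γ′ h) (b h) (+ χ g) (+ χ′ (g ∙ h)) (+ χ′ g) (+ χ′ h)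
                 (ω-∙ g h) (u-∙ g h) (u-linear h (χ g)) (χ-∙ χ′-character g h)
      }
      where
      lemma₁ : ∀ a b c d e → a ≡ b + c [mod p ] → c ≡ d + e [mod p ] → a ≡ b + d + e [mod p ]
      lemma₁ a b c d e h₁ h₂ = mod-conv (mod-+ h₁ h₂) (solve (a ∷ b ∷ c ∷ d ∷ e ∷ []))
      lemma₂ : ∀ cgh cg ch bgh bg bh sgh sg sh → cgh ≡ cg + ch - sg * bh [mod p ] → bgh ≡ bg + bh [mod p ] → sgh ≡ sg + sh [mod p ] →
               cgh + bgh * sgh ≡ cg + bg * sg + (ch + bh * sh) + bg * sh [mod p ]
      lemma₂ cgh cg ch bgh bg bh sgh sg sh h₁ h₂ h₃ = mod-conv (mod-+ h₁ (mod-+ (mod-scale sgh h₂) (mod-scale (bg + bh) h₃)))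
        (solve (cgh ∷ cg ∷ ch ∷ bgh ∷ bg ∷ bh ∷ sgh ∷ sg ∷ sh ∷ []))
      lemma₃ : ∀ wgh wg wh ugh ug us uh c b s tgh tg th → wgh ≡ wg + wh + (s * c - tg * (uh + s * b)) [mod p ] →
               ugh ≡ ug + us [mod p ] → us ≡ uh + s * b [mod p ] → tgh ≡ tg + th [mod p ] →
               wgh + ugh * tgh ≡ wg + ug * tg + (wh + uh * th) + (s * (c + b * th) + ug * th) [mod p ]
      lemma₃ wgh wg wh ugh ug us uh c b s tgh tg th h₁ h₂ h₃ h₄ = mod-conv
        (mod-+ h₁ (mod-+ (mod-scale tgh h₂) (mod-+ (mod-scale tgh h₃) (mod-scale (ug + uh + s * b) h₄))))
        (solve (wgh ∷ wg ∷ wh ∷ ugh ∷ ug ∷ us ∷ uh ∷ c ∷ b ∷ s ∷ tgh ∷ tg ∷ th ∷ []))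

  -- φ and φ′ witness χ ∪ b = 0 and b ∪ χ′ = 0; b χ′ − φ′ witnesses χ′ ∪ b = 0.
  unitriangular : ∀ {χ χ′} → Character χ → Character χ′ → ∀ {b φ φ′} →
    LocallyConstant p b → (∀ g h → b (g ∙ h) ≡ b g + b h [mod p ]) →
    LocallyConstant p φ → (∀ g h → φ (g ∙ h) ≡ φ g + φ h + + χ g * b h [mod p ]) →
    LocallyConstant p φ′ → (∀ g h → φ′ (g ∙ h) ≡ φ′ g + φ′ h + b g * + χ′ h [mod p ]) →
    Unitriangular (λ g → + χ g) b (λ g → + χ′ g)
  unitriangular {χ} {χ′} χ-character χ′-character {b} {φ} {φ′} b-lc b-∙ φ-lc φ-∙ φ′-lc φ′-∙ =
    let α , α-cocycle , ∑α = norm χ-character b-lc b-∙ φ-lc φ-∙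
        γ , γ-cocycle , ∑γ = norm χ′-character b-lc b-∙ (lc-+ (lc-* b-lc (Character.χ-lc χ′-character)) (lc-neg φ′-lc)) swapped
        A , Γ , A-cocycle , Γ-cocycle , norms≡ , Γ-lifts =
          equaliseNorms χ-character χ′-character α-cocycle γ-cocycle (λ g → mod-trans (∑α g) (mod-sym (∑γ g)))
    in unitriangular-from-δ χ-character χ′-character A-cocycle Γ-cocycle norms≡ b-lc b-∙
         (λ g → mod-trans (mod-∑ p (λ i → Γ-lifts i g)) (∑γ g))
         (diagonalSolution χ-character χ′-character A-cocycle Γ-cocycle norms≡)
    where
    swapped : ∀ g h → b (g ∙ h) * + χ′ (g ∙ h) - φ′ (g ∙ h) ≡ b g * + χ′ g - φ′ g + (b h * + χ′ h - φ′ h) + + χ′ g * b h [mod p ]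
    swapped g h = lemma (b (g ∙ h)) (b g) (b h) (+ χ′ (g ∙ h)) (+ χ′ g) (+ χ′ h) (φ′ (g ∙ h)) (φ′ g) (φ′ h)
        (b-∙ g h) (Character.χ-∙ χ′-character g h) (φ′-∙ g h)
      where
      lemma : ∀ bgh bg bh sgh sg sh fgh fg fh → bgh ≡ bg + bh [mod p ] → sgh ≡ sg + sh [mod p ] → fgh ≡ fg + fh + bg * sh [mod p ] →
              bgh * sgh - fgh ≡ bg * sg - fg + (bh * sh - fh) + sg * bh [mod p ]
      lemma bgh bg bh sgh sg sh fgh fg fh h₁ h₂ h₃ = mod-conv (mod-+ (mod-scale sgh h₁) (mod-+ (mod-scale (bg + bh) h₂) (mod-neg h₃)))
        (solve (bgh ∷ bg ∷ bh ∷ sgh ∷ sg ∷ sh ∷ fgh ∷ fg ∷ fh ∷ []))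

-- Massey products

module _ {p : ℕ} (𝒢 : OrientedProfiniteGroup p) where
  private
    G : TopologicalGroup
    G = OrientedProfiniteGroup.G 𝒢
    C : DGRing
    C = modpCochains 𝒢
    H¹ H² : AbelianGroup (lsuc 0ℓ) (lsuc 0ℓ)
    H¹ = modpH 𝒢 1
    H² = modpH 𝒢 2
  open TopologicalGroup G using (Carrier; _∙_)
  open DGRing C using (Cochain; IsCocycle; ∂)
  open LocalConstancy G

  at : Cochain 1 → Carrier → ℤ
  at f g = ContinuousMap.to f (g , tt)

  cocycle-additive : ∀ f → IsCocycle {1} f → ∀ g h → at f (g ∙ h) ≡ at f g + at f h [mod p ]
  cocycle-additive f ∂f≡0 g h = lemma (at f g) (at f h) (at f (g ∙ h)) (∂f≡0 (g , h , tt))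
    where
    lemma : ∀ a b c → b - (c - (a - 0ℤ)) ≡ 0ℤ [mod p ] → c ≡ a + b [mod p ]
    lemma a b c h = mod-sym (mod-conv h (solve (a ∷ b ∷ c ∷ [])))

  -- Coefficients are trivial, so 1-coboundaries vanish.
  ≈⇒at : ∀ (x y : AbelianGroup.Carrier H¹) → AbelianGroup._≈_ H¹ x y → ∀ g → at (proj₁ x) g ≡ at (proj₁ y) g [mod p ]
  ≈⇒at (x , _) (y , _) (c , ∂c) g = lemma (ContinuousMap.to c tt) (at x g) (at y g) (∂c (g , tt))
    where
    lemma : ∀ c a b → c - (c - 0ℤ) ≡ a - b [mod p ] → a ≡ b [mod p ]
    lemma c a b h = mod-sym (mod-conv h (solve (c ∷ a ∷ b ∷ [])))

  module _ (χ₁ χ₂ χ₃ : AbelianGroup.Carrier H¹) where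
    private
      f₁ f₂ f₃ : Cochain 1
      f₁ = proj₁ χ₁
      f₂ = proj₁ χ₂
      f₃ = proj₁ χ₃

    -- The defining equation carries a minus sign, so `- e` bounds the cup product.
    cup-zero : ∀ (x y : AbelianGroup.Carrier H¹) (e e₁ e₂ : Cochain 1) →
      (∀ g → at e₁ g ≡ at (proj₁ x) g [mod p ]) → (∀ g → at e₂ g ≡ at (proj₁ y) g [mod p ]) →
      DGRing._≈_ C {2} (∂ {1} e) (DGRing.-_ C {2} (DGRing._+_ C {2} (DGRing.0# C {2}) (DGRing._·_ C {1} {1} e₁ e₂))) →
      AbelianGroup._≈_ H² (cup C {1} {1} x y) (AbelianGroup.ε H²)
    cup-zero (x , _) (y , _) e e₁ e₂ h₁ h₂ ∂e = DGRing.-_ C {1} e , λ (g , h , _) →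
      lemma (at e g) (at e h) (at e (g ∙ h)) (at e₁ g) (at x g) (at e₂ h) (at y h) (∂e (g , h , tt)) (h₁ g) (h₂ h)
      where
      lemma : ∀ a b c u x v y → b - (c - (a - 0ℤ)) ≡ - (0ℤ + u * v) [mod p ] → u ≡ x [mod p ] → v ≡ y [mod p ] →
              - b - (- c - (- a - 0ℤ)) ≡ x * y - 0ℤ [mod p ]
      lemma a b c u x v y h₁ h₂ h₃ = mod-conv (mod-+ (mod-neg h₁) (mod-+ (mod-scale v h₂) (mod-scale x h₃)))
        (solve (a ∷ b ∷ c ∷ u ∷ x ∷ v ∷ y ∷ []))

    defined⇒cups-zero : MasseyDefined C (χ₁ Vec.∷ χ₂ Vec.∷ χ₃ Vec.∷ Vec.[]) →
      AbelianGroup._≈_ H² (cup C {1} {1} χ₁ χ₂) (AbelianGroup.ε H²) ×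
      AbelianGroup._≈_ H² (cup C {1} {1} χ₂ χ₃) (AbelianGroup.ε H²)
    defined⇒cups-zero (_ , system , _) =
      cup-zero χ₁ χ₂ (entry 1 3) (entry 1 2) (entry 2 3) e₁₂ e₂₃
        (equation 1 3 (s≤s z≤n) (s≤s (s≤s (s≤s z≤n))) (s≤s (s≤s (s≤s z≤n))) (λ ())) ,
      cup-zero χ₂ χ₃ (entry 2 4) (entry 2 3) (entry 3 4) e₂₃ e₃₄
        (equation 2 4 (s≤s z≤n) (s≤s (s≤s (s≤s (s≤s z≤n)))) (s≤s (s≤s (s≤s (s≤s z≤n)))) (λ ()))
      where
      open DefiningSystem system
      e₁₂ : ∀ g → at (entry 1 2) g ≡ at f₁ g [mod p ]
      e₁₂ = ≈⇒at (entry 1 2 , cocycle Fin.zero) χ₁ (represents Fin.zero)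
      e₂₃ : ∀ g → at (entry 2 3) g ≡ at f₂ g [mod p ]
      e₂₃ = ≈⇒at (entry 2 3 , cocycle (Fin.suc Fin.zero)) χ₂ (represents (Fin.suc Fin.zero))
      e₃₄ : ∀ g → at (entry 3 4) g ≡ at f₃ g [mod p ]
      e₃₄ = ≈⇒at (entry 3 4 , cocycle (Fin.suc (Fin.suc Fin.zero))) χ₃ (represents (Fin.suc (Fin.suc Fin.zero)))

    module _ (p-prime : Prime p) (hilbert90 : FormalHilbert90 𝒢) where
      open Oriented p-prime 𝒢 hilbert90 using (Character; Unitriangular; unitriangular)

      private
        instance
          p≢0 : ℕ.NonZero p
          p≢0 = prime⇒nonZero p-prime

        residue : Cochain 1 → Carrier → ℕ
        residue f g = at f g %ℕ p

        residue≡ : ∀ f g → + residue f g ≡ at f g [mod p ]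
        residue≡ f g = mod-% (at f g) p

        character : (x : AbelianGroup.Carrier H¹) → Character (residue (proj₁ x))
        character (f , ∂f) = record
          { χ-lc = lc-via (fromMap f) (λ g h e → mod-trans (residue≡ f h) (mod-trans e (mod-sym (residue≡ f g))))
          ; χ-∙  = λ g h → mod-trans (residue≡ f (g ∙ h)) (mod-trans (cocycle-additive f ∂f g h)
              (mod-sym (mod-+ (residue≡ f g) (residue≡ f h))))
          }

        cobounding : ∀ (x y : AbelianGroup.Carrier H¹) → AbelianGroup._≈_ H² (cup C {1} {1} x y) (AbelianGroup.ε H²) →
          Σ[ φ ∈ (Carrier → ℤ) ] LocallyConstant p φ × (∀ g h → φ (g ∙ h) ≡ φ g + φ h + at (proj₁ x) g * at (proj₁ y) h [mod p ])
        cobounding (x , _) (y , _) (c , ∂c) = (λ g → - at c g) , lc-neg (fromMap c) , λ g h →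
          lemma (at c g) (at c h) (at c (g ∙ h)) (at x g * at y h) (∂c (g , h , tt))
          where
          lemma : ∀ a b c e → b - (c - (a - 0ℤ)) ≡ e - 0ℤ [mod p ] → - c ≡ - a + - b + e [mod p ]
          lemma a b c e h = mod-conv h (solve (a ∷ b ∷ c ∷ e ∷ []))

      -- Since ∂φ (g, h) = φ h - φ (g h) + φ g, matrix multiplication gives the equations of a
      -- defining system with the right sign. In the corner it shows that `φ₁₄` bounds the value.
      unitriangular⇒vanishes : Unitriangular (λ g → + residue f₁ g) (at f₂) (λ g → + residue f₃ g) →
                               MasseyVanishes C (χ₁ Vec.∷ χ₂ Vec.∷ χ₃ Vec.∷ Vec.[])
      unitriangular⇒vanishes U = record { entry = entry ; cocycle = cocycle ; represents = represents ; equation = equation } ,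
          toMap lc₁₄ , λ (g , h , _) → lemma₁₄ (φ₁₄ g) (φ₁₄ h) (φ₁₄ (g ∙ h)) (at f₁ g) (+ residue f₁ g) (φ₂₄ h) (φ₁₃ g) (at f₃ h) (+ residue f₃ h)
            (∙₁₄ g h) (residue≡ f₁ g) (residue≡ f₃ h)
        where
        open Unitriangular U
        entry : ℕ → ℕ → Cochain 1
        entry 1 2 = f₁
        entry 2 3 = f₂
        entry 3 4 = f₃
        entry 1 3 = toMap lc₁₃
        entry 2 4 = toMap lc₂₄
        entry _ _ = DGRing.0# C {1}
        cocycle : ∀ (i : Fin 3) → IsCocycle {1} (entry (1 ℕ.+ toℕ i) (2 ℕ.+ toℕ i))
        cocycle Fin.zero                       = proj₂ χ₁
        cocycle (Fin.suc Fin.zero)             = proj₂ χ₂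
        cocycle (Fin.suc (Fin.suc Fin.zero))   = proj₂ χ₃
        represents : ∀ (i : Fin 3) → AbelianGroup._≈_ H¹ (entry (1 ℕ.+ toℕ i) (2 ℕ.+ toℕ i) , cocycle i) (Vec.lookup (χ₁ Vec.∷ χ₂ Vec.∷ χ₃ Vec.∷ Vec.[]) i)
        represents Fin.zero                     = AbelianGroup.refl H¹ {χ₁}
        represents (Fin.suc Fin.zero)           = AbelianGroup.refl H¹ {χ₂}
        represents (Fin.suc (Fin.suc Fin.zero)) = AbelianGroup.refl H¹ {χ₃}
        lemma₁₃ : ∀ a b c x x′ y y′ → c ≡ a + b + x′ * y′ [mod p ] → x′ ≡ x [mod p ] → y′ ≡ y [mod p ] →
                  b - (c - (a - 0ℤ)) ≡ - (0ℤ + x * y) [mod p ]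
        lemma₁₃ a b c x x′ y y′ h₁ h₂ h₃ = mod-conv (mod-+ (mod-neg h₁) (mod-+ (mod-scale (- y′) h₂) (mod-scale (- x) h₃)))
          (solve (a ∷ b ∷ c ∷ x ∷ x′ ∷ y ∷ y′ ∷ []))
        lemma₁₄ : ∀ a b c x x′ u v y y′ → c ≡ a + b + (x′ * u + v * y′) [mod p ] → x′ ≡ x [mod p ] → y′ ≡ y [mod p ] →
                  b - (c - (a - 0ℤ)) ≡ - (0ℤ + x * u + v * y) - 0ℤ [mod p ]
        lemma₁₄ a b c x x′ u v y y′ h₁ h₂ h₃ = mod-conv (mod-+ (mod-neg h₁) (mod-+ (mod-scale (- u) h₂) (mod-scale (- v) h₃)))
          (solve (a ∷ b ∷ c ∷ x ∷ x′ ∷ u ∷ v ∷ y ∷ y′ ∷ []))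
        equation : ∀ i j → 1 ℕ.≤ i → suc i ℕ.< j → j ℕ.≤ 4 → ¬ (i ≡ 1 × j ≡ 4) →
          DGRing._≈_ C {2} (∂ {1} (entry i j)) (DGRing.-_ C {2} (innerSum C (χ₁ Vec.∷ χ₂ Vec.∷ χ₃ Vec.∷ Vec.[]) entry i j))
        equation 1 3 _ _ _ _ (g , h , _) = lemma₁₃ (φ₁₃ g) (φ₁₃ h) (φ₁₃ (g ∙ h)) (at f₁ g) (+ residue f₁ g) (at f₂ h) (at f₂ h) (∙₁₃ g h) (residue≡ f₁ g) mod-refl
        equation 2 4 _ _ _ _ (g , h , _) = lemma₁₃ (φ₂₄ g) (φ₂₄ h) (φ₂₄ (g ∙ h)) (at f₂ g) (at f₂ g) (at f₃ h) (+ residue f₃ h) (∙₂₄ g h) mod-refl (residue≡ f₃ h)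
        equation 1 4 _ _ _ ¬14 = contradiction (refl , refl) ¬14
        equation 0 _ () _ _ _
        equation 1 0 _ () _ _
        equation 1 1 _ (s≤s ()) _ _
        equation 1 2 _ (s≤s (s≤s ())) _ _
        equation 1 (suc (suc (suc (suc (suc _))))) _ _ (s≤s (s≤s (s≤s (s≤s ())))) _
        equation 2 0 _ () _ _
        equation 2 1 _ (s≤s ()) _ _
        equation 2 2 _ (s≤s (s≤s ())) _ _
        equation 2 3 _ (s≤s (s≤s (s≤s ()))) _ _
        equation 2 (suc (suc (suc (suc (suc _))))) _ _ (s≤s (s≤s (s≤s (s≤s ())))) _
        equation (suc (suc (suc i))) j _ i<j j≤4 _ = contradiction (ℕ.≤-trans i<j j≤4) (λ { (s≤s (s≤s (s≤s (s≤s ())))) })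

      cups-zero⇒vanishes : AbelianGroup._≈_ H² (cup C {1} {1} χ₁ χ₂) (AbelianGroup.ε H²) →
                           AbelianGroup._≈_ H² (cup C {1} {1} χ₂ χ₃) (AbelianGroup.ε H²) →
                           MasseyVanishes C (χ₁ Vec.∷ χ₂ Vec.∷ χ₃ Vec.∷ Vec.[])
      cups-zero⇒vanishes χ₁χ₂ χ₂χ₃ =
        let φ , φ-lc , φ-∙ = cobounding χ₁ χ₂ χ₁χ₂
            φ′ , φ′-lc , φ′-∙ = cobounding χ₂ χ₃ χ₂χ₃
        in unitriangular⇒vanishes (unitriangular (character χ₁) (character χ₃)
          (fromMap f₂) (cocycle-additive f₂ (proj₂ χ₂))
          φ-lc (λ g h → mod-trans (φ-∙ g h) (mod-+ (mod-refl {x = φ g + φ h}) (mod-* (mod-sym (residue≡ f₁ g)) (mod-refl {x = at f₂ h}))))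
          φ′-lc (λ g h → mod-trans (φ′-∙ g h) (mod-+ (mod-refl {x = φ′ g + φ′ h}) (mod-scale (at f₂ g) (mod-sym (residue≡ f₃ h))))))

open Vec using (_∷_; [])

theorem1p3 : ∀ (p : ℕ) → Prime p →
    (𝒢 : OrientedProfiniteGroup p) → FormalHilbert90 𝒢 →
    (χ₁ χ₂ χ₃ : AbelianGroup.Carrier (modpH 𝒢 1)) →
    let C  = modpCochains 𝒢
        H² = modpH 𝒢 2
        cup-products-zero = AbelianGroup._≈_ H² (cup C {1} {1} χ₁ χ₂) (AbelianGroup.ε H²)
                          × AbelianGroup._≈_ H² (cup C {1} {1} χ₂ χ₃) (AbelianGroup.ε H²)
        χs = χ₁ ∷ χ₂ ∷ χ₃ ∷ []
    in (cup-products-zero ⇔ MasseyDefined C χs) × (MasseyDefined C χs ⇔ MasseyVanishes C χs)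
theorem1p3 p p-prime 𝒢 hilbert90 χ₁ χ₂ χ₃ =
  mk⇔ (λ cups → vanishes⇒defined (cups⇒vanishes cups)) (defined⇒cups-zero 𝒢 χ₁ χ₂ χ₃) ,
  mk⇔ (λ defined → cups⇒vanishes (defined⇒cups-zero 𝒢 χ₁ χ₂ χ₃ defined)) vanishes⇒defined
  where
  vanishes⇒defined : MasseyVanishes (modpCochains 𝒢) (χ₁ ∷ χ₂ ∷ χ₃ ∷ []) → MasseyDefined (modpCochains 𝒢) (χ₁ ∷ χ₂ ∷ χ₃ ∷ [])
  vanishes⇒defined v = AbelianGroup.ε (modpH 𝒢 2) , v
  cups⇒vanishes : AbelianGroup._≈_ (modpH 𝒢 2) (cup (modpCochains 𝒢) {1} {1} χ₁ χ₂) (AbelianGroup.ε (modpH 𝒢 2)) ×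
                  AbelianGroup._≈_ (modpH 𝒢 2) (cup (modpCochains 𝒢) {1} {1} χ₂ χ₃) (AbelianGroup.ε (modpH 𝒢 2)) →
                  MasseyVanishes (modpCochains 𝒢) (χ₁ ∷ χ₂ ∷ χ₃ ∷ [])
  cups⇒vanishes (c , c′) = cups-zero⇒vanishes 𝒢 χ₁ χ₂ χ₃ p-prime hilbert90 c c′
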